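{- Let $\delta$ be a positive integer and let $\beta,\nu$ be real numbers with $\nu>0$. Let $(T_n(x))_{n\ge\delta-1}$ be polynomials with $T_{\delta-1}(x)=1$, $\deg(T_n(x))=n-\delta+1$, and, for $n\ge\delta-1$, $$T_{n+1}(x)=\bigl((n-\delta+1)\nu x^2+\beta x+\beta+(n-\delta+1)\nu\bigr)T_n(x)+\nu\bigl(-x^3+x^2-x+1\bigr)\frac{d}{dx}T_n(x).$$ Then: (i) the exponential generating function is $$\sum_{n\ge0}T_{n+\delta-1}(x)\frac{t^n}{n!}=\frac{(1-x)^{\beta/\nu}}{\bigl[(1-x)\cos(\nu(1-x)t)-(1+x)\sin(\nu(1-x)t)\bigr]^{\beta/\nu}};$$ (ii) the ordinary generating function has the Jacobi continued fraction expansion $$\sum_{n=0}^{\infty}T_{n+\delta-1}(x)t^n=\cfrac{1}{1-r_0t-\cfrac{s_1t^2}{1-r_1t-\cfrac{s_2t^2}{1-r_2t-\cdots}}},$$ where $r_i=(2\nu i+\beta)(1+x)$ for $i\ge0$ and $s_i=2\nu i[\beta+\nu(i-1)](1+x^2)$ for $i\ge 1$; (iii) the polynomial sequence $(T_n(q))_{n\ge\delta-1}$ is strongly $q$-log-convex for $\beta\ge0$; (iv) the polynomial $T_n(x)$ is not $\gamma$-positive for $n\ge\delta+2$ and $\beta\ge0$.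
   Context: The right-hand side of (i) is understood as a formal power series in $t$ (for $x\ne1$), namely $\bigl[\cos(\nu(1-x)t)-\frac{1+x}{1-x}\sin(\nu(1-x)t)\bigr]^{ -\beta/\nu}$. A polynomial sequence $(f_n(q))_{n\ge0}$ is strongly $q$-log-convex if $f_{n+1}(q)f_{m-1}(q)-f_n(q)f_m(q)$ has only nonnegative coefficients for all $n\ge m\ge1$ (here applied to $f_n=T_{n+\delta-1}$). A symmetric polynomial $f$ of degree $d$ (that is, $f(x)=x^df(1/x)$) is $\gamma$-positive if in the expansion $f(x)=\sum_{k=0}^{\lfloor d/2\rfloor}g_kx^k(1+x)^{d-2k}$ all $g_k\ge0$. Note that the degree hypothesis forces $\beta\neq 0$. -}

module Defs where

open import Level using (Level; _⊔_) renaming (suc to lsuc)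
open import Algebra.Apartness.Bundles using (HeytingField; HeytingCommutativeRing)
open import Algebra.Bundles using (CommutativeRing)
open import Algebra.Bundles.Raw using (RawRing)
import Algebra.Definitions.RawMonoid as RawMonoidOps
import Algebra.Definitions.RawSemiring as RawSemiringOps
open import Data.Fin.Base using (toℕ)
open import Data.List.Base using (List; []; _∷_; map)
open import Data.Nat.Base as ℕ using (ℕ; zero; suc; ⌊_/2⌋; _!)
open import Data.Nat.Properties using (_!≢0)
open import Data.Product.Base using (Σ-syntax; ∃-syntax; _×_; _,_; proj₁; proj₂)
open import Data.Sum.Base using (_⊎_; inj₁; inj₂)
open import Function.Base using (_∘_)
open import Function.Bundles using (_⇔_; Equivalence)
open import Relation.Binary.Core using (Rel)
open import Relation.Binary.Structures using (IsStrictPartialOrder)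
open import Relation.Nullary.Negation.Core using (¬_)

-- The real numbers, given axiomatically as a Cauchy-complete Archimedean
-- ordered Heyting field.  Classically this is ℝ, up to isomorphism; the axioms
-- are phrased so that they also hold constructively, with x # y in the role
-- of x ≠ y and no decidability of the order.

record RealNumbers c ℓ₁ ℓ₂ ℓ₃ : Set (lsuc (c ⊔ ℓ₁ ⊔ ℓ₂ ⊔ ℓ₃)) where
  field
    heytingField : HeytingField c ℓ₁ ℓ₂

  open HeytingField heytingField public

  rawRing : RawRing c ℓ₁
  rawRing = CommutativeRing.rawRing
    (HeytingCommutativeRing.commutativeRing heytingCommutativeRing)

  nat : ℕ → Carrier
  nat n = RawMonoidOps._×_ (RawRing.+-rawMonoid rawRing) n 1#

  infix 4 _<_ _≤_

  field
    _<_                  : Rel Carrier ℓ₃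
    isStrictPartialOrder : IsStrictPartialOrder _≈_ _<_
    #⇔<                  : ∀ {x y} → x # y ⇔ (x < y ⊎ y < x)
    0<1                  : 0# < 1#
    +-monoˡ-<            : ∀ {x y} z → x < y → x + z < y + z
    *-pos                : ∀ {x y} → 0# < x → 0# < y → 0# < x * y
    archimedean          : ∀ x → ∃[ n ] x < nat n
    complete             : (a : ℕ → Carrier) →
      (∀ ε → 0# < ε → ∃[ N ] ∀ m n → m ℕ.≥ N → n ℕ.≥ N → a m < a n + ε) →
      ∃[ l ] ∀ ε → 0# < ε → ∃[ N ] ∀ n → n ℕ.≥ N →
        (a n < l + ε) × (l < a n + ε)

  _≤_ : Rel Carrier ℓ₃
  x ≤ y = ¬ (y < x)

-- Formal power series in t: the coefficient of tⁿ in f is f n.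

module PowerSeries {c ℓ} (S : RawRing c ℓ) where
  open RawRing S
  open RawMonoidOps +-rawMonoid using (sum)

  Series : Set c
  Series = ℕ → Carrier

  infix  4 _≈ₛ_
  infixl 6 _+ₛ_ _-ₛ_
  infixl 7 _*ₛ_ _•ₛ_
  infixr 8 _^ₛ_

  _≈ₛ_ : Rel Series ℓ
  f ≈ₛ g = ∀ n → f n ≈ g n

  sum≤ : ℕ → (ℕ → Carrier) → Carrier
  sum≤ n f = sum {suc n} (f ∘ toℕ)

  _+ₛ_ _-ₛ_ _*ₛ_ : Series → Series → Series
  (f +ₛ g) n = f n + g n
  (f -ₛ g) n = f n + (- g n)
  (f *ₛ g) n = sum≤ n (λ k → f k * g (n ℕ.∸ k))

  _•ₛ_ : Carrier → Series → Series
  (a •ₛ f) n = a * f n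

  -- a ·t^ k is the series a tᵏ.
  infix 9 _·t^_
  _·t^_ : Carrier → ℕ → Series
  (a ·t^ zero)  zero    = a
  (a ·t^ zero)  (suc n) = 0#
  (a ·t^ suc k) zero    = 0#
  (a ·t^ suc k) (suc n) = (a ·t^ k) n

  1ₛ : Series
  1ₛ = 1# ·t^ 0

  _^ₛ_ : Series → ℕ → Series
  f ^ₛ zero  = 1ₛ
  f ^ₛ suc k = f *ₛ f ^ₛ k

  -- 1/(1 - u) = Σₖ uᵏ, for u without constant term; the powers uᵏ with k > n
  -- do not contribute to the coefficient of tⁿ.
  1/1-_ : Series → Series
  (1/1- u) n = sum≤ n (λ k → (u ^ₛ k) n)

  -- The finite continued fraction
  --   1/(1 - rᵢ t - sᵢ₊₁ t²/(1 - rᵢ₊₁ t - ⋯ - sᵢ₊ₘ t²/(1 - rᵢ₊ₘ t))).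
  convergent : (r s : ℕ → Carrier) → ℕ → ℕ → Series
  convergent r s zero    i = 1/1- (r i ·t^ 1)
  convergent r s (suc m) i =
    1/1- (r i ·t^ 1 +ₛ s (suc i) ·t^ 2 *ₛ convergent r s m (suc i))

  -- The convergents tend to f in the t-adic topology.  The value s 0 is unused.
  HasJFraction : Series → (r s : ℕ → Carrier) → Set ℓ
  HasJFraction f r s =
    ∀ n → ∃[ N ] ∀ m → m ℕ.≥ N → convergent r s m 0 n ≈ f n

module Notions {c ℓ₁ ℓ₂ ℓ₃} (ℝ : RealNumbers c ℓ₁ ℓ₂ ℓ₃) where
  open RealNumbers ℝ
  open RawSemiringOps (RawRing.rawSemiring rawRing) using (_^_)
  private module < = IsStrictPartialOrder isStrictPartialOrder

  infixl 7 _/_⟨_⟩ _/ℕ_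

  _/_⟨_⟩ : Carrier → (y : Carrier) → y # 0# → Carrier
  x / y ⟨ y#0 ⟩ = x * proj₁ (#⇒invertible y#0)

  pos⇒#0 : ∀ {x} → 0# < x → x # 0#
  pos⇒#0 0<x = Equivalence.from #⇔< (inj₂ 0<x)

  #1⇒1-x#0 : ∀ {x} → x # 1# → 1# - x # 0#
  #1⇒1-x#0 {x} x#1 with #⇒invertible (#-sym x#1)
  ... | z , zy≈1 , yz≈1 = invertible⇒#
    (z , trans (*-congˡ minus0) zy≈1 , trans (*-congʳ minus0) yz≈1)
    where
    -0≈0 : - 0# ≈ 0#
    -0≈0 = trans (sym (+-identityˡ (- 0#))) (-‿inverseʳ 0#)
    minus0 : (1# - x) - 0# ≈ 1# - x
    minus0 = trans (+-congˡ -0≈0) (+-identityʳ (1# - x))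

  nat-pos : ∀ n → 0# < nat (suc n)
  nat-pos zero    = <.<-respʳ-≈ (sym (+-identityʳ 1#)) 0<1
  nat-pos (suc n) = <.trans (nat-pos n)
    (<.<-respˡ-≈ (+-identityˡ _) (+-monoˡ-< (nat (suc n)) 0<1))

  _/ℕ_ : Carrier → (n : ℕ) → .{{ℕ.NonZero n}} → Carrier
  x /ℕ suc n = x / nat (suc n) ⟨ pos⇒#0 (nat-pos n) ⟩

  -- Polynomials as coefficient lists, lowest degree first, compared
  -- coefficientwise, so that trailing zeros are immaterial.

  Poly : Set c
  Poly = List Carrier

  coeff : Poly → ℕ → Carrier
  coeff []      i       = 0#
  coeff (a ∷ p) zero    = a
  coeff (a ∷ p) (suc i) = coeff p i

  infix  4 _≈ₚ_
  infixl 6 _+ₚ_ _-ₚ_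
  infixl 7 _*ₚ_ _•ₚ_
  infix  8 -ₚ_

  _≈ₚ_ : Rel Poly ℓ₁
  p ≈ₚ q = ∀ i → coeff p i ≈ coeff q i

  _+ₚ_ : Poly → Poly → Poly
  []      +ₚ q       = q
  (a ∷ p) +ₚ []      = a ∷ p
  (a ∷ p) +ₚ (b ∷ q) = a + b ∷ p +ₚ q

  _•ₚ_ : Carrier → Poly → Poly
  a •ₚ p = map (a *_) p

  _*ₚ_ : Poly → Poly → Poly
  []      *ₚ q = []
  (a ∷ p) *ₚ q = a •ₚ q +ₚ (0# ∷ p *ₚ q)

  -ₚ_ : Poly → Poly
  -ₚ p = map -_ p

  _-ₚ_ : Poly → Poly → Poly
  p -ₚ q = p +ₚ -ₚ q

  const : Carrier → Poly
  const a = a ∷ []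

  1ₚ X : Poly
  1ₚ = const 1#
  X  = 0# ∷ 1# ∷ []

  polyRing : RawRing c ℓ₁
  polyRing = record
    { Carrier = Poly ; _≈_ = _≈ₚ_ ; _+_ = _+ₚ_ ; _*_ = _*ₚ_
    ; -_ = -ₚ_ ; 0# = [] ; 1# = 1ₚ }

  open RawSemiringOps (RawRing.rawSemiring polyRing) public
    using () renaming (_^_ to infixr 8 _^ₚ_)

  -- (a + x p)′ = p + x p′
  derivative : Poly → Poly
  derivative []      = []
  derivative (a ∷ p) = p +ₚ (0# ∷ derivative p)

  eval : Poly → Carrier → Carrier
  eval []      x = 0#
  eval (a ∷ p) x = a + x * eval p x

  HasDegree : Poly → ℕ → Set (ℓ₁ ⊔ ℓ₂)
  HasDegree p d = (coeff p d # 0#) × (∀ i → i ℕ.> d → coeff p i ≈ 0#)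

  module Series  = PowerSeries rawRing
  module SeriesP = PowerSeries polyRing

  open Series using (Series; _-ₛ_; 1ₛ; _^ₛ_; sum≤)

  egf : (ℕ → Carrier) → Series
  egf a n = _/ℕ_ (a n) (n !) {{n !≢0}}

  -- The values at 0 of the n-th derivatives of cos and sin.
  cos⁽_⁾ sin⁽_⁾ : ℕ → Carrier
  cos⁽ 0 ⁾           = 1#
  cos⁽ 1 ⁾           = 0#
  cos⁽ suc (suc n) ⁾ = - cos⁽ n ⁾
  sin⁽ 0 ⁾           = 0#
  sin⁽ 1 ⁾           = 1#
  sin⁽ suc (suc n) ⁾ = - sin⁽ n ⁾

  cos[_t] sin[_t] : Carrier → Series
  cos[ a t] = egf (λ n → cos⁽ n ⁾ * a ^ n)
  sin[ a t] = egf (λ n → sin⁽ n ⁾ * a ^ n)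

  fallingFactorial : Carrier → ℕ → Carrier
  fallingFactorial a zero    = 1#
  fallingFactorial a (suc k) = fallingFactorial a k * (a - nat k)

  binomial : Carrier → ℕ → Carrier
  binomial a k = _/ℕ_ (fallingFactorial a k) (k !) {{k !≢0}}

  -- f to a real power a, for f with constant term 1, by the binomial series
  -- Σₖ (a choose k) (f - 1)ᵏ; the terms with k > n do not contribute to the
  -- coefficient of tⁿ.
  _^ᵣ_ : Series → Carrier → Series
  (f ^ᵣ a) n = sum≤ n (λ k → binomial a k * ((f -ₛ 1ₛ) ^ₛ k) n)

  NonNegCoeffs : Poly → Set ℓ₃
  NonNegCoeffs p = ∀ i → 0# ≤ coeff p i

  StronglyQLogConvex : (ℕ → Poly) → Set ℓ₃
  StronglyQLogConvex f = ∀ n m → n ℕ.≥ m → m ℕ.≥ 1 →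
    NonNegCoeffs (f (n ℕ.+ 1) *ₚ f (m ℕ.∸ 1) -ₚ f n *ₚ f m)

  -- f(x) = xᵈ f(1/x), for f of degree d
  Symmetric : Poly → ℕ → Set ℓ₁
  Symmetric f d = ∀ i → i ℕ.≤ d → coeff f i ≈ coeff f (d ℕ.∸ i)

  γ-Positive : Poly → Set (c ⊔ ℓ₁ ⊔ ℓ₂ ⊔ ℓ₃)
  γ-Positive f = ∃[ d ] HasDegree f d × Symmetric f d ×
    (Σ[ g ∈ (ℕ → Carrier) ]
      (f ≈ₚ SeriesP.sum≤ ⌊ d /2⌋
              (λ k → g k •ₚ (X ^ₚ k *ₚ (1ₚ +ₚ X) ^ₚ (d ℕ.∸ 2 ℕ.* k)))) ×
      (∀ k → k ℕ.≤ ⌊ d /2⌋ → 0# ≤ g k))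

{-# OPTIONS --safe #-}

-- Write f n for T (n + δ - 1). With h = 1 + x and a = 1 - x, f n is the value at h
-- of the polynomial P n in h (and a) given by
--   P 0 = 1,  P (n + 1) = β h P n + ν (h² + a²) ∂P n/∂h,
-- that is, of the n-th derivative of Φ = F^(-β/ν) divided by Φ, for F the function
-- in (i), when h solves h′ = ν (h² + a²). The array A n k = ∂ᵏP n/∂hᵏ satisfies the
-- three-term recurrence
--   A (n + 1) k = (β + 2νk)(1 + x) A n k + 2ν(1 + x²) A n (k + 1) + k(β + ν(k - 1)) A n (k - 1),
-- and since P n is homogeneous of degree n in h and a, Euler's identity gives
--   (1 - x) (A n k)′ + (n - k) A n k = 2 A n (k + 1),
-- which for k = 0 turns the three-term recurrence into the given recurrence of f.
-- So f n = A n 0, and everything is read off the array: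
-- (i) the exponential generating function of column k is Π_{j<k} (β + νj) Φ gᵏ with
--     g = sin(ν(1-x)t) / (ν(1-x) F), because g′ = F⁻² is a Riccati equation;
-- (ii) column 0 of a three-term array has a J-fraction;
-- (iii) f (n+1) f (m-1) - f n f m is 2ν(1 + x²) times a 2 × 2 minor of the array, and
--     these minors are nonnegative because those of the tridiagonal matrix of the
--     recurrence are;
-- (iv) f n is a combination of the (1 + x)^(n-2j) (1 + x²)^j with nonnegative
--     coefficients, and since 1 + x² = (1 + x)² - 2x, its γ-coefficient of index 1 is
--     negative.
module Submission where

-- The given recurrence mixes T n with its x-derivative. Differentiating in `h` with `a` fixed
-- avoids this: h² + a² = 2(1 + x²) is quadratic in `h`, so k-fold Leibniz only reaches the columns
-- k - 1, k and k + 1. Euler's identity brings d/dx back, since d/dx = ∂/∂h - ∂/∂a and h + a = 2.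
-- Neither P n nor ∂/∂h is formed, however: the array is defined by its recurrence, and Euler's
-- identity is proved for it by induction on n from relations between the coefficients of the
-- recurrence. Two obstacles shape the rest. Over coefficient lists and convolution sums the ring
-- solver would not see variables, so the identities are proved in an arbitrary commutative ring,
-- mostly with an abstract derivation, and then specialized. And the order of the reals is not
-- decidable: 0 ≤ x is a negation, so closure of nonnegativity under sums rests on tightness of
-- apartness, while strict positivity must come from a strictly positive summand. In (iv) its source
-- is β, the leading coefficient of the first nonconstant T n.

open import Defs
open import Algebra.Apartness.Bundles using (HeytingCommutativeRing)
open import Algebra.Bundles using (CommutativeRing)
open import Algebra.Bundles.Raw using (RawRing)
import Algebra.Definitions.RawMonoid as RawMonoidOps
import Algebra.Definitions.RawSemiring as RawSemiringOps
import Algebra.Properties.AbelianGroup as AbelianGroupProperties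
import Algebra.Properties.Ring as RingProperties
import Algebra.Properties.Semiring.Mult as SemiringMult
import Algebra.Solver.Ring
open import Algebra.Solver.Ring.AlmostCommutativeRing
  using (fromCommutativeRing; _-Raw-AlmostCommutative⟶_; Induced-equivalence)
open import Data.Empty using (⊥-elim)
open import Data.Integer.Base as ℤ using (ℤ; +_; -[1+_]; _⊖_)
import Data.Integer.Properties as ℤ
open import Data.List.Base using ([]; _∷_)
open import Data.Maybe.Base using (just; nothing)
open import Data.Nat.Base as ℕ using (ℕ; zero; suc; pred; z≤n; s≤s; ⌊_/2⌋; _!)
import Data.Nat.Properties as ℕ
open import Data.Product.Base using (_×_; _,_; proj₁; proj₂)
open import Data.Sum.Base using (inj₁; inj₂)
open import Function.Bundles using (Equivalence)
open import Relation.Binary.Definitions using (WeaklyDecidable; tri<; tri≈; tri>)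
import Relation.Binary.PropositionalEquality as ≡
import Relation.Binary.Reasoning.Setoid as SetoidReasoning
open import Relation.Binary.Structures using (IsStrictPartialOrder)
open import Relation.Nullary.Decidable using (yes; no)
open import Relation.Nullary.Negation.Core using (¬_)
open import Relation.Unary using (Pred)
open ≡ using (_≡_)

-- Ring solver with integer coefficients

-- Integer coefficients let the solver cancel terms without deciding equality in R.
module IntegerSolver {c ℓ} (R : CommutativeRing c ℓ) where
  open CommutativeRing R
  open RingProperties ring using (-‿distribˡ-*; -0#≈0#; -‿involutive)
  open AbelianGroupProperties +-abelianGroup using (⁻¹-∙-comm)
  open SetoidReasoning setoid

  -- The clause for 1 makes the solver's constant 1 denote 1# itself.
  fromℕ : ℕ → Carrier
  fromℕ 0             = 0#
  fromℕ 1             = 1#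
  fromℕ (suc (suc n)) = fromℕ (suc n) + 1#

  fromℤ : ℤ → Carrier
  fromℤ (+ n)    = fromℕ n
  fromℤ -[1+ n ] = - fromℕ (suc n)

  fromℕ-suc : ∀ n → fromℕ (suc n) ≈ fromℕ n + 1#
  fromℕ-suc zero    = sym (+-identityˡ 1#)
  fromℕ-suc (suc n) = refl

  fromℕ-+ : ∀ m n → fromℕ (m ℕ.+ n) ≈ fromℕ m + fromℕ n
  fromℕ-+ zero    n = sym (+-identityˡ _)
  fromℕ-+ (suc m) n = begin
    fromℕ (suc m ℕ.+ n)       ≈⟨ fromℕ-suc (m ℕ.+ n) ⟩
    fromℕ (m ℕ.+ n) + 1#      ≈⟨ +-congʳ (fromℕ-+ m n) ⟩
    fromℕ m + fromℕ n + 1#    ≈⟨ +-assoc _ _ _ ⟩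
    fromℕ m + (fromℕ n + 1#)  ≈⟨ +-congˡ (+-comm _ _) ⟩
    fromℕ m + (1# + fromℕ n)  ≈⟨ +-assoc _ _ _ ⟨
    fromℕ m + 1# + fromℕ n    ≈⟨ +-congʳ (fromℕ-suc m) ⟨
    fromℕ (suc m) + fromℕ n   ∎

  fromℕ-* : ∀ m n → fromℕ (m ℕ.* n) ≈ fromℕ m * fromℕ n
  fromℕ-* zero    n = sym (zeroˡ _)
  fromℕ-* (suc m) n = begin
    fromℕ (n ℕ.+ m ℕ.* n)                ≈⟨ fromℕ-+ n (m ℕ.* n) ⟩
    fromℕ n + fromℕ (m ℕ.* n)            ≈⟨ +-cong (sym (*-identityˡ _)) (fromℕ-* m n) ⟩
    1# * fromℕ n + fromℕ m * fromℕ n     ≈⟨ distribʳ _ _ _ ⟨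
    (1# + fromℕ m) * fromℕ n             ≈⟨ *-congʳ (+-comm _ _) ⟩
    (fromℕ m + 1#) * fromℕ n             ≈⟨ *-congʳ (fromℕ-suc m) ⟨
    fromℕ (suc m) * fromℕ n              ∎

  fromℤ-neg : ∀ i → fromℤ (ℤ.- i) ≈ - fromℤ i
  fromℤ-neg (+ zero)  = sym -0#≈0#
  fromℤ-neg (+ suc n) = refl
  fromℤ-neg -[1+ n ]  = sym (-‿involutive _)

  cancel-suc : ∀ x y → (x + 1#) + - (y + 1#) ≈ x + - y
  cancel-suc x y = begin
    (x + 1#) + - (y + 1#)    ≈⟨ +-congˡ (⁻¹-∙-comm y 1#) ⟨
    (x + 1#) + (- y + - 1#)  ≈⟨ +-congˡ (+-comm _ _) ⟩
    (x + 1#) + (- 1# + - y)  ≈⟨ +-assoc _ _ _ ⟨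
    ((x + 1#) + - 1#) + - y  ≈⟨ +-congʳ (+-assoc _ _ _) ⟩
    (x + (1# + - 1#)) + - y  ≈⟨ +-congʳ (+-congˡ (-‿inverseʳ 1#)) ⟩
    (x + 0#) + - y           ≈⟨ +-congʳ (+-identityʳ x) ⟩
    x + - y                  ∎

  fromℤ-⊖ : ∀ m n → fromℤ (m ⊖ n) ≈ fromℕ m + - fromℕ n
  fromℤ-⊖ m       zero    = sym (trans (+-congˡ -0#≈0#) (+-identityʳ _))
  fromℤ-⊖ zero    (suc n) = sym (+-identityˡ _)
  fromℤ-⊖ (suc m) (suc n) = begin
    fromℤ (suc m ⊖ suc n)               ≡⟨ ≡.cong fromℤ (ℤ.[1+m]⊖[1+n]≡m⊖n m n) ⟩
    fromℤ (m ⊖ n)                       ≈⟨ fromℤ-⊖ m n ⟩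
    fromℕ m + - fromℕ n                 ≈⟨ cancel-suc _ _ ⟨
    (fromℕ m + 1#) + - (fromℕ n + 1#)   ≈⟨ +-cong (fromℕ-suc m) (-‿cong (fromℕ-suc n)) ⟨
    fromℕ (suc m) + - fromℕ (suc n)     ∎

  fromℤ-+ : ∀ i j → fromℤ (i ℤ.+ j) ≈ fromℤ i + fromℤ j
  fromℤ-+ (+ m)    (+ n)    = fromℕ-+ m n
  fromℤ-+ (+ m)    -[1+ n ] = fromℤ-⊖ m (suc n)
  fromℤ-+ -[1+ m ] (+ n)    = trans (fromℤ-⊖ n (suc m)) (+-comm _ _)
  fromℤ-+ -[1+ m ] -[1+ n ] = begin
    - fromℕ (suc (suc (m ℕ.+ n)))       ≡⟨ ≡.cong (λ k → - fromℕ (suc k)) (≡.sym (ℕ.+-suc m n)) ⟩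
    - fromℕ (suc m ℕ.+ suc n)           ≈⟨ -‿cong (fromℕ-+ (suc m) (suc n)) ⟩
    - (fromℕ (suc m) + fromℕ (suc n))   ≈⟨ ⁻¹-∙-comm _ _ ⟨
    - fromℕ (suc m) + - fromℕ (suc n)   ∎

  fromℤ-*-pos : ∀ m j → fromℤ (+ m ℤ.* j) ≈ fromℕ m * fromℤ j
  fromℤ-*-pos m (+ n)    = trans (reflexive (≡.cong fromℤ (≡.sym (ℤ.pos-* m n)))) (fromℕ-* m n)
  fromℤ-*-pos m -[1+ n ] = begin
    fromℤ (+ m ℤ.* (ℤ.- + suc n))    ≡⟨ ≡.cong fromℤ (ℤ.neg-distribʳ-* (+ m) (+ suc n)) ⟨
    fromℤ (ℤ.- (+ m ℤ.* + suc n))    ≈⟨ fromℤ-neg (+ m ℤ.* + suc n) ⟩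
    - fromℤ (+ m ℤ.* + suc n)        ≈⟨ -‿cong (fromℤ-*-pos m (+ suc n)) ⟩
    - (fromℕ m * fromℕ (suc n))      ≈⟨ RingProperties.-‿distribʳ-* ring _ _ ⟩
    fromℕ m * - fromℕ (suc n)        ∎

  fromℤ-* : ∀ i j → fromℤ (i ℤ.* j) ≈ fromℤ i * fromℤ j
  fromℤ-* (+ m)    j = fromℤ-*-pos m j
  fromℤ-* -[1+ m ] j = begin
    fromℤ ((ℤ.- + suc m) ℤ.* j)  ≡⟨ ≡.cong fromℤ (ℤ.neg-distribˡ-* (+ suc m) j) ⟨
    fromℤ (ℤ.- (+ suc m ℤ.* j))  ≈⟨ fromℤ-neg (+ suc m ℤ.* j) ⟩
    - fromℤ (+ suc m ℤ.* j)      ≈⟨ -‿cong (fromℤ-*-pos (suc m) j) ⟩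
    - (fromℕ (suc m) * fromℤ j)  ≈⟨ -‿distribˡ-* _ _ ⟩
    - fromℕ (suc m) * fromℤ j    ∎

  morphism : ℤ.+-*-rawRing -Raw-AlmostCommutative⟶ fromCommutativeRing R
  morphism = record
    { ⟦_⟧ = fromℤ ; +-homo = fromℤ-+ ; *-homo = fromℤ-* ; -‿homo = fromℤ-neg
    ; 0-homo = refl ; 1-homo = refl }

  _≟_ : WeaklyDecidable (Induced-equivalence morphism)
  i ≟ j with i ℤ.≟ j
  ... | yes ≡.refl = just refl
  ... | no  _      = nothing

  open Algebra.Solver.Ring ℤ.+-*-rawRing (fromCommutativeRing R) morphism _≟_ public
    using (Polynomial; con; solve; _:+_; _:*_; _:-_; :-_; _:=_)

-- The ring of formal power series; composition

module SeriesProperties {c ℓ} (R : CommutativeRing c ℓ) where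
  open CommutativeRing R
  open PowerSeries rawRing public
  open IntegerSolver R
  private module RawMonoid = RawMonoidOps +-rawMonoid
  open SetoidReasoning setoid

  -- This is (f - f 0)/t. The coefficient `suc n` of `f *ₛ g` unfolds definitionally to
  -- `f 0 * g (suc n) + (shift f *ₛ g) n`, which is why the inductions below run on the coefficient
  -- index with the series generalized.
  shift : Series → Series
  shift f n = f (suc n)

  0ₛ : Series
  0ₛ _ = 0#

  ⊝_ : Series → Series
  (⊝ f) n = - f n

  sum≤-cong : ∀ n (f g : Series) → f ≈ₛ g → sum≤ n f ≈ sum≤ n g
  sum≤-cong zero    f g f≈g = +-congʳ (f≈g 0)
  sum≤-cong (suc n) f g f≈g = +-cong (f≈g 0) (sum≤-cong n (shift f) (shift g) (λ k → f≈g (suc k)))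

  sum≤-0 : ∀ n (f : Series) → (∀ k → f k ≈ 0#) → sum≤ n f ≈ 0#
  sum≤-0 zero    f f≈0 = trans (+-congʳ (f≈0 0)) (+-identityʳ 0#)
  sum≤-0 (suc n) f f≈0 = trans (+-cong (f≈0 0) (sum≤-0 n (shift f) (λ k → f≈0 (suc k)))) (+-identityʳ 0#)

  sum≤-+ : ∀ n (f g : Series) → sum≤ n (f +ₛ g) ≈ sum≤ n f + sum≤ n g
  sum≤-+ zero    f g = solve 2 (λ a b → (a :+ b) :+ con (+ 0) := (a :+ con (+ 0)) :+ (b :+ con (+ 0))) refl (f 0) (g 0)
  sum≤-+ (suc n) f g = trans (+-congˡ (sum≤-+ n (shift f) (shift g)))
    (solve 4 (λ a b s t → (a :+ b) :+ (s :+ t) := (a :+ s) :+ (b :+ t)) refl (f 0) (g 0) _ _)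

  sum≤-*ˡ : ∀ n a (f : Series) → sum≤ n (a •ₛ f) ≈ a * sum≤ n f
  sum≤-*ˡ zero    a f = solve 2 (λ a b → a :* b :+ con (+ 0) := a :* (b :+ con (+ 0))) refl a (f 0)
  sum≤-*ˡ (suc n) a f = trans (+-congˡ (sum≤-*ˡ n a (shift f))) (sym (distribˡ a _ _))

  sum≤-last : ∀ n (f : Series) → sum≤ (suc n) f ≈ sum≤ n f + f (suc n)
  sum≤-last zero    f = solve 2 (λ a b → a :+ (b :+ con (+ 0)) := (a :+ con (+ 0)) :+ b) refl (f 0) (f 1)
  sum≤-last (suc n) f = trans (+-congˡ (sum≤-last n (shift f))) (sym (+-assoc _ _ _))

  *ₛ-cong : ∀ {f f′ g g′} → f ≈ₛ f′ → g ≈ₛ g′ → f *ₛ g ≈ₛ f′ *ₛ g′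
  *ₛ-cong {f} {f′} {g} {g′} f≈ g≈ n = sum≤-cong n (λ k → f k * g (n ℕ.∸ k)) (λ k → f′ k * g′ (n ℕ.∸ k))
    (λ k → *-cong (f≈ k) (g≈ (n ℕ.∸ k)))

  *ₛ-zeroˡ : ∀ {f} g → (∀ n → f n ≈ 0#) → ∀ n → (f *ₛ g) n ≈ 0#
  *ₛ-zeroˡ {f} g f≈0 n = sum≤-0 n (λ k → f k * g (n ℕ.∸ k))
    (λ k → trans (*-congʳ (f≈0 k)) (zeroˡ (g (n ℕ.∸ k))))

  *ₛ-distribʳ : ∀ h f g → (f +ₛ g) *ₛ h ≈ₛ f *ₛ h +ₛ g *ₛ h
  *ₛ-distribʳ h f g n = trans
    (sum≤-cong n (λ k → (f k + g k) * h (n ℕ.∸ k)) (λ k → f k * h (n ℕ.∸ k) + g k * h (n ℕ.∸ k))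
      (λ k → distribʳ (h (n ℕ.∸ k)) (f k) (g k)))
    (sum≤-+ n (λ k → f k * h (n ℕ.∸ k)) (λ k → g k * h (n ℕ.∸ k)))

  •ₛ-*ₛ-assoc : ∀ a f g → (a •ₛ f) *ₛ g ≈ₛ a •ₛ (f *ₛ g)
  •ₛ-*ₛ-assoc a f g n = trans
    (sum≤-cong n (λ k → a * f k * g (n ℕ.∸ k)) (λ k → a * (f k * g (n ℕ.∸ k)))
      (λ k → *-assoc a (f k) (g (n ℕ.∸ k))))
    (sum≤-*ˡ n a (λ k → f k * g (n ℕ.∸ k)))

  -- The mirror image of the definitional unfolding, splitting off the last summand instead of the
  -- first; commutativity comes from playing one against the other.
  *ₛ-sucʳ : ∀ f g n → (f *ₛ g) (suc n) ≈ (f *ₛ shift g) n + f (suc n) * g 0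
  *ₛ-sucʳ f g zero    = solve 4 (λ a b c d → a :* b :+ (c :* d :+ con (+ 0)) := (a :* b :+ con (+ 0)) :+ c :* d)
    refl (f 0) (g 1) (f 1) (g 0)
  *ₛ-sucʳ f g (suc n) = trans (+-congˡ (*ₛ-sucʳ (shift f) g n)) (sym (+-assoc _ _ _))

  *ₛ-comm : ∀ f g → f *ₛ g ≈ₛ g *ₛ f
  *ₛ-comm f g zero    = +-congʳ (*-comm _ _)
  *ₛ-comm f g (suc n) = begin
    f 0 * g (suc n) + (shift f *ₛ g) n  ≈⟨ +-cong (*-comm _ _) (*ₛ-comm (shift f) g n) ⟩
    g (suc n) * f 0 + (g *ₛ shift f) n  ≈⟨ +-comm _ _ ⟩
    (g *ₛ shift f) n + g (suc n) * f 0  ≈⟨ *ₛ-sucʳ g f n ⟨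
    (g *ₛ f) (suc n)                    ∎

  -- No double sum is reindexed: `shift (f *ₛ g)` is by definition `f 0 •ₛ shift g +ₛ shift f *ₛ g`,
  -- so induction closes after distributing.
  *ₛ-assoc : ∀ f g h → (f *ₛ g) *ₛ h ≈ₛ f *ₛ (g *ₛ h)
  *ₛ-assoc f g h zero    = solve 3
    (λ a b c → (a :* b :+ con (+ 0)) :* c :+ con (+ 0) := a :* (b :* c :+ con (+ 0)) :+ con (+ 0))
    refl (f 0) (g 0) (h 0)
  *ₛ-assoc f g h (suc n) = begin
    (f 0 * g 0 + 0#) * h (suc n) + (((f 0 •ₛ shift g) +ₛ (shift f *ₛ g)) *ₛ h) n
      ≈⟨ +-congˡ (trans (*ₛ-distribʳ h (f 0 •ₛ shift g) (shift f *ₛ g) n)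
           (+-cong (•ₛ-*ₛ-assoc (f 0) (shift g) h n) (*ₛ-assoc (shift f) g h n))) ⟩
    (f 0 * g 0 + 0#) * h (suc n) + (f 0 * (shift g *ₛ h) n + (shift f *ₛ (g *ₛ h)) n)
      ≈⟨ solve 5 (λ a b x y z → (a :* b :+ con (+ 0)) :* x :+ (a :* y :+ z) := a :* (b :* x :+ y) :+ z)
           refl (f 0) (g 0) (h (suc n)) _ _ ⟩
    f 0 * (g 0 * h (suc n) + (shift g *ₛ h) n) + (shift f *ₛ (g *ₛ h)) n ∎

  ·t^0-* : ∀ a f n → (a ·t^ 0 *ₛ f) n ≈ a * f n
  ·t^0-* a f zero    = +-identityʳ _
  ·t^0-* a f (suc n) = trans (+-congˡ (*ₛ-zeroˡ f (λ _ → refl) n)) (+-identityʳ _)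

  ·t^suc-*-suc : ∀ a k f n → (a ·t^ suc k *ₛ f) (suc n) ≈ (a ·t^ k *ₛ f) n
  ·t^suc-*-suc a k f n = trans (+-congʳ (zeroˡ _)) (+-identityˡ _)

  ·t^suc-*-zero : ∀ a k f → (a ·t^ suc k *ₛ f) 0 ≈ 0#
  ·t^suc-*-zero a k f = trans (+-congʳ (zeroˡ _)) (+-identityˡ _)

  seriesRing : CommutativeRing c ℓ
  seriesRing = record
    { Carrier = Series ; _≈_ = _≈ₛ_ ; _+_ = _+ₛ_ ; _*_ = _*ₛ_ ; -_ = ⊝_ ; 0# = 0ₛ ; 1# = 1ₛ
    ; isCommutativeRing = record
      { isRing = record
        { +-isAbelianGroup = record
          { isGroup = record
            { isMonoid = record
              { isSemigroup = record
                { isMagma = record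
                  { isEquivalence = record
                    { refl = λ _ → refl ; sym = λ p n → sym (p n) ; trans = λ p q n → trans (p n) (q n) }
                  ; ∙-cong = λ p q n → +-cong (p n) (q n) }
                ; assoc = λ f g h n → +-assoc (f n) (g n) (h n) }
              ; identity = (λ f n → +-identityˡ (f n)) , (λ f n → +-identityʳ (f n)) }
            ; inverse = (λ f n → -‿inverseˡ (f n)) , (λ f n → -‿inverseʳ (f n))
            ; ⁻¹-cong = λ p n → -‿cong (p n) }
          ; comm = λ f g n → +-comm (f n) (g n) }
        ; *-cong = λ {f} {f′} {g} {g′} → *ₛ-cong {f} {f′} {g} {g′}
        ; *-assoc = *ₛ-assoc
        ; *-identity = identityˡ , λ f n → trans (*ₛ-comm f 1ₛ n) (identityˡ f n)
        ; distrib = (λ h f g n → trans (*ₛ-comm h (f +ₛ g) n) (trans (*ₛ-distribʳ h f g n)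
                      (+-cong (*ₛ-comm f h n) (*ₛ-comm g h n))))
                  , *ₛ-distribʳ
        }
      ; *-comm = *ₛ-comm } }
    where
    identityˡ : ∀ f → 1ₛ *ₛ f ≈ₛ f
    identityˡ f n = trans (·t^0-* 1# f n) (*-identityˡ (f n))

  module ₛ = CommutativeRing seriesRing

  -- Divisibility of `f` by tᵐ.
  Vanishes< : ℕ → Series → Set ℓ
  Vanishes< m f = ∀ n → n ℕ.< m → f n ≈ 0#

  *ₛ-vanishes : ∀ {m f} g → Vanishes< m f → Vanishes< m (g *ₛ f)
  *ₛ-vanishes {m} {f} g f≈0 zero    0<m = trans (+-identityʳ _) (trans (*-congˡ (f≈0 0 0<m)) (zeroʳ _))
  *ₛ-vanishes {m} {f} g f≈0 (suc n) n<m = trans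
    (+-cong (trans (*-congˡ (f≈0 (suc n) n<m)) (zeroʳ _)) (*ₛ-vanishes (shift g) f≈0 n (ℕ.<-trans (ℕ.n<1+n n) n<m)))
    (+-identityʳ 0#)

  *ₛ-vanishes-suc : ∀ {m f v} → v 0 ≈ 0# → Vanishes< m f → Vanishes< (suc m) (v *ₛ f)
  *ₛ-vanishes-suc {m} {f} {v} v₀≈0 f≈0 zero    _ = trans (+-identityʳ _) (trans (*-congʳ v₀≈0) (zeroˡ _))
  *ₛ-vanishes-suc {m} {f} {v} v₀≈0 f≈0 (suc n) (s≤s n<m) = trans
    (+-cong (trans (*-congʳ v₀≈0) (zeroˡ _)) (*ₛ-vanishes (shift v) f≈0 n n<m)) (+-identityʳ 0#)

  ^ₛ-vanishes : ∀ {v} → v 0 ≈ 0# → ∀ k → Vanishes< k (v ^ₛ k)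
  ^ₛ-vanishes     v₀≈0 zero    n ()
  ^ₛ-vanishes {v} v₀≈0 (suc k) = *ₛ-vanishes-suc {v = v} v₀≈0 (^ₛ-vanishes {v} v₀≈0 k)

  -- The composite b(v) for `v` without constant term: vᵏ is then divisible by tᵏ, so the truncation
  -- at k = n loses nothing. Geometric series and real powers are both of this form.
  compose : Series → Series → Series
  compose b v n = sum≤ n (λ k → b k * (v ^ₛ k) n)

  -- Inside the convolution the composite is truncated at a varying index. The sums can be brought
  -- to equal length because the extra term contains a power of `v` that vanishes in the degree
  -- concerned; this is where `v 0 ≈ 0#` enters.
  *ₛ-compose : ∀ {v} → v 0 ≈ 0# → ∀ g b n →
    (g *ₛ compose b v) n ≈ sum≤ n (λ k → b k * (g *ₛ v ^ₛ k) n)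
  *ₛ-compose {v} v₀≈0 g b zero    = solve 2
    (λ g b → g :* (b :* con (+ 1) :+ con (+ 0)) :+ con (+ 0) := b :* (g :* con (+ 1) :+ con (+ 0)) :+ con (+ 0))
    refl (g 0) (b 0)
  *ₛ-compose {v} v₀≈0 g b (suc n) = begin
    g 0 * sum≤ (suc n) (λ k → b k * (v ^ₛ k) (suc n)) + (shift g *ₛ compose b v) n
      ≈⟨ +-cong (sym (sum≤-*ˡ (suc n) (g 0) (λ k → b k * (v ^ₛ k) (suc n)))) (*ₛ-compose {v} v₀≈0 (shift g) b n) ⟩
    sum≤ (suc n) (λ k → g 0 * (b k * (v ^ₛ k) (suc n))) + sum≤ n u
      ≈⟨ +-congˡ (trans (sym (+-identityʳ _)) (+-congˡ (sym last≈0))) ⟩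
    sum≤ (suc n) (λ k → g 0 * (b k * (v ^ₛ k) (suc n))) + (sum≤ n u + u (suc n))
      ≈⟨ +-congˡ (sum≤-last n u) ⟨
    sum≤ (suc n) (λ k → g 0 * (b k * (v ^ₛ k) (suc n))) + sum≤ (suc n) u
      ≈⟨ sum≤-+ (suc n) (λ k → g 0 * (b k * (v ^ₛ k) (suc n))) u ⟨
    sum≤ (suc n) (λ k → g 0 * (b k * (v ^ₛ k) (suc n)) + u k)
      ≈⟨ sum≤-cong (suc n) (λ k → g 0 * (b k * (v ^ₛ k) (suc n)) + u k) (λ k → b k * (g *ₛ v ^ₛ k) (suc n))
           (λ k → solve 4 (λ g b x y → g :* (b :* x) :+ b :* y := b :* (g :* x :+ y))
           refl (g 0) (b k) ((v ^ₛ k) (suc n)) ((shift g *ₛ v ^ₛ k) n)) ⟩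
    sum≤ (suc n) (λ k → b k * (g *ₛ v ^ₛ k) (suc n)) ∎
    where
    u : Series
    u k = b k * (shift g *ₛ v ^ₛ k) n
    last≈0 : u (suc n) ≈ 0#
    last≈0 = trans (*-congˡ (*ₛ-vanishes (shift g) (^ₛ-vanishes {v} v₀≈0 (suc n)) n (ℕ.n<1+n n))) (zeroʳ _)

  -- Horner's scheme b(v) = b 0 + v c(v) with c = `shift b`. It lets the geometric series and the
  -- chain rule be treated without handling truncated sums again.
  compose-horner : ∀ {v} → v 0 ≈ 0# → ∀ b → compose b v ≈ₛ b 0 ·t^ 0 +ₛ v *ₛ compose (shift b) v
  compose-horner {v} v₀≈0 b zero    = begin
    b 0 * 1# + 0#             ≈⟨ +-cong (*-identityʳ _) (sym (trans (+-identityʳ _) (trans (*-congʳ v₀≈0) (zeroˡ _)))) ⟩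
    b 0 + (v 0 * _ + 0#)      ∎
  compose-horner {v} v₀≈0 b (suc n) = begin
    b 0 * 0# + sum≤ n (λ k → b (suc k) * (v *ₛ v ^ₛ k) (suc n))
      ≈⟨ +-cong (zeroʳ _) (sum≤-cong n (λ k → b (suc k) * (v *ₛ v ^ₛ k) (suc n))
           (λ k → b (suc k) * (shift v *ₛ v ^ₛ k) n)
           (λ k → *-congˡ {b (suc k)} (v-suc (v ^ₛ k)))) ⟩
    0# + sum≤ n (λ k → b (suc k) * (shift v *ₛ v ^ₛ k) n)
      ≈⟨ +-congˡ (*ₛ-compose {v} v₀≈0 (shift v) (shift b) n) ⟨
    0# + (shift v *ₛ compose (shift b) v) n
      ≈⟨ +-congˡ (v-suc (compose (shift b) v)) ⟨
    0# + (v *ₛ compose (shift b) v) (suc n) ∎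
    where
    v-suc : ∀ f → (v *ₛ f) (suc n) ≈ (shift v *ₛ f) n
    v-suc f = trans (+-congʳ (trans (*-congʳ v₀≈0) (zeroˡ _))) (+-identityˡ _)

  compose-cong : ∀ {b b′} v → b ≈ₛ b′ → compose b v ≈ₛ compose b′ v
  compose-cong {b} {b′} v b≈b′ n = sum≤-cong n (λ k → b k * (v ^ₛ k) n) (λ k → b′ k * (v ^ₛ k) n)
    (λ k → *-congʳ {(v ^ₛ k) n} (b≈b′ k))

  compose-+ : ∀ b b′ v → compose (b +ₛ b′) v ≈ₛ compose b v +ₛ compose b′ v
  compose-+ b b′ v n = trans
    (sum≤-cong n (λ k → (b k + b′ k) * (v ^ₛ k) n) (λ k → b k * (v ^ₛ k) n + b′ k * (v ^ₛ k) n)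
      (λ k → distribʳ ((v ^ₛ k) n) (b k) (b′ k)))
    (sum≤-+ n (λ k → b k * (v ^ₛ k) n) (λ k → b′ k * (v ^ₛ k) n))

  compose-• : ∀ a b v → compose (a •ₛ b) v ≈ₛ a •ₛ compose b v
  compose-• a b v n = trans
    (sum≤-cong n (λ k → a * b k * (v ^ₛ k) n) (λ k → a * (b k * (v ^ₛ k) n))
      (λ k → *-assoc a (b k) ((v ^ₛ k) n)))
    (sum≤-*ˡ n a (λ k → b k * (v ^ₛ k) n))

  1/1-≈ : ∀ {u} → u 0 ≈ 0# → 1/1- u ≈ₛ 1ₛ +ₛ u *ₛ 1/1- u
  1/1-≈ {u} u₀≈0 = ₛ.trans geometric
    (ₛ.trans (compose-horner u₀≈0 (λ _ → 1#)) (ₛ.+-congˡ {1ₛ} (ₛ.*-congˡ {u} (ₛ.sym geometric))))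
    where
    geometric : 1/1- u ≈ₛ compose (λ _ → 1#) u
    geometric n = sum≤-cong n (λ k → (u ^ₛ k) n) (λ k → 1# * (u ^ₛ k) n) (λ k → sym (*-identityˡ ((u ^ₛ k) n)))

  nat : ℕ → Carrier
  nat n = n RawMonoid.× 1#

  D θ : Series → Series
  θ f n = nat n * f n
  D f = shift (θ f)

  -- In coefficient n the weight n splits as k + (n - k) over the convolution. Since θ keeps every
  -- coefficient in place, the product rule is proved for it, and the one for `D` is read off by a
  -- shift.
  θ-*ₛ : ∀ f g → θ (f *ₛ g) ≈ₛ θ f *ₛ g +ₛ f *ₛ θ g
  θ-*ₛ f g zero    = solve 2
    (λ a b → con (+ 0) :* (a :* b :+ con (+ 0)) :=
         (con (+ 0) :* a :* b :+ con (+ 0)) :+ (a :* (con (+ 0) :* b) :+ con (+ 0)))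
    refl (f 0) (g 0)
  θ-*ₛ f g (suc n) = begin
    (1# + nat n) * (f 0 * g (suc n) + (f′ *ₛ g) n)
      ≈⟨ solve 4 (λ a b k y → (con (+ 1) :+ k) :* (a :* b :+ y) := k :* y :+ y :+ a :* ((con (+ 1) :+ k) :* b))
           refl (f 0) (g (suc n)) (nat n) _ ⟩
    nat n * (f′ *ₛ g) n + (f′ *ₛ g) n + f 0 * ((1# + nat n) * g (suc n))
      ≈⟨ +-congʳ (+-congʳ (θ-*ₛ f′ g n)) ⟩
    ((θ f′ *ₛ g) n + (f′ *ₛ θ g) n) + (f′ *ₛ g) n + f 0 * ((1# + nat n) * g (suc n))
      ≈⟨ solve 6 (λ x y z w a b → (x :+ y) :+ z :+ w := (con (+ 0) :* a :* b :+ (z :+ x)) :+ (w :+ y))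
           refl ((θ f′ *ₛ g) n) ((f′ *ₛ θ g) n) ((f′ *ₛ g) n) (f 0 * ((1# + nat n) * g (suc n))) (f 0) (g (suc n)) ⟩
    (0# * f 0 * g (suc n) + ((f′ *ₛ g) n + (θ f′ *ₛ g) n)) + (f 0 * ((1# + nat n) * g (suc n)) + (f′ *ₛ θ g) n)
      ≈⟨ +-congʳ (+-congˡ (trans (sym (*ₛ-distribʳ g f′ (θ f′) n)) (*ₛ-cong {g = g} shift-θ (λ _ → refl) n))) ⟩
    (0# * f 0 * g (suc n) + (shift (θ f) *ₛ g) n) + (f 0 * ((1# + nat n) * g (suc n)) + (f′ *ₛ θ g) n) ∎
    where
    f′ = shift f
    shift-θ : f′ +ₛ θ f′ ≈ₛ shift (θ f)
    shift-θ k = trans (+-congʳ (sym (*-identityˡ _))) (sym (distribʳ _ _ _))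
 

-- Differentiation of series: product rule, chain rule, equation of a power

module SeriesDerivative {c ℓ} (R : CommutativeRing c ℓ) where
  open CommutativeRing R
  open SeriesProperties R
  private module 𝕊 = IntegerSolver seriesRing
  open IntegerSolver R
  open SetoidReasoning ₛ.setoid

  D-cong : ∀ {f g} → f ≈ₛ g → D f ≈ₛ D g
  D-cong f≈g n = *-congˡ (f≈g (suc n))

  D-+ₛ : ∀ f g → D (f +ₛ g) ≈ₛ D f +ₛ D g
  D-+ₛ f g n = distribˡ _ _ _

  D-⊝ : ∀ f → D (⊝ f) ≈ₛ ⊝ D f
  D-⊝ f n = solve 2 (λ k y → k :* (:- y) := :- (k :* y)) refl (nat (suc n)) (f (suc n))

  D-const : ∀ a → D (a ·t^ 0) ≈ₛ 0ₛ
  D-const a n = zeroʳ _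

  D-*ₛ : ∀ f g → D (f *ₛ g) ≈ₛ D f *ₛ g +ₛ f *ₛ D g
  D-*ₛ f g n = trans (θ-*ₛ f g (suc n)) (+-cong
    (trans (+-congʳ (trans (*-congʳ (zeroˡ _)) (zeroˡ _))) (+-identityˡ _))
    (trans (*ₛ-sucʳ f (θ g) n) (trans (+-congˡ (trans (*-congˡ (zeroˡ _)) (zeroʳ _))) (+-identityʳ _))))

  ·t^0-*ₛ : ∀ a f → a ·t^ 0 *ₛ f ≈ₛ a •ₛ f
  ·t^0-*ₛ = ·t^0-*

  -- θ is t d/dt, which on the outer series of a composite is composition with θ b.
  compose-θ : ∀ {v} → v 0 ≈ 0# → ∀ b → compose (θ b) v ≈ₛ v *ₛ compose (D b) v
  compose-θ {v} v₀≈0 b = ₛ.trans (compose-horner {v} v₀≈0 (θ b))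
    λ n → trans (+-congʳ (const≈0 n)) (+-identityˡ _)
    where
    const≈0 : ∀ n → (θ b 0 ·t^ 0) n ≈ 0#
    const≈0 zero    = zeroˡ _
    const≈0 (suc n) = refl

  -- Writing the outer series as b 0 + s c(s), its derivative is c + s c′.
  compose-D : ∀ {v} → v 0 ≈ 0# → ∀ b →
    compose (D b) v ≈ₛ compose (shift b) v +ₛ v *ₛ compose (D (shift b)) v
  compose-D {v} v₀≈0 b = begin
    compose (D b) v                                     ≈⟨ compose-cong v Db≈ ⟩
    compose (shift b +ₛ θ (shift b)) v                  ≈⟨ compose-+ (shift b) (θ (shift b)) v ⟩
    compose (shift b) v +ₛ compose (θ (shift b)) v
      ≈⟨ ₛ.+-congˡ {compose (shift b) v} (compose-θ {v} v₀≈0 (shift b)) ⟩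
    compose (shift b) v +ₛ v *ₛ compose (D (shift b)) v ∎
    where
    Db≈ : D b ≈ₛ shift b +ₛ θ (shift b)
    Db≈ k = trans (distribʳ _ _ _) (+-congʳ (*-identityˡ _))

  -- The defect of the chain rule for b is v times the defect for shift b,
  -- so it is divisible by every power of t.
  chain-rule : ∀ {v} → v 0 ≈ 0# → ∀ b → D (compose b v) ≈ₛ D v *ₛ compose (D b) v
  chain-rule {v} v₀≈0 b n = trans
    (solve 2 (λ x y → x := (x :- y) :+ y) refl (D (compose b v) n) ((D v *ₛ compose (D b) v) n))
    (trans (+-congʳ (defect-vanishes (suc n) b n (ℕ.n<1+n n))) (+-identityˡ _))
    where
    defect : Series → Series
    defect b = D (compose b v) -ₛ D v *ₛ compose (D b) v
    defect-shift : ∀ b → defect b ≈ₛ v *ₛ defect (shift b)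
    defect-shift b = begin
      D (compose b v) -ₛ D v *ₛ compose (D b) v
        ≈⟨ ₛ.+-cong {D (compose b v)} (ₛ.trans (D-cong (compose-horner {v} v₀≈0 b))
             (ₛ.trans (D-+ₛ (b 0 ·t^ 0) (v *ₛ C)) (ₛ.+-cong {D (b 0 ·t^ 0)} (D-const (b 0)) (D-*ₛ v C))))
           (ₛ.-‿cong (ₛ.*-congˡ {D v} (compose-D {v} v₀≈0 b))) ⟩
      (0ₛ +ₛ (D v *ₛ C +ₛ v *ₛ D C)) -ₛ D v *ₛ (C +ₛ v *ₛ E)
        ≈⟨ 𝕊.solve 5 (λ v dv c dc e → (𝕊.con (+ 0) 𝕊.:+ (dv 𝕊.:* c 𝕊.:+ v 𝕊.:* dc)) 𝕊.:- dv 𝕊.:* (c 𝕊.:+ v 𝕊.:* e)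
             𝕊.:= v 𝕊.:* (dc 𝕊.:- dv 𝕊.:* e)) ₛ.refl v (D v) C (D C) E ⟩
      v *ₛ (D C -ₛ D v *ₛ E) ∎
      where
      C E : Series
      C = compose (shift b) v
      E = compose (D (shift b)) v
    defect-vanishes : ∀ m b → Vanishes< m (defect b)
    defect-vanishes zero    b n ()
    defect-vanishes (suc m) b n n<m = trans (defect-shift b n)
      (*ₛ-vanishes-suc {f = defect (shift b)} {v} v₀≈0 (defect-vanishes m (shift b)) n n<m)

  -- The hypothesis on `b` is the coefficient form of (1 + s) b′ = α b, the equation of (1 + s)^α.
  -- Substituting `v` for s and applying the chain rule gives the claim.
  power-ODE : ∀ {v} → v 0 ≈ 0# → ∀ α b → (∀ k → nat (suc k) * b (suc k) ≈ (α - nat k) * b k) →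
    (1ₛ +ₛ v) *ₛ D (compose b v) ≈ₛ α ·t^ 0 *ₛ (D v *ₛ compose b v)
  power-ODE {v} v₀≈0 α b rec = begin
    (1ₛ +ₛ v) *ₛ D (compose b v)             ≈⟨ ₛ.*-congˡ {1ₛ +ₛ v} (chain-rule {v} v₀≈0 b) ⟩
    (1ₛ +ₛ v) *ₛ (D v *ₛ compose (D b) v)
      ≈⟨ 𝕊.solve 3 (λ v dv c → (𝕊.con (+ 1) 𝕊.:+ v) 𝕊.:* (dv 𝕊.:* c) 𝕊.:= dv 𝕊.:* (c 𝕊.:+ v 𝕊.:* c))
           ₛ.refl v (D v) (compose (D b) v) ⟩
    D v *ₛ (compose (D b) v +ₛ v *ₛ compose (D b) v) ≈⟨ ₛ.*-congˡ {D v} sum≈ ⟩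
    D v *ₛ (α ·t^ 0 *ₛ compose b v)
      ≈⟨ 𝕊.solve 3 (λ a dv c → dv 𝕊.:* (a 𝕊.:* c) 𝕊.:= a 𝕊.:* (dv 𝕊.:* c)) ₛ.refl (α ·t^ 0) (D v) (compose b v) ⟩
    α ·t^ 0 *ₛ (D v *ₛ compose b v) ∎
    where
    sum≈ : compose (D b) v +ₛ v *ₛ compose (D b) v ≈ₛ α ·t^ 0 *ₛ compose b v
    sum≈ = begin
      compose (D b) v +ₛ v *ₛ compose (D b) v  ≈⟨ ₛ.+-congˡ {compose (D b) v} (compose-θ {v} v₀≈0 b) ⟨
      compose (D b) v +ₛ compose (θ b) v       ≈⟨ compose-+ (D b) (θ b) v ⟨
      compose (D b +ₛ θ b) v                   ≈⟨ compose-cong v (λ k → trans (+-congʳ (rec k))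
                                                   (solve 3 (λ α k x → (α :- k) :* x :+ k :* x := α :* x)
                                                        refl α (nat k) (b k))) ⟩
      compose (α •ₛ b) v                       ≈⟨ compose-• α b v ⟩
      α •ₛ compose b v                         ≈⟨ ·t^0-* α (compose b v) ⟨
      α ·t^ 0 *ₛ compose b v                   ∎

  D-^ₛ : ∀ g k → D (g ^ₛ suc k) ≈ₛ nat (suc k) ·t^ 0 *ₛ (g ^ₛ k *ₛ D g)
  D-^ₛ g zero    = begin
    D (g *ₛ 1ₛ)                              ≈⟨ D-*ₛ g 1ₛ ⟩
    D g *ₛ 1ₛ +ₛ g *ₛ D 1ₛ                   ≈⟨ ₛ.+-congˡ {D g *ₛ 1ₛ} (ₛ.*-congˡ {g} (D-const 1#)) ⟩
    D g *ₛ 1ₛ +ₛ g *ₛ 0ₛ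
      ≈⟨ 𝕊.solve 2 (λ g d → d 𝕊.:* 𝕊.con (+ 1) 𝕊.:+ g 𝕊.:* 𝕊.con (+ 0) 𝕊.:= 𝕊.con (+ 1) 𝕊.:* (𝕊.con (+ 1) 𝕊.:* d))
           ₛ.refl g (D g) ⟩
    1ₛ *ₛ (1ₛ *ₛ D g)                        ≈⟨ ₛ.*-congʳ {1ₛ *ₛ D g} one ⟩
    nat 1 ·t^ 0 *ₛ (1ₛ *ₛ D g)            ∎
    where
    one : 1ₛ ≈ₛ nat 1 ·t^ 0
    one zero    = sym (+-identityʳ 1#)
    one (suc n) = refl
  D-^ₛ g (suc k) = begin
    D (g *ₛ P)                               ≈⟨ D-*ₛ g P ⟩
    D g *ₛ P +ₛ g *ₛ D P                     ≈⟨ ₛ.+-congˡ {D g *ₛ P} (ₛ.*-congˡ {g} (D-^ₛ g k)) ⟩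
    D g *ₛ (g *ₛ g ^ₛ k) +ₛ g *ₛ (K *ₛ (g ^ₛ k *ₛ D g))
      ≈⟨ 𝕊.solve 4 (λ g d p k → d 𝕊.:* (g 𝕊.:* p) 𝕊.:+ g 𝕊.:* (k 𝕊.:* (p 𝕊.:* d))
           𝕊.:= (𝕊.con (+ 1) 𝕊.:+ k) 𝕊.:* ((g 𝕊.:* p) 𝕊.:* d)) ₛ.refl g (D g) (g ^ₛ k) K ⟩
    (1ₛ +ₛ K) *ₛ (P *ₛ D g)                  ≈⟨ ₛ.*-congʳ {P *ₛ D g} 1+K ⟩
    nat (suc (suc k)) ·t^ 0 *ₛ (P *ₛ D g)   ∎
    where
    P K : Series
    P = g ^ₛ suc k
    K = nat (suc k) ·t^ 0
    1+K : 1ₛ +ₛ K ≈ₛ nat (suc (suc k)) ·t^ 0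
    1+K zero    = refl
    1+K (suc n) = +-identityʳ 0#

-- Three-term arrays: J-fraction, minors, Euler's identity

module ThreeTermArray {c ℓ} (R : CommutativeRing c ℓ)
  (r : ℕ → CommutativeRing.Carrier R) (u : CommutativeRing.Carrier R) (w : ℕ → CommutativeRing.Carrier R)
  (w₀≈0 : CommutativeRing._≈_ R (w 0) (CommutativeRing.0# R)) where
  open CommutativeRing R
  open IntegerSolver R

  -- Since `pred 0` is `0`, the last term at k = 0 reads column 0 instead of a column -1; the
  -- hypothesis `w₀≈0` removes it.
  A : ℕ → ℕ → Carrier
  A zero    zero    = 1#
  A zero    (suc k) = 0#
  A (suc n) k       = r k * A n k + u * A n (suc k) + w k * A n (pred k)

  module JFraction where
    open SeriesProperties R
    private module 𝕊 = IntegerSolver seriesRing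
    open SetoidReasoning ₛ.setoid

    module Convergent (s : ℕ → Carrier) (s≈ : ∀ k → s (suc k) ≈ u * w (suc k)) (m : ℕ) where

      C : ℕ → Series
      C k = convergent r s (m ℕ.∸ k) k

      -- With C k the tails of the m-th convergent, B k is the generating function
      -- of column k of the array truncated to the columns 0, …, m.
      B : ℕ → Series
      B zero    = C 0
      B (suc k) = w (suc k) ·t^ 1 *ₛ C (suc k) *ₛ B k

      convergent-0 : ∀ m i → convergent r s m i 0 ≈ 1#
      convergent-0 zero    i = +-identityʳ 1#
      convergent-0 (suc m) i = +-identityʳ 1#

      -- For k < m the number m - k is a successor, so one layer of the fraction unfolds. The
      -- numerator s t² is split as (u t)(w t): the factor w t goes into `B (suc k)`, while u t
      -- stays as its coefficient in the recurrence.
      C-step : ∀ {k} → k ℕ.< m →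
        C k ≈ₛ 1ₛ +ₛ (r k ·t^ 1 +ₛ u ·t^ 1 *ₛ (w (suc k) ·t^ 1 *ₛ C (suc k))) *ₛ C k
      C-step {k} k<m with m ℕ.∸ k | ℕ.+-∸-assoc 1 k<m
      ... | _ | ≡.refl = begin
        1/1- U
          ≈⟨ 1/1-≈ {U} (trans (+-identityˡ _) (·t^suc-*-zero (s (suc k)) 1 (C (suc k)))) ⟩
        1ₛ +ₛ U *ₛ 1/1- U
          ≈⟨ ₛ.+-congˡ {1ₛ} (ₛ.*-congʳ {1/1- U} (ₛ.+-congˡ {r k ·t^ 1} (ₛ.*-congʳ {C (suc k)} s·t²≈))) ⟩
        1ₛ +ₛ (r k ·t^ 1 +ₛ (u ·t^ 1 *ₛ w (suc k) ·t^ 1) *ₛ C (suc k)) *ₛ 1/1- U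
          ≈⟨ ₛ.+-congˡ {1ₛ} (ₛ.*-congʳ {1/1- U}
               (ₛ.+-congˡ {r k ·t^ 1} (ₛ.*-assoc (u ·t^ 1) (w (suc k) ·t^ 1) (C (suc k))))) ⟩
        1ₛ +ₛ (r k ·t^ 1 +ₛ u ·t^ 1 *ₛ (w (suc k) ·t^ 1 *ₛ C (suc k))) *ₛ 1/1- U ∎
        where
        U : Series
        U = r k ·t^ 1 +ₛ s (suc k) ·t^ 2 *ₛ C (suc k)
        s·t²≈ : s (suc k) ·t^ 2 ≈ₛ u ·t^ 1 *ₛ w (suc k) ·t^ 1
        s·t²≈ zero                = sym (·t^suc-*-zero u 0 (w (suc k) ·t^ 1))
        s·t²≈ (suc zero)          = sym (trans (·t^suc-*-suc u 0 (w (suc k) ·t^ 1) 0)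
                                      (trans (·t^0-* u (w (suc k) ·t^ 1) 0) (zeroʳ u)))
        s·t²≈ (suc (suc zero))    = trans (s≈ k) (sym (trans (·t^suc-*-suc u 0 (w (suc k) ·t^ 1) 1)
                                      (·t^0-* u (w (suc k) ·t^ 1) 1)))
        s·t²≈ (suc (suc (suc n))) = sym (trans (·t^suc-*-suc u 0 (w (suc k) ·t^ 1) (suc (suc n)))
                                      (trans (·t^0-* u (w (suc k) ·t^ 1) (suc (suc n))) (zeroʳ u)))

      B-0 : ∀ k → B k 0 ≈ A 0 k
      B-0 zero    = convergent-0 m 0
      B-0 (suc k) = trans (+-identityʳ _) (trans
        (*-congʳ (·t^suc-*-zero (w (suc k)) 0 (C (suc k)))) (zeroˡ _))

      t-coeff : ∀ a f n → (a ·t^ 1 *ₛ f) (suc n) ≈ a * f n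
      t-coeff a f n = trans (·t^suc-*-suc a 0 f n) (·t^0-* a f n)

      -- Multiplying `C-step` by the remaining factors of `B k` turns the fixed-point equation of
      -- one tail into the recurrence of the array. It stops at k = m, where the last tail has no
      -- further layer.
      B-suc : ∀ k n → k ℕ.< m → B k (suc n) ≈ r k * B k n + u * B (suc k) n + w k * B (pred k) n
      B-suc zero n 0<m = trans (B₀≈ (suc n)) (trans
        (+-cong refl (+-cong (t-coeff (r 0) (B 0) n) (t-coeff u (B 1) n)))
        (trans (+-identityˡ _) (sym (trans (+-congˡ (trans (*-congʳ w₀≈0) (zeroˡ _))) (+-identityʳ _)))))
        where
        B₀≈ : B 0 ≈ₛ 1ₛ +ₛ (r 0 ·t^ 1 *ₛ B 0 +ₛ u ·t^ 1 *ₛ B 1)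
        B₀≈ = begin
          C 0 ≈⟨ C-step 0<m ⟩
          1ₛ +ₛ (r 0 ·t^ 1 +ₛ u ·t^ 1 *ₛ (w 1 ·t^ 1 *ₛ C 1)) *ₛ C 0
            ≈⟨ 𝕊.solve 4 (λ r u wc c → 𝕊.con (+ 1) 𝕊.:+ (r 𝕊.:+ u 𝕊.:* wc) 𝕊.:* c
                 𝕊.:= 𝕊.con (+ 1) 𝕊.:+ (r 𝕊.:* c 𝕊.:+ u 𝕊.:* (wc 𝕊.:* c)))
               ₛ.refl (r 0 ·t^ 1) (u ·t^ 1) (w 1 ·t^ 1 *ₛ C 1) (C 0) ⟩
          1ₛ +ₛ (r 0 ·t^ 1 *ₛ B 0 +ₛ u ·t^ 1 *ₛ B 1) ∎
      B-suc (suc k) n k<m = trans (Bₖ≈ (suc n))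
        (+-cong (+-cong (t-coeff (r (suc k)) (B (suc k)) n) (t-coeff u (B (suc (suc k))) n))
          (t-coeff (w (suc k)) (B k) n))
        where
        Bₖ≈ : B (suc k) ≈ₛ r (suc k) ·t^ 1 *ₛ B (suc k) +ₛ u ·t^ 1 *ₛ B (suc (suc k)) +ₛ w (suc k) ·t^ 1 *ₛ B k
        Bₖ≈ = begin
          w (suc k) ·t^ 1 *ₛ C (suc k) *ₛ B k
            ≈⟨ ₛ.*-congʳ {B k} (ₛ.*-congˡ {w (suc k) ·t^ 1} (C-step k<m)) ⟩
          w (suc k) ·t^ 1 *ₛ (1ₛ +ₛ (r (suc k) ·t^ 1 +ₛ u ·t^ 1 *ₛ (w (suc (suc k)) ·t^ 1 *ₛ C (suc (suc k)))) *ₛ C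
               (suc k)) *ₛ B k
            ≈⟨ 𝕊.solve 6 (λ w r u wc c b → w 𝕊.:* (𝕊.con (+ 1) 𝕊.:+ (r 𝕊.:+ u 𝕊.:* wc) 𝕊.:* c) 𝕊.:* b
                 𝕊.:= r 𝕊.:* (w 𝕊.:* c 𝕊.:* b) 𝕊.:+ u 𝕊.:* (wc 𝕊.:* (w 𝕊.:* c 𝕊.:* b)) 𝕊.:+ w 𝕊.:* b)
               ₛ.refl (w (suc k) ·t^ 1) (r (suc k) ·t^ 1) (u ·t^ 1) (w (suc (suc k)) ·t^ 1 *ₛ C (suc (suc k)))
                    (C (suc k)) (B k) ⟩
          r (suc k) ·t^ 1 *ₛ B (suc k) +ₛ u ·t^ 1 *ₛ B (suc (suc k)) +ₛ w (suc k) ·t^ 1 *ₛ B k ∎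

      -- Entry (n, k) depends only on columns up to n + k, so it does not feel the truncation at
      -- column m.
      B≈A : ∀ n k → n ℕ.+ k ℕ.≤ m → B k n ≈ A n k
      B≈A zero    k _    = B-0 k
      B≈A (suc n) k n+k<m = trans (B-suc k n (ℕ.≤-trans (s≤s (ℕ.m≤n+m k n)) n+k<m))
        (+-cong (+-cong (*-congˡ (B≈A n k (ℕ.<⇒≤ n+k<m)))
                        (*-congˡ (B≈A n (suc k) (≡.subst (ℕ._≤ m) (≡.sym (ℕ.+-suc n k)) n+k<m))))
          (*-congˡ (B≈A n (pred k) (ℕ.≤-trans (ℕ.+-monoʳ-≤ n ℕ.pred[n]≤n) (ℕ.<⇒≤ n+k<m)))))

    jFraction : ∀ s → (∀ k → s (suc k) ≈ u * w (suc k)) → HasJFraction (λ n → A n 0) r s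
    jFraction s s≈ n = n , λ m m≥n →
      Convergent.B≈A s s≈ m n 0 (≡.subst (ℕ._≤ m) (≡.sym (ℕ.+-identityʳ n)) m≥n)

  -- `NonNeg` is kept abstract because it will mean coefficientwise nonnegative polynomials, which
  -- form no total order. The last hypothesis concerns the only 2 × 2 minors of the tridiagonal
  -- matrix with two nonzero terms; all others are monomials or zero.
  module Minors {p} {NonNeg : Pred Carrier p}
    (resp : ∀ {x y} → x ≈ y → NonNeg x → NonNeg y)
    (0-nonNeg : NonNeg 0#) (1-nonNeg : NonNeg 1#)
    (+-nonNeg : ∀ {x y} → NonNeg x → NonNeg y → NonNeg (x + y))
    (*-nonNeg : ∀ {x y} → NonNeg x → NonNeg y → NonNeg (x * y))
    (r-nonNeg : ∀ k → NonNeg (r k)) (u-nonNeg : NonNeg u) (w-nonNeg : ∀ k → NonNeg (w k))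
    (rr-uw-nonNeg : ∀ k → NonNeg (r k * r (suc k) - u * w (suc k)))
    where
    open SetoidReasoning setoid

    A-nonNeg : ∀ n k → NonNeg (A n k)
    A-nonNeg zero    zero    = 1-nonNeg
    A-nonNeg zero    (suc k) = 0-nonNeg
    A-nonNeg (suc n) k       = +-nonNeg (+-nonNeg
      (*-nonNeg (r-nonNeg k) (A-nonNeg n k)) (*-nonNeg u-nonNeg (A-nonNeg n (suc k))))
      (*-nonNeg (w-nonNeg k) (A-nonNeg n (pred k)))

    -- The rows are `g` above `f`, because the argument `g` will be the earlier row of the array.
    minor : (f g : ℕ → Carrier) → ℕ → ℕ → Carrier
    minor f g i j = g i * f j - f i * g j

    minor-diag : ∀ f g i → minor f g i i ≈ 0#
    minor-diag f g i = solve 2 (λ a b → b :* a :- a :* b := con (+ 0)) refl (f i) (g i)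

    step : (ℕ → Carrier) → ℕ → Carrier
    step f k = r k * f k + u * f (suc k) + w k * f (pred k)

    -- The minor whose column i has been stepped while column l has not. A determinant is linear in
    -- each column, so `minor-step` can step the two columns one after the other.
    row : (f g : ℕ → Carrier) → ℕ → ℕ → Carrier
    row f g i l = r i * minor f g i l + u * minor f g (suc i) l + w i * minor f g (pred i) l

    minor-step : ∀ f g i j → minor (step f) (step g) i j ≈
      r j * row f g i j + u * row f g i (suc j) + w j * row f g i (pred j)
    minor-step f g i j = begin
      minor (step f) (step g) i j
        ≈⟨ solve 11 (λ rⱼ u wⱼ fi gi f₀ f₁ f₂ g₀ g₁ g₂ →
             gi :* (rⱼ :* f₀ :+ u :* f₁ :+ wⱼ :* f₂) :- fi :* (rⱼ :* g₀ :+ u :* g₁ :+ wⱼ :* g₂) :=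
             rⱼ :* (gi :* f₀ :- fi :* g₀) :+ u :* (gi :* f₁ :- fi :* g₁) :+ wⱼ :* (gi :* f₂ :- fi :* g₂))
           refl (r j) u (w j) (step f i) (step g i) (f j) (f (suc j)) (f (pred j)) (g j) (g (suc j)) (g (pred j)) ⟩
      r j * half j + u * half (suc j) + w j * half (pred j)
        ≈⟨ +-cong (+-cong (*-congˡ (half≈ j)) (*-congˡ (half≈ (suc j)))) (*-congˡ (half≈ (pred j))) ⟩
      r j * row f g i j + u * row f g i (suc j) + w j * row f g i (pred j) ∎
      where
      half : ℕ → Carrier
      half l = step g i * f l - step f i * g l
      half≈ : ∀ l → half l ≈ row f g i l
      half≈ l = solve 11 (λ rᵢ u wᵢ fl gl f₀ f₁ f₂ g₀ g₁ g₂ →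
        (rᵢ :* g₀ :+ u :* g₁ :+ wᵢ :* g₂) :* fl :- (rᵢ :* f₀ :+ u :* f₁ :+ wᵢ :* f₂) :* gl :=
        rᵢ :* (g₀ :* fl :- f₀ :* gl) :+ u :* (g₁ :* fl :- f₁ :* gl) :+ wᵢ :* (g₂ :* fl :- f₂ :* gl))
        refl (r i) u (w i) (f l) (g l) (f i) (f (suc i)) (f (pred i)) (g i) (g (suc i)) (g (pred i))

    MinorsNonNeg : (f g : ℕ → Carrier) → Set p
    MinorsNonNeg f g = ∀ i j → i ℕ.≤ j → NonNeg (minor f g i j)

    -- If j is at least i + 2, every `row` that occurs has second index above i, so all its minors
    -- have their indices in order. Only j = i + 1 brings in an out-of-order minor, with indices i +
    -- 1 and i.
    step-nonNeg : ∀ f g → MinorsNonNeg f g → MinorsNonNeg (step f) (step g)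
    step-nonNeg f g fg≥0 i j i≤j = by-gap (ℕ.≤⇒≤′ i≤j)
      where
      row-nonNeg : ∀ {l} → suc i ℕ.≤ l → NonNeg (row f g i l)
      row-nonNeg {l} i<l = +-nonNeg (+-nonNeg
        (*-nonNeg (r-nonNeg i) (fg≥0 i l (ℕ.<⇒≤ i<l)))
        (*-nonNeg u-nonNeg (fg≥0 (suc i) l i<l)))
        (*-nonNeg (w-nonNeg i) (fg≥0 (pred i) l (ℕ.≤-trans ℕ.pred[n]≤n (ℕ.<⇒≤ i<l))))

      by-gap : ∀ {j} → i ℕ.≤′ j → NonNeg (minor (step f) (step g) i j)
      by-gap ℕ.≤′-refl = resp (sym (minor-diag (step f) (step g) i)) 0-nonNeg
      -- The negative term of row i i is absorbed by r i * r (suc i).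
      by-gap (ℕ.≤′-step ℕ.≤′-refl) = resp (sym eq) (+-nonNeg (+-nonNeg (+-nonNeg (+-nonNeg
        (*-nonNeg (rr-uw-nonNeg i) (fg≥0 i (suc i) (ℕ.n≤1+n i)))
        (*-nonNeg (*-nonNeg (r-nonNeg (suc i)) (w-nonNeg i))
             (fg≥0 (pred i) (suc i) (ℕ.≤-trans ℕ.pred[n]≤n (ℕ.n≤1+n i)))))
        (*-nonNeg u-nonNeg (row-nonNeg (ℕ.n≤1+n (suc i)))))
        (*-nonNeg (*-nonNeg (w-nonNeg (suc i)) (w-nonNeg i)) (fg≥0 (pred i) i ℕ.pred[n]≤n))) 0-nonNeg)
        where
        eq : minor (step f) (step g) i (suc i) ≈
          (r i * r (suc i) - u * w (suc i)) * minor f g i (suc i) + r (suc i) * w i * minor f g (pred i) (suc i)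
          + u * row f g i (suc (suc i)) + w (suc i) * w i * minor f g (pred i) i + 0#
        eq = trans (minor-step f g i (suc i)) (solve 12
          (λ r r′ u w w′ f₀ g₀ f₁ g₁ m m′ t →
            r′ :* (r :* (g₀ :* f₁ :- f₀ :* g₁) :+ u :* (g₁ :* f₁ :- f₁ :* g₁) :+ w :* m) :+ u :* t
              :+ w′ :* (r :* (g₀ :* f₀ :- f₀ :* g₀) :+ u :* (g₁ :* f₀ :- f₁ :* g₀) :+ w :* m′) :=
            (r :* r′ :- u :* w′) :* (g₀ :* f₁ :- f₀ :* g₁) :+ r′ :* w :* m :+ u :* t :+ w′ :* w :* m′ :+ con (+ 0))
          refl (r i) (r (suc i)) u (w i) (w (suc i)) (f i) (g i) (f (suc i)) (g (suc i))
          (minor f g (pred i) (suc i)) (minor f g (pred i) i) (row f g i (suc (suc i))))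
      by-gap {suc (suc j)} (ℕ.≤′-step (ℕ.≤′-step i≤′j)) = resp (sym (minor-step f g i (suc (suc j))))
        (+-nonNeg (+-nonNeg
          (*-nonNeg (r-nonNeg (suc (suc j))) (row-nonNeg (ℕ.≤-trans (s≤s i≤j₀) (ℕ.n≤1+n (suc j)))))
          (*-nonNeg u-nonNeg (row-nonNeg (ℕ.≤-trans (s≤s i≤j₀) (ℕ.≤-trans (ℕ.n≤1+n (suc j)) (ℕ.n≤1+n (suc (suc j))))))))
          (*-nonNeg (w-nonNeg (suc (suc j))) (row-nonNeg (s≤s i≤j₀))))
        where
        i≤j₀ = ℕ.≤′⇒≤ i≤′j

    -- Both rows are stepped back together until the earlier one is row 0, which is (1, 0, 0, ...).
    -- There each minor is an entry of `A` or zero.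
    minors-nonNeg : ∀ {a b} → a ℕ.≤ b → MinorsNonNeg (A b) (A a)
    minors-nonNeg {b = b} z≤n zero    zero    _ = resp (sym (minor-diag (A b) (A 0) 0)) 0-nonNeg
    minors-nonNeg {b = b} z≤n zero    (suc j) _ = resp
      (solve 2 (λ x y → x := con (+ 1) :* x :- y :* con (+ 0)) refl (A b (suc j)) (A b 0)) (A-nonNeg b (suc j))
    minors-nonNeg {b = b} z≤n (suc i) (suc j) _ = resp
      (solve 2 (λ x y → con (+ 0) := con (+ 0) :* x :- y :* con (+ 0)) refl (A b (suc j)) (A b (suc i))) 0-nonNeg
    minors-nonNeg {suc a} {suc b} (s≤s a≤b) = step-nonNeg (A b) (A a) (minors-nonNeg a≤b)

    stronglyLogConvex : ∀ {a b} → a ℕ.≤ b → NonNeg (A (suc b) 0 * A a 0 - A b 0 * A (suc a) 0)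
    stronglyLogConvex {a} {b} a≤b = resp (sym eq) (*-nonNeg u-nonNeg (minors-nonNeg a≤b 0 1 z≤n))
      where
      eq : A (suc b) 0 * A a 0 - A b 0 * A (suc a) 0 ≈ u * minor (A b) (A a) 0 1
      eq = solve 7 (λ r u w b₀ b₁ a₀ a₁ →
        (r :* b₀ :+ u :* b₁ :+ w :* b₀) :* a₀ :- b₀ :* (r :* a₀ :+ u :* a₁ :+ w :* a₀) := u :* (a₀ :* b₁ :- b₀ :* a₁))
        refl (r 0) u (w 0) (A b 0) (A b 1) (A a 0) (A a 1)

  -- After one step of the recurrence, comparing the coefficients of `A n k` and of `A n (suc k)` in
  -- Euler's identity leaves exactly `E-r` and `E-u`. The function `κ` is the image of the natural
  -- numbers in the ring.
  module Derivation (E : Carrier → Carrier)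
    (E-cong : ∀ {x y} → x ≈ y → E x ≈ E y)
    (E-+ : ∀ x y → E (x + y) ≈ E x + E y)
    (E-* : ∀ x y → E (x * y) ≈ E x * y + x * E y)
    (E-0 : E 0# ≈ 0#) (E-1 : E 1# ≈ 0#)
    (κ : ℕ → Carrier) (κ-0 : κ 0 ≈ 0#) (κ-suc : ∀ n → κ (suc n) ≈ 1# + κ n)
    (E-r : ∀ k → E (r k) + r k + (1# + 1#) * w k ≈ (1# + 1#) * w (suc k))
    (E-u : ∀ k → E u + (1# + 1#) * r k + (1# + 1#) * u ≈ (1# + 1#) * r (suc k))
    (E-w : ∀ k → E (w k) ≈ 0#)
    where
    open SetoidReasoning setoid

    -- Euler's identity for ∂ᵏP n/∂hᵏ, stated without subtraction; E is (1 - x) d/dx.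
    euler : ∀ n k → E (A n k) + κ n * A n k ≈ (1# + 1#) * A n (suc k) + κ k * A n k
    euler zero zero = begin
      E 1# + κ 0 * 1#               ≈⟨ +-congʳ E-1 ⟩
      0# + κ 0 * 1#
        ≈⟨ solve 1 (λ k → con (+ 0) :+ k :* con (+ 1) := (con (+ 1) :+ con (+ 1)) :* con (+ 0) :+ k :* con (+ 1))
             refl (κ 0) ⟩
      (1# + 1#) * 0# + κ 0 * 1#     ∎
    euler zero (suc k) = begin
      E 0# + κ 0 * 0#               ≈⟨ +-congʳ E-0 ⟩
      0# + κ 0 * 0#
        ≈⟨ solve 2 (λ k l → con (+ 0) :+ k :* con (+ 0) := (con (+ 1) :+ con (+ 1)) :* con (+ 0) :+ l :* con (+ 0))
             refl (κ 0) (κ (suc k)) ⟩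
      (1# + 1#) * 0# + κ (suc k) * 0# ∎
    euler (suc n) k = begin
      E (r k * a + u * b + w k * z) + κ (suc n) * (r k * a + u * b + w k * z)
        ≈⟨ +-cong Leibniz (*-congʳ (κ-suc n)) ⟩
      (E (r k) * a + r k * E a) + (E u * b + u * E b) + w k * E z + (1# + κ n) * (r k * a + u * b + w k * z)
        ≈⟨ solve 12 (λ r dr u du w a b z da db dz n →
             (dr :* a :+ r :* da) :+ (du :* b :+ u :* db) :+ w :* dz :+ (con (+ 1) :+ n) :*
                  (r :* a :+ u :* b :+ w :* z) :=
             (dr :+ r) :* a :+ (du :+ u) :* b :+ r :* (da :+ n :* a) :+ u :* (db :+ n :* b) :+ w :* (dz :+ n :* z :+ z))
           refl (r k) (E (r k)) u (E u) (w k) a b z (E a) (E b) (E z) (κ n) ⟩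
      (E (r k) + r k) * a + (E u + u) * b + r k * (E a + κ n * a) + u * (E b + κ n * b) + w k * (E z + κ n * z + z)
        ≈⟨ +-cong (+-cong (+-congˡ (*-congˡ (euler n k)))
             (*-congˡ (trans (euler n (suc k)) (+-congˡ (*-congʳ (κ-suc k)))))) (w-term k) ⟩
      (E (r k) + r k) * a + (E u + u) * b + r k * ((1# + 1#) * b + κ k * a)
        + u * ((1# + 1#) * d + (1# + κ k) * b) + w k * ((1# + 1#) * a + κ k * z)
        ≈⟨ solve 10 (λ r dr u du w a b d z k → let t = con (+ 1) :+ con (+ 1) in
             (dr :+ r) :* a :+ (du :+ u) :* b :+ r :* (t :* b :+ k :* a)
               :+ u :* (t :* d :+ (con (+ 1) :+ k) :* b) :+ w :* (t :* a :+ k :* z) :=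
             (dr :+ r :+ t :* w) :* a :+ (du :+ t :* r :+ t :* u) :* b :+ t :* (u :* d) :+ k :*
                  (r :* a :+ u :* b :+ w :* z))
           refl (r k) (E (r k)) u (E u) (w k) a b d z (κ k) ⟩
      (E (r k) + r k + (1# + 1#) * w k) * a + (E u + (1# + 1#) * r k + (1# + 1#) * u) * b
        + (1# + 1#) * (u * d) + κ k * A (suc n) k
        ≈⟨ +-congʳ (+-congʳ (+-cong (*-congʳ (E-r k)) (*-congʳ (E-u k)))) ⟩
      (1# + 1#) * w (suc k) * a + (1# + 1#) * r (suc k) * b + (1# + 1#) * (u * d) + κ k * A (suc n) k
        ≈⟨ +-congʳ (solve 6 (λ w a r b u d → let t = con (+ 1) :+ con (+ 1) in
             t :* w :* a :+ t :* r :* b :+ t :* (u :* d) := t :* (r :* b :+ u :* d :+ w :* a))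
           refl (w (suc k)) a (r (suc k)) b u d) ⟩
      (1# + 1#) * A (suc n) (suc k) + κ k * A (suc n) k ∎
      where
      a = A n k
      b = A n (suc k)
      d = A n (suc (suc k))
      z = A n (pred k)
      Leibniz : E (r k * a + u * b + w k * z) ≈ (E (r k) * a + r k * E a) + (E u * b + u * E b) + w k * E z
      Leibniz = trans (E-+ _ _) (+-cong (trans (E-+ _ _) (+-cong (E-* _ _) (E-* _ _)))
        (trans (E-* _ _) (trans (+-congʳ (trans (*-congʳ (E-w k)) (zeroˡ _))) (+-identityˡ _))))
      -- At k = 0 the bracketed equality would require κ 0 = 1 + κ (pred 0); there the factor `w 0`,
      -- which is zero, makes both sides vanish.
      w-term : ∀ k → w k * (E (A n (pred k)) + κ n * A n (pred k) + A n (pred k)) ≈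
                     w k * ((1# + 1#) * A n k + κ k * A n (pred k))
      w-term zero    = trans (trans (*-congʳ w₀≈0) (zeroˡ _)) (sym (trans (*-congʳ w₀≈0) (zeroˡ _)))
      w-term (suc k) = *-congˡ (begin
        E (A n k) + κ n * A n k + A n k                          ≈⟨ +-congʳ (euler n k) ⟩
        (1# + 1#) * A n (suc k) + κ k * A n k + A n k
          ≈⟨ solve 3 (λ k x y → x :+ k :* y :+ y := x :+ (con (+ 1) :+ k) :* y)
               refl (κ k) ((1# + 1#) * A n (suc k)) (A n k) ⟩
        (1# + 1#) * A n (suc k) + (1# + κ k) * A n k             ≈⟨ +-congˡ (*-congʳ (κ-suc k)) ⟨
        (1# + 1#) * A n (suc k) + κ (suc k) * A n k              ∎)
 

-- The polynomial ring, its derivation and evaluation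

module Polynomials {c ℓ₁ ℓ₂ ℓ₃} (ℝ : RealNumbers c ℓ₁ ℓ₂ ℓ₃) where
  open RealNumbers ℝ hiding (refl; sym; trans)
  open Notions ℝ

  realRing : CommutativeRing c ℓ₁
  realRing = HeytingCommutativeRing.commutativeRing heytingCommutativeRing

  open CommutativeRing realRing using (refl; sym; trans)
  open RingProperties (CommutativeRing.ring realRing) using (-0#≈0#)
  open IntegerSolver realRing
  module S = SeriesProperties realRing
  module SD = SeriesDerivative realRing
  open S using (_≈ₛ_; _+ₛ_; _*ₛ_; D; module ₛ)

  coeff-+ : ∀ p q → coeff (p +ₚ q) ≈ₛ coeff p +ₛ coeff q
  coeff-+ []      q       i       = sym (+-identityˡ _)
  coeff-+ (a ∷ p) []      i       = sym (+-identityʳ _)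
  coeff-+ (a ∷ p) (b ∷ q) zero    = refl
  coeff-+ (a ∷ p) (b ∷ q) (suc i) = coeff-+ p q i

  coeff-• : ∀ a p i → coeff (a •ₚ p) i ≈ a * coeff p i
  coeff-• a []      i       = sym (zeroʳ a)
  coeff-• a (b ∷ p) zero    = refl
  coeff-• a (b ∷ p) (suc i) = coeff-• a p i

  coeff-neg : ∀ p i → coeff (-ₚ p) i ≈ - coeff p i
  coeff-neg []      i       = sym -0#≈0#
  coeff-neg (a ∷ p) zero    = refl
  coeff-neg (a ∷ p) (suc i) = coeff-neg p i

  coeff-* : ∀ p q → coeff (p *ₚ q) ≈ₛ coeff p *ₛ coeff q
  coeff-* []      q i       = sym (S.*ₛ-zeroˡ {coeff []} (coeff q) (λ _ → refl) i)
  coeff-* (a ∷ p) q zero    = trans (coeff-+ (a •ₚ q) (0# ∷ p *ₚ q) 0) (+-congʳ (coeff-• a q 0))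
  coeff-* (a ∷ p) q (suc i) = trans (coeff-+ (a •ₚ q) (0# ∷ p *ₚ q) (suc i))
    (+-cong (coeff-• a q (suc i)) (coeff-* p q i))

  coeff-1 : coeff 1ₚ ≈ₛ S.1ₛ
  coeff-1 zero    = refl
  coeff-1 (suc i) = refl

  coeff-derivative : ∀ p → coeff (derivative p) ≈ₛ D (coeff p)
  coeff-derivative []      i       = sym (zeroʳ _)
  coeff-derivative (a ∷ p) zero    = trans (coeff-+ p (0# ∷ derivative p) 0)
    (solve 1 (λ x → x :+ con (+ 0) := (con (+ 1) :+ con (+ 0)) :* x) refl (coeff p 0))
  coeff-derivative (a ∷ p) (suc i) = trans (coeff-+ p (0# ∷ derivative p) (suc i))
    (trans (+-congˡ (coeff-derivative p i))
      (solve 2 (λ k x → x :+ k :* x := (con (+ 1) :+ k) :* x) refl (nat (suc i)) (coeff p (suc i))))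

  private
    +ₚ-cong : ∀ {p p′ q q′} → p ≈ₚ p′ → q ≈ₚ q′ → p +ₚ q ≈ₚ p′ +ₚ q′
    +ₚ-cong {p} {p′} {q} {q′} p≈ q≈ i = trans (coeff-+ p q i)
      (trans (+-cong (p≈ i) (q≈ i)) (sym (coeff-+ p′ q′ i)))

    -- Equality of polynomials is equality of coefficient series, so `coeff` is an injective
    -- homomorphism along which the ring laws are pulled back from power series.
    via : ∀ p q {f g : S.Series} → coeff p ≈ₛ f → coeff q ≈ₛ g → f ≈ₛ g → p ≈ₚ q
    via p q p≈ q≈ f≈g i = trans (p≈ i) (trans (f≈g i) (sym (q≈ i)))

    coeff-** : ∀ p q r → coeff (p *ₚ q *ₚ r) ≈ₛ coeff p *ₛ coeff q *ₛ coeff r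
    coeff-** p q r i = trans (coeff-* (p *ₚ q) r i) (ₛ.*-congʳ {coeff r} (coeff-* p q) i)

    coeff-**ʳ : ∀ p q r → coeff (p *ₚ (q *ₚ r)) ≈ₛ coeff p *ₛ (coeff q *ₛ coeff r)
    coeff-**ʳ p q r i = trans (coeff-* p (q *ₚ r) i) (ₛ.*-congˡ {coeff p} (coeff-* q r) i)

    *ₚ-comm : ∀ p q → p *ₚ q ≈ₚ q *ₚ p
    *ₚ-comm p q = via (p *ₚ q) (q *ₚ p) (coeff-* p q) (coeff-* q p) (S.*ₛ-comm (coeff p) (coeff q))

    *ₚ-identityˡ : ∀ p → 1ₚ *ₚ p ≈ₚ p
    *ₚ-identityˡ p = via (1ₚ *ₚ p) p (coeff-* 1ₚ p) (λ _ → refl)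
      (ₛ.trans (ₛ.*-congʳ {coeff p} coeff-1) (ₛ.*-identityˡ (coeff p)))

    *ₚ-distribʳ : ∀ r p q → (p +ₚ q) *ₚ r ≈ₚ p *ₚ r +ₚ q *ₚ r
    *ₚ-distribʳ r p q = via ((p +ₚ q) *ₚ r) (p *ₚ r +ₚ q *ₚ r)
      (λ i → trans (coeff-* (p +ₚ q) r i) (ₛ.*-congʳ {coeff r} (coeff-+ p q) i))
      (λ i → trans (coeff-+ (p *ₚ r) (q *ₚ r) i) (+-cong (coeff-* p r i) (coeff-* q r i)))
      (S.*ₛ-distribʳ (coeff r) (coeff p) (coeff q))

  polynomialRing : CommutativeRing c ℓ₁
  polynomialRing = record
    { Carrier = Poly ; _≈_ = _≈ₚ_ ; _+_ = _+ₚ_ ; _*_ = _*ₚ_ ; -_ = -ₚ_ ; 0# = [] ; 1# = 1ₚ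
    ; isCommutativeRing = record
      { isRing = record
        { +-isAbelianGroup = record
          { isGroup = record
            { isMonoid = record
              { isSemigroup = record
                { isMagma = record
                  { isEquivalence = record
                    { refl = λ _ → refl ; sym = λ p i → sym (p i) ; trans = λ p q i → trans (p i) (q i) }
                  ; ∙-cong = λ {p} {p′} {q} {q′} → +ₚ-cong {p} {p′} {q} {q′} }
                ; assoc = λ p q r i → trans (coeff-+ (p +ₚ q) r i) (trans (+-congʳ (coeff-+ p q i))
                    (trans (+-assoc _ _ _) (sym (trans (coeff-+ p (q +ₚ r) i) (+-congˡ (coeff-+ q r i)))))) }
              ; identity = (λ p i → refl) , λ p i → trans (coeff-+ p [] i) (+-identityʳ _) }
            ; inverse = (λ p i → trans (coeff-+ (-ₚ p) p i) (trans (+-congʳ (coeff-neg p i)) (-‿inverseˡ _)))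
                      , (λ p i → trans (coeff-+ p (-ₚ p) i) (trans (+-congˡ (coeff-neg p i)) (-‿inverseʳ _)))
            ; ⁻¹-cong = λ {p} {q} p≈q i → trans (coeff-neg p i) (trans (-‿cong (p≈q i)) (sym (coeff-neg q i))) }
          ; comm = λ p q i → trans (coeff-+ p q i) (trans (+-comm _ _) (sym (coeff-+ q p i))) }
        ; *-cong = λ {p} {p′} {q} {q′} p≈ q≈ → via (p *ₚ q) (p′ *ₚ q′) (coeff-* p q) (coeff-* p′ q′)
            (S.*ₛ-cong {coeff p} {coeff p′} {coeff q} {coeff q′} p≈ q≈)
        ; *-assoc = λ p q r → via (p *ₚ q *ₚ r) (p *ₚ (q *ₚ r)) (coeff-** p q r) (coeff-**ʳ p q r)
            (S.*ₛ-assoc (coeff p) (coeff q) (coeff r))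
        ; *-identity = *ₚ-identityˡ , λ p i → trans (*ₚ-comm p 1ₚ i) (*ₚ-identityˡ p i)
        ; distrib = (λ r p q i → trans (*ₚ-comm r (p +ₚ q) i) (trans (*ₚ-distribʳ r p q i)
                      (+ₚ-cong {p *ₚ r} {r *ₚ p} {q *ₚ r} {r *ₚ q} (*ₚ-comm p r) (*ₚ-comm q r) i)))
                  , *ₚ-distribʳ
        }
      ; *-comm = *ₚ-comm } }

  module ₚ = CommutativeRing polynomialRing

  derivative-cong : ∀ {p q} → p ≈ₚ q → derivative p ≈ₚ derivative q
  derivative-cong {p} {q} p≈q = via (derivative p) (derivative q) (coeff-derivative p) (coeff-derivative q)
    (SD.D-cong p≈q)

  derivative-+ : ∀ p q → derivative (p +ₚ q) ≈ₚ derivative p +ₚ derivative q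
  derivative-+ p q = via (derivative (p +ₚ q)) (derivative p +ₚ derivative q)
    (ₛ.trans (coeff-derivative (p +ₚ q)) (SD.D-cong (coeff-+ p q)))
    (λ i → trans (coeff-+ (derivative p) (derivative q) i) (+-cong (coeff-derivative p i) (coeff-derivative q i)))
    (SD.D-+ₛ (coeff p) (coeff q))

  derivative-* : ∀ p q → derivative (p *ₚ q) ≈ₚ derivative p *ₚ q +ₚ p *ₚ derivative q
  derivative-* p q = via (derivative (p *ₚ q)) (derivative p *ₚ q +ₚ p *ₚ derivative q)
    (ₛ.trans (coeff-derivative (p *ₚ q)) (SD.D-cong (coeff-* p q)))
    (λ i → trans (coeff-+ (derivative p *ₚ q) (p *ₚ derivative q) i) (+-cong
      (trans (coeff-* (derivative p) q i) (ₛ.*-congʳ {coeff q} (coeff-derivative p) i))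
      (trans (coeff-* p (derivative q) i) (ₛ.*-congˡ {coeff p} (coeff-derivative q) i))))
    (SD.D-*ₛ (coeff p) (coeff q))

  derivative-const : ∀ a → derivative (const a) ≈ₚ []
  derivative-const a zero    = refl
  derivative-const a (suc i) = refl

  derivative-X : derivative X ≈ₚ 1ₚ
  derivative-X zero          = +-identityʳ _
  derivative-X (suc zero)    = refl
  derivative-X (suc (suc i)) = refl

  •≈const* : ∀ a p → a •ₚ p ≈ₚ const a *ₚ p
  •≈const* a p i = trans (coeff-• a p i) (sym (trans (coeff-* (const a) p i)
    (trans (ₛ.*-congʳ {coeff p} coeff-const i) (S.·t^0-* a (coeff p) i))))
    where
    coeff-const : coeff (const a) ≈ₛ a S.·t^ 0
    coeff-const zero    = refl
    coeff-const (suc i) = refl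

  const-cong : ∀ {a b} → a ≈ b → const a ≈ₚ const b
  const-cong a≈b zero    = a≈b
  const-cong a≈b (suc i) = refl

  const-* : ∀ a b → const (a * b) ≈ₚ const a *ₚ const b
  const-* a b = •≈const* a (const b)

  const-0 : const 0# ≈ₚ []
  const-0 zero    = refl
  const-0 (suc i) = refl

  eval-+ : ∀ p q x → eval (p +ₚ q) x ≈ eval p x + eval q x
  eval-+ []      q       x = sym (+-identityˡ _)
  eval-+ (a ∷ p) []      x = sym (+-identityʳ _)
  eval-+ (a ∷ p) (b ∷ q) x = trans (+-congˡ (*-congˡ (eval-+ p q x)))
    (solve 5 (λ a b x y z → a :+ b :+ x :* (y :+ z) := (a :+ x :* y) :+ (b :+ x :* z)) refl a b x (eval p x) (eval q x))

  eval-• : ∀ a p x → eval (a •ₚ p) x ≈ a * eval p x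
  eval-• a []      x = sym (zeroʳ a)
  eval-• a (b ∷ p) x = trans (+-congˡ (*-congˡ (eval-• a p x)))
    (solve 4 (λ a b x y → a :* b :+ x :* (a :* y) := a :* (b :+ x :* y)) refl a b x (eval p x))

  eval-* : ∀ p q x → eval (p *ₚ q) x ≈ eval p x * eval q x
  eval-* []      q x = sym (zeroˡ _)
  eval-* (a ∷ p) q x = trans (eval-+ (a •ₚ q) (0# ∷ p *ₚ q) x)
    (trans (+-cong (eval-• a q x) (+-congˡ (*-congˡ (eval-* p q x))))
      (solve 4 (λ a x p q → a :* q :+ (con (+ 0) :+ x :* (p :* q)) := (a :+ x :* p) :* q)
           refl a x (eval p x) (eval q x)))

  -- Equal polynomials may be lists of different lengths; this disposes of the trailing zeros in
  -- `eval-cong`.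
  eval-≈0 : ∀ p x → p ≈ₚ [] → eval p x ≈ 0#
  eval-≈0 []      x p≈0 = refl
  eval-≈0 (a ∷ p) x p≈0 = trans (+-cong (p≈0 0) (*-congˡ (eval-≈0 p x (λ i → p≈0 (suc i)))))
    (trans (+-identityˡ _) (zeroʳ x))

  eval-cong : ∀ {p q} x → p ≈ₚ q → eval p x ≈ eval q x
  eval-cong {[]}    {q}     x p≈q = sym (eval-≈0 q x (λ i → sym (p≈q i)))
  eval-cong {a ∷ p} {[]}    x p≈q = eval-≈0 (a ∷ p) x p≈q
  eval-cong {a ∷ p} {b ∷ q} x p≈q = +-cong (p≈q 0) (*-congˡ (eval-cong {p} {q} x (λ i → p≈q (suc i))))
 

-- Nonnegativity and positivity without a decidable order

module Order {c ℓ₁ ℓ₂ ℓ₃} (ℝ : RealNumbers c ℓ₁ ℓ₂ ℓ₃) where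
  open RealNumbers ℝ hiding (refl; sym; trans)
  open Notions ℝ
  open Polynomials ℝ
  open CommutativeRing realRing using (refl; sym; trans)
  open IntegerSolver realRing
  module < = IsStrictPartialOrder isStrictPartialOrder

  #-resp : ∀ {x y x′ y′} → x ≈ x′ → y ≈ y′ → x # y → x′ # y′
  #-resp x≈ y≈ x#y with #⇒invertible x#y
  ... | z , p , q = invertible⇒# (z , trans (*-congˡ eq) p , trans (*-congʳ eq) q)
    where eq = +-cong (sym x≈) (-‿cong (sym y≈))

  <-resp : ∀ {x y x′ y′} → x ≈ x′ → y ≈ y′ → x < y → x′ < y′
  <-resp x≈ y≈ x<y = <.<-respˡ-≈ x≈ (<.<-respʳ-≈ y≈ x<y)

  ≤-resp : ∀ {x y} → x ≈ y → 0# ≤ x → 0# ≤ y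
  ≤-resp x≈y 0≤x y<0 = 0≤x (<-resp (sym x≈y) refl y<0)

  <⇒0≤ : ∀ {x} → 0# < x → 0# ≤ x
  <⇒0≤ 0<x x<0 = <.irrefl refl (<.trans 0<x x<0)

  0≤0 : 0# ≤ 0#
  0≤0 = <.irrefl refl

  #0⇒pos : ∀ {x} → x # 0# → 0# ≤ x → 0# < x
  #0⇒pos x#0 0≤x with Equivalence.to #⇔< x#0
  ... | inj₁ x<0 = ⊥-elim (0≤x x<0)
  ... | inj₂ 0<x = 0<x

  +-pos : ∀ {x y} → 0# < x → 0# < y → 0# < x + y
  +-pos {x} {y} 0<x 0<y = <.trans 0<y (<-resp (+-identityˡ y) refl (+-monoˡ-< y 0<x))

  ≤∧≯⇒≈0 : ∀ {x} → 0# ≤ x → ¬ (0# < x) → x ≈ 0#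
  ≤∧≯⇒≈0 0≤x 0≮x = proj₁ (tight _ _) (λ x#0 → 0≮x (#0⇒pos x#0 0≤x))

  sum<0∧pos⇒<0 : ∀ {x y} → x + y < 0# → 0# < x → y < 0#
  sum<0∧pos⇒<0 {x} {y} x+y<0 0<x = <.trans
    (<-resp (solve 2 (λ x y → x :+ y :+ :- x := y) refl x y) (+-identityˡ _) (+-monoˡ-< (- x) x+y<0))
    (<-resp (+-identityˡ _) (-‿inverseʳ x) (+-monoˡ-< (- x) 0<x))

  -- Suppose the sum is negative. Were `x` positive, `y` would be negative; so `x` is not positive,
  -- hence equal to 0 by tightness, and then the sum is `y`.
  +-0≤ : ∀ {x y} → 0# ≤ x → 0# ≤ y → 0# ≤ x + y
  +-0≤ {x} {y} 0≤x 0≤y x+y<0 =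
    0≤y (<-resp (trans (+-congʳ x≈0) (+-identityˡ y)) refl x+y<0)
    where x≈0 = ≤∧≯⇒≈0 0≤x (λ 0<x → 0≤y (sum<0∧pos⇒<0 x+y<0 0<x))

  *-0≤ : ∀ {x y} → 0# ≤ x → 0# ≤ y → 0# ≤ x * y
  *-0≤ {x} {y} 0≤x 0≤y xy<0 = <.irrefl (trans (*-congʳ x≈0) (zeroˡ y)) xy<0
    where
    x≈0 = ≤∧≯⇒≈0 0≤x λ 0<x → <.irrefl
      (trans (*-congˡ (≤∧≯⇒≈0 0≤y (λ 0<y → <⇒0≤ (*-pos 0<x 0<y) xy<0))) (zeroʳ x)) xy<0

  -- Cotransitivity replaces the case split on `y`: as `x` is apart from 0, either `x + y` is apart
  -- from 0, and being nonnegative it is positive, or it is apart from `x`, which makes `y` apart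
  -- from 0 and hence positive.
  +-pos-0≤ : ∀ {x y} → 0# < x → 0# ≤ y → 0# < x + y
  +-pos-0≤ {x} {y} 0<x 0≤y with #-cotrans (pos⇒#0 0<x) (x + y)
  ... | inj₂ x+y#0 = #0⇒pos x+y#0 (+-0≤ (<⇒0≤ 0<x) 0≤y)
  ... | inj₁ x#x+y with #⇒invertible (#-sym x#x+y)
  ...   | z , p , q = +-pos 0<x (#0⇒pos (invertible⇒# (z , trans (*-congˡ eq) p , trans (*-congʳ eq) q)) 0≤y)
    where eq = solve 2 (λ x y → y :- con (+ 0) := x :+ y :- x) refl x y

  nat-0≤ : ∀ n → 0# ≤ nat n
  nat-0≤ zero    = 0≤0
  nat-0≤ (suc n) = <⇒0≤ (nat-pos n)

  sum-0≤ : ∀ n f → (∀ k → 0# ≤ f k) → 0# ≤ S.sum≤ n f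
  sum-0≤ zero    f 0≤f = +-0≤ (0≤f 0) 0≤0
  sum-0≤ (suc n) f 0≤f = +-0≤ (0≤f 0) (sum-0≤ n (S.shift f) (λ k → 0≤f (suc k)))

  NonNegCoeffs-resp : ∀ {p q} → p ≈ₚ q → NonNegCoeffs p → NonNegCoeffs q
  NonNegCoeffs-resp p≈q 0≤p i = ≤-resp (p≈q i) (0≤p i)

  NonNegCoeffs-0 : NonNegCoeffs []
  NonNegCoeffs-0 i = 0≤0

  NonNegCoeffs-const : ∀ {a} → 0# ≤ a → NonNegCoeffs (const a)
  NonNegCoeffs-const 0≤a zero    = 0≤a
  NonNegCoeffs-const 0≤a (suc i) = 0≤0

  NonNegCoeffs-X : NonNegCoeffs X
  NonNegCoeffs-X zero          = 0≤0
  NonNegCoeffs-X (suc zero)    = <⇒0≤ 0<1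
  NonNegCoeffs-X (suc (suc i)) = 0≤0

  NonNegCoeffs-+ : ∀ {p q} → NonNegCoeffs p → NonNegCoeffs q → NonNegCoeffs (p +ₚ q)
  NonNegCoeffs-+ {p} {q} 0≤p 0≤q i = ≤-resp (sym (coeff-+ p q i)) (+-0≤ (0≤p i) (0≤q i))

  NonNegCoeffs-* : ∀ {p q} → NonNegCoeffs p → NonNegCoeffs q → NonNegCoeffs (p *ₚ q)
  NonNegCoeffs-* {p} {q} 0≤p 0≤q i = ≤-resp (sym (coeff-* p q i))
    (sum-0≤ i (λ k → coeff p k * coeff q (i ℕ.∸ k)) (λ k → *-0≤ (0≤p k) (0≤q (i ℕ.∸ k))))

-- The array over a ring with derivation, and its identities

module TangentArray {c ℓ} (R : CommutativeRing c ℓ) where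
  open CommutativeRing R

  module WithDerivation
    (d : Carrier → Carrier)
    (d-cong : ∀ {x y} → x ≈ y → d x ≈ d y)
    (d-+ : ∀ x y → d (x + y) ≈ d x + d y)
    (d-* : ∀ x y → d (x * y) ≈ d x * y + x * d y)
    (x β ν : Carrier) (d-x : d x ≈ 1#) (d-β : d β ≈ 0#) (d-ν : d ν ≈ 0#)
    (κ : ℕ → Carrier) (κ-0 : κ 0 ≈ 0#) (κ-suc : ∀ n → κ (suc n) ≈ 1# + κ n)
    (r : ℕ → Carrier) (u : Carrier) (w : ℕ → Carrier) where

    private
      2# : Carrier
      2# = 1# + 1#

    -- Differentiate βhP + ν(h² + a²)P′ k times in h. The summand βh gives β in `ρ` and kβ in `ω`;
    -- the summand νh² gives 2νk in `ρ` and νk(k - 1) in `ω`. At k = 0 the value of `pred` is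
    -- immaterial because of the factor `κ k`.
    ρ ω : ℕ → Carrier
    ρ k = 2# * ν * κ k + β
    ω k = κ k * (β + ν * κ (pred k))

    module Properties (r≈ : ∀ k → r k ≈ ρ k * (1# + x)) (u≈ : u ≈ 2# * ν * (1# + x * x)) (w≈ : ∀ k → w k ≈ ω k) where
      open IntegerSolver R
      open SetoidReasoning setoid

      private
        :2 : ∀ {n} → Polynomial n
        :2 = con (+ 1) :+ con (+ 1)

      w₀≈0 : w 0 ≈ 0#
      w₀≈0 = trans (w≈ 0) (trans (*-congʳ κ-0) (zeroˡ _))

      open ThreeTermArray R r u w w₀≈0 public

      ρ-suc : ∀ k → ρ (suc k) ≈ ρ k + 2# * ν
      ρ-suc k = trans (+-congʳ (*-congˡ (κ-suc k)))
        (solve 3 (λ n k b → :2 :* n :* (con (+ 1) :+ k) :+ b := (:2 :* n :* k :+ b) :+ :2 :* n) refl ν (κ k) β)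

      -- (k + 1)(β + νk) - k(β + ν(k - 1)) = β + 2νk. The case k = 0 is separate only because of
      -- `pred`.
      ω-suc : ∀ k → ω (suc k) ≈ ρ k + ω k
      ω-suc zero    = trans (*-cong (κ-suc 0) refl) (trans (*-cong (+-congˡ κ-0) (+-congˡ (*-congˡ κ-0)))
        (trans (solve 2 (λ n b → (con (+ 1) :+ con (+ 0)) :* (b :+ n :* con (+ 0)) :=
            (:2 :* n :* con (+ 0) :+ b) :+ con (+ 0) :* (b :+ n :* con (+ 0))) refl ν β)
          (sym (+-cong (+-congʳ (*-congˡ κ-0)) (*-cong κ-0 (+-congˡ (*-congˡ κ-0)))))))
      ω-suc (suc k) = trans (*-cong (trans (κ-suc (suc k)) (+-congˡ (κ-suc k))) (+-congˡ (*-congˡ (κ-suc k))))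
        (trans (solve 3 (λ n b k → (con (+ 1) :+ (con (+ 1) :+ k)) :* (b :+ n :* (con (+ 1) :+ k)) :=
            (:2 :* n :* (con (+ 1) :+ k) :+ b) :+ (con (+ 1) :+ k) :* (b :+ n :* k)) refl ν β (κ k))
          (sym (+-cong (+-congʳ (*-congˡ (κ-suc k))) (*-congʳ (κ-suc k)))))

      d-0 : d 0# ≈ 0#
      d-0 = begin
        d 0#                    ≈⟨ d-cong (zeroˡ 0#) ⟨
        d (0# * 0#)             ≈⟨ d-* 0# 0# ⟩
        d 0# * 0# + 0# * d 0#   ≈⟨ solve 1 (λ y → y :* con (+ 0) :+ con (+ 0) :* y := con (+ 0)) refl (d 0#) ⟩
        0#                      ∎

      d-1 : d 1# ≈ 0#
      d-1 = begin
        d 1#                           ≈⟨ solve 1 (λ y → y := y :* con (+ 1) :+ con (+ 1) :* y :- y) refl (d 1#) ⟩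
        d 1# * 1# + 1# * d 1# - d 1#   ≈⟨ +-congʳ (d-* 1# 1#) ⟨
        d (1# * 1#) - d 1#             ≈⟨ +-congʳ (d-cong (*-identityˡ 1#)) ⟩
        d 1# - d 1#                    ≈⟨ -‿inverseʳ _ ⟩
        0#                             ∎

      Constant : Carrier → Set ℓ
      Constant a = d a ≈ 0#

      +-const : ∀ {a b} → Constant a → Constant b → Constant (a + b)
      +-const p q = trans (d-+ _ _) (trans (+-cong p q) (+-identityʳ 0#))

      *-const : ∀ {a b} → Constant a → Constant b → Constant (a * b)
      *-const p q = trans (d-* _ _)
           (trans (+-cong (trans (*-congʳ p) (zeroˡ _)) (trans (*-congˡ q) (zeroʳ _))) (+-identityʳ 0#))

      κ-const : ∀ k → Constant (κ k)
      κ-const zero    = trans (d-cong κ-0) d-0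
      κ-const (suc k) = trans (d-cong (κ-suc k)) (+-const d-1 (κ-const k))

      E : Carrier → Carrier
      E y = (1# - x) * d y

      E-const-* : ∀ {a} y → Constant a → E (a * y) ≈ a * E y
      E-const-* {a} y a-const = begin
        (1# - x) * d (a * y)           ≈⟨ *-congˡ (trans (d-* a y) (+-congʳ (*-congʳ a-const))) ⟩
        (1# - x) * (0# * y + a * d y)
          ≈⟨ solve 4 (λ x a y dy → (con (+ 1) :- x) :* (con (+ 0) :* y :+ a :* dy) := a :* ((con (+ 1) :- x) :* dy))
               refl x a y (d y) ⟩
        a * ((1# - x) * d y)           ∎

      2ν-const : Constant (2# * ν)
      2ν-const = *-const (+-const d-1 d-1) d-ν

      -- (1 - x) + (1 + x) = 2 leaves twice `ρ k + ω k`, which is twice the next `ω`.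
      E-r : ∀ k → E (r k) + r k + 2# * w k ≈ 2# * w (suc k)
      E-r k = begin
        E (r k) + r k + 2# * w k
          ≈⟨ +-cong (+-cong (trans (*-congˡ (d-cong (r≈ k))) (trans
               (E-const-* (1# + x) (+-const (*-const 2ν-const (κ-const k)) d-β))
               (*-congˡ (*-congˡ (trans (d-+ 1# x) (+-cong d-1 d-x)))))) (r≈ k)) (*-congˡ (w≈ k)) ⟩
        ρ k * ((1# - x) * (0# + 1#)) + ρ k * (1# + x) + 2# * ω k
          ≈⟨ solve 3 (λ p x w → p :* ((con (+ 1) :- x) :* (con (+ 0) :+ con (+ 1))) :+ p :*
               (con (+ 1) :+ x) :+ :2 :* w := :2 :* (p :+ w)) refl (ρ k) x (ω k) ⟩
        2# * (ρ k + ω k)  ≈⟨ *-congˡ (trans (w≈ (suc k)) (ω-suc k)) ⟨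
        2# * w (suc k)    ∎

      -- (1 - x)(2x) + 2(1 + x²) = 2(1 + x), and 2ν is the increment of `ρ`.
      E-u : ∀ k → E u + 2# * r k + 2# * u ≈ 2# * r (suc k)
      E-u k = begin
        E u + 2# * r k + 2# * u
          ≈⟨ +-cong (+-cong (trans (*-congˡ (d-cong u≈)) (trans (E-const-* (1# + x * x) 2ν-const)
               (*-congˡ (*-congˡ (trans (d-+ 1# (x * x))
                    (+-cong d-1 (trans (d-* x x) (+-cong (*-congʳ d-x) (*-congˡ d-x)))))))))
               (*-congˡ (r≈ k))) (*-congˡ u≈) ⟩
        2# * ν * ((1# - x) * (0# + (1# * x + x * 1#))) + 2# * (ρ k * (1# + x)) + 2# * (2# * ν * (1# + x * x))
          ≈⟨ solve 3 (λ n p x → :2 :* n :* ((con (+ 1) :- x) :* (con (+ 0) :+ (con (+ 1) :* x :+ x :* con (+ 1))))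
               :+ :2 :* (p :* (con (+ 1) :+ x)) :+ :2 :* (:2 :* n :* (con (+ 1) :+ x :* x)) :=
               :2 :* ((p :+ :2 :* n) :* (con (+ 1) :+ x))) refl ν (ρ k) x ⟩
        2# * ((ρ k + 2# * ν) * (1# + x))  ≈⟨ *-congˡ (trans (r≈ (suc k)) (*-congʳ (ρ-suc k))) ⟨
        2# * r (suc k)                    ∎

      E-w : ∀ k → E (w k) ≈ 0#
      E-w k = trans (*-congˡ (trans (d-cong (w≈ k))
        (*-const (κ-const k) (+-const d-β (*-const d-ν (κ-const (pred k))))))) (zeroʳ _)

      open Derivation E (λ p → *-congˡ (d-cong p))
        (λ y z → trans (*-congˡ (d-+ y z)) (distribˡ _ _ _))
        (λ y z → trans (*-congˡ (d-* y z)) (solve 5 (λ x y z dy dz → (con (+ 1) :- x) :* (dy :* z :+ y :* dz)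
           := (con (+ 1) :- x) :* dy :* z :+ y :* ((con (+ 1) :- x) :* dz)) refl x y z (d y) (d z)))
        (trans (*-congˡ d-0) (zeroʳ _)) (trans (*-congˡ d-1) (zeroʳ _))
        κ κ-0 κ-suc E-r E-u E-w public

      -- The cubic factors as (1 - x)(1 + x²), which exhibits the operator `E` and the factor of
      -- `u`. Powers are spelled `x * (x * 1#)` because that is what `X ^ₚ 2` unfolds to.
      column₀-recurrence : ∀ n → A (suc n) 0 ≈
        ((κ n * ν) * (x * (x * 1#)) + β * x + (β + κ n * ν)) * A n 0
        + ν * (- (x * (x * (x * 1#))) + x * (x * 1#) - x + 1#) * d (A n 0)
      column₀-recurrence n = begin
        r 0 * A n 0 + u * A n 1 + w 0 * A n 0
          ≈⟨ +-cong (+-cong (*-congʳ (trans (r≈ 0) (*-congʳ (+-congʳ (*-congˡ κ-0))))) (*-congʳ u≈)) (*-congʳ w₀≈0) ⟩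
        (2# * ν * 0# + β) * (1# + x) * A n 0 + 2# * ν * (1# + x * x) * A n 1 + 0# * A n 0
          ≈⟨ solve 5 (λ n b x p q → (:2 :* n :* con (+ 0) :+ b) :* (con (+ 1) :+ x) :* p :+ :2 :* n :*
               (con (+ 1) :+ x :* x) :* q :+ con (+ 0) :* p
               := b :* (con (+ 1) :+ x) :* p :+ n :* (con (+ 1) :+ x :* x) :* (:2 :* q :+ con (+ 0) :* p))
                    refl ν β x (A n 0) (A n 1) ⟩
        β * (1# + x) * A n 0 + ν * (1# + x * x) * (2# * A n 1 + 0# * A n 0)
          ≈⟨ +-congˡ (*-congˡ (trans (euler n 0) (+-congˡ (*-congʳ κ-0)))) ⟨
        β * (1# + x) * A n 0 + ν * (1# + x * x) * ((1# - x) * d (A n 0) + κ n * A n 0)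
          ≈⟨ solve 6 (λ n b x p dp k → b :* (con (+ 1) :+ x) :* p :+ n :* (con (+ 1) :+ x :* x) :*
               ((con (+ 1) :- x) :* dp :+ k :* p) :=
               ((k :* n) :* (x :* (x :* con (+ 1))) :+ b :* x :+ (b :+ k :* n)) :* p
               :+ n :* (:- (x :* (x :* (x :* con (+ 1)))) :+ x :* (x :* con (+ 1)) :- x :+ con (+ 1)) :* dp)
             refl ν β x (A n 0) (d (A n 0)) (κ n) ⟩
        ((κ n * ν) * (x * (x * 1#)) + β * x + (β + κ n * ν)) * A n 0
          + ν * (- (x * (x * (x * 1#))) + x * (x * 1#) - x + 1#) * d (A n 0) ∎

      -- With (1 + x)² = (1 + x²) + 2x, the subtracted product cancels against the 1 + x² part
      -- alone. The result contains no subtraction, so for nonnegative β and ν its coefficients are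
      -- visibly nonnegative.
      rr-uw≈ : ∀ k → r k * r (suc k) - u * w (suc k) ≈
        (β * β + 2# * ν * κ k * β + 2# * ν * ν * κ k * κ (suc k)) * (1# + x * x) + ρ k * ρ (suc k) * (x + x)
      rr-uw≈ k = begin
        r k * r (suc k) - u * w (suc k)
          ≈⟨ +-cong (*-cong (r≈ k) (trans (r≈ (suc k)) (*-congʳ (+-congʳ (*-congˡ (κ-suc k))))))
               (-‿cong (*-cong u≈ (trans (w≈ (suc k)) (*-congʳ (κ-suc k))))) ⟩
        ρ k * (1# + x) * ((2# * ν * (1# + κ k) + β) * (1# + x)) - 2# * ν * (1# + x * x) * ((1# + κ k) * (β + ν * κ k))
          ≈⟨ solve 4 (λ n b x k → (:2 :* n :* k :+ b) :* (con (+ 1) :+ x) :*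
               ((:2 :* n :* (con (+ 1) :+ k) :+ b) :* (con (+ 1) :+ x))
               :- :2 :* n :* (con (+ 1) :+ x :* x) :* ((con (+ 1) :+ k) :* (b :+ n :* k)) :=
               (b :* b :+ :2 :* n :* k :* b :+ :2 :* n :* n :* k :* (con (+ 1) :+ k)) :* (con (+ 1) :+ x :* x)
               :+ (:2 :* n :* k :+ b) :* (:2 :* n :* (con (+ 1) :+ k) :+ b) :* (x :+ x)) refl ν β x (κ k) ⟩
        (β * β + 2# * ν * κ k * β + 2# * ν * ν * κ k * (1# + κ k)) * (1# + x * x) + ρ k * (2# * ν * (1# + κ k) + β) *
             (x + x)
          ≈⟨ +-cong (*-congʳ (+-congˡ (*-congˡ (κ-suc k)))) (*-congʳ (*-congˡ (+-congʳ (*-congˡ (κ-suc k))))) ⟨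
        (β * β + 2# * ν * κ k * β + 2# * ν * ν * κ k * κ (suc k)) * (1# + x * x) + ρ k * ρ (suc k) * (x + x) ∎
 

-- The array of real polynomials and the given recurrence

module PolynomialArray {c ℓ₁ ℓ₂ ℓ₃} (ℝ : RealNumbers c ℓ₁ ℓ₂ ℓ₃)
  (β ν : RealNumbers.Carrier ℝ) where
  open RealNumbers ℝ hiding (refl; sym; trans)
  open Notions ℝ
  open Polynomials ℝ
  open Order ℝ
  open CommutativeRing realRing using (refl; sym; trans)
  open IntegerSolver realRing
  open SetoidReasoning ₚ.setoid

  r w : ℕ → Poly
  r k = (nat 2 * ν * nat k + β) •ₚ (1ₚ +ₚ X)
  w k = const (nat k * (β + ν * nat (pred k)))

  u : Poly
  u = (nat 2 * ν) •ₚ (1ₚ +ₚ X ^ₚ 2)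

  κ : ℕ → Poly
  κ k = const (nat k)

  private
    2ₚ : Poly
    2ₚ = 1ₚ +ₚ 1ₚ

    const-2ν : const (nat 2 * ν) ≈ₚ 2ₚ *ₚ const ν
    const-2ν = ₚ.trans {const (nat 2 * ν)} {const (nat 2) *ₚ const ν} {2ₚ *ₚ const ν} (const-* (nat 2) ν)
      (ₚ.*-congʳ {const ν} {const (nat 2)} {2ₚ} (const-cong (+-congˡ (+-identityʳ 1#))))

    const-+* : ∀ a b c → const (a + b * c) ≈ₚ const a +ₚ const b *ₚ const c
    const-+* a b c = ₚ.+-congˡ {const a} {const (b * c)} {const b *ₚ const c} (const-* b c)

  module TA = TangentArray.WithDerivation polynomialRing derivative
    (λ {p} {q} → derivative-cong {p} {q}) derivative-+ derivative-*
    X (const β) (const ν) derivative-X (derivative-const β) (derivative-const ν)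
    κ const-0 (λ n → ₚ.refl {κ (suc n)}) r u w

  const-ρ : ∀ k → const (nat 2 * ν * nat k + β) ≈ₚ TA.ρ k
  const-ρ k = ₚ.+-congʳ {const β} {const (nat 2 * ν * nat k)} {2ₚ *ₚ const ν *ₚ κ k}
    (ₚ.trans {const (nat 2 * ν * nat k)} {const (nat 2 * ν) *ₚ κ k} {2ₚ *ₚ const ν *ₚ κ k} (const-* (nat 2 * ν) (nat k))
      (ₚ.*-congʳ {κ k} {const (nat 2 * ν)} {2ₚ *ₚ const ν} const-2ν))

  r≈ : ∀ k → r k ≈ₚ TA.ρ k *ₚ (1ₚ +ₚ X)
  r≈ k = begin
    r k                                             ≈⟨ •≈const* (nat 2 * ν * nat k + β) (1ₚ +ₚ X) ⟩
    const (nat 2 * ν * nat k + β) *ₚ (1ₚ +ₚ X)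
      ≈⟨ ₚ.*-congʳ {1ₚ +ₚ X} {const (nat 2 * ν * nat k + β)} {TA.ρ k} (const-ρ k) ⟩
    TA.ρ k *ₚ (1ₚ +ₚ X)                              ∎

  u≈ : u ≈ₚ 2ₚ *ₚ const ν *ₚ (1ₚ +ₚ X *ₚ X)
  u≈ = begin
    u                                        ≈⟨ •≈const* (nat 2 * ν) (1ₚ +ₚ X ^ₚ 2) ⟩
    const (nat 2 * ν) *ₚ (1ₚ +ₚ X ^ₚ 2)
      ≈⟨ ₚ.*-cong {const (nat 2 * ν)} {2ₚ *ₚ const ν} {1ₚ +ₚ X ^ₚ 2} {1ₚ +ₚ X *ₚ X} const-2ν
           (ₚ.+-congˡ {1ₚ} {X ^ₚ 2} {X *ₚ X} (ₚ.*-congˡ {X} {X *ₚ 1ₚ} {X} (ₚ.*-identityʳ X))) ⟩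
    2ₚ *ₚ const ν *ₚ (1ₚ +ₚ X *ₚ X)          ∎

  w≈ : ∀ k → w k ≈ₚ TA.ω k
  w≈ k = begin
    w k                                         ≈⟨ const-* (nat k) (β + ν * nat (pred k)) ⟩
    κ k *ₚ const (β + ν * nat (pred k))
      ≈⟨ ₚ.*-congˡ {κ k} {const (β + ν * nat (pred k))} {const β +ₚ const ν *ₚ κ (pred k)}
           (const-+* β ν (nat (pred k))) ⟩
    TA.ω k                                       ∎

  open TA.Properties r≈ u≈ w≈ public

  A-suc : ∀ n k → A (suc n) k ≈ₚ r k *ₚ A n k +ₚ u *ₚ A n (suc k) +ₚ w k *ₚ A n (pred k)
  A-suc n k i = refl

  next : ℕ → Poly → Poly
  next n p = ((nat n * ν) •ₚ X ^ₚ 2 +ₚ β •ₚ X +ₚ const (β + nat n * ν)) *ₚ p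
    +ₚ ν •ₚ (-ₚ (X ^ₚ 3) +ₚ X ^ₚ 2 -ₚ X +ₚ 1ₚ) *ₚ derivative p

  next-cong : ∀ n {p q} → p ≈ₚ q → next n p ≈ₚ next n q
  next-cong n {p} {q} p≈q = ₚ.+-cong {a *ₚ p} {a *ₚ q} {b *ₚ derivative p} {b *ₚ derivative q}
    (ₚ.*-congˡ {a} {p} {q} p≈q) (ₚ.*-congˡ {b} {derivative p} {derivative q} (derivative-cong {p} {q} p≈q))
    where
    a = (nat n * ν) •ₚ X ^ₚ 2 +ₚ β •ₚ X +ₚ const (β + nat n * ν)
    b = ν •ₚ (-ₚ (X ^ₚ 3) +ₚ X ^ₚ 2 -ₚ X +ₚ 1ₚ)

  A-next : ∀ n → A (suc n) 0 ≈ₚ next n (A n 0)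
  A-next n = begin
    A (suc n) 0 ≈⟨ column₀-recurrence n ⟩
    a′ *ₚ p +ₚ const ν *ₚ q *ₚ derivative p
      ≈⟨ ₚ.+-cong {a′ *ₚ p} {a *ₚ p} {const ν *ₚ q *ₚ derivative p} {ν •ₚ q *ₚ derivative p}
           (ₚ.*-congʳ {p} {a′} {a} a′≈a)
           (ₚ.*-congʳ {derivative p} {const ν *ₚ q} {ν •ₚ q} (ₚ.sym {ν •ₚ q} {const ν *ₚ q} (•≈const* ν q))) ⟩
    next n p ∎
    where
    p q a a′ : Poly
    p = A n 0
    q = -ₚ (X ^ₚ 3) +ₚ X ^ₚ 2 -ₚ X +ₚ 1ₚ
    a = (nat n * ν) •ₚ X ^ₚ 2 +ₚ β •ₚ X +ₚ const (β + nat n * ν)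
    a′ = κ n *ₚ const ν *ₚ X ^ₚ 2 +ₚ const β *ₚ X +ₚ (const β +ₚ κ n *ₚ const ν)
    a′≈a : a′ ≈ₚ a
    a′≈a = ₚ.sym {a} {a′} (ₚ.+-cong {(nat n * ν) •ₚ X ^ₚ 2 +ₚ β •ₚ X} {κ n *ₚ const ν *ₚ X ^ₚ 2 +ₚ const β *ₚ X}
        {const (β + nat n * ν)} {const β +ₚ κ n *ₚ const ν}
      (ₚ.+-cong {(nat n * ν) •ₚ X ^ₚ 2} {κ n *ₚ const ν *ₚ X ^ₚ 2} {β •ₚ X} {const β *ₚ X}
        (ₚ.trans {(nat n * ν) •ₚ X ^ₚ 2} {const (nat n * ν) *ₚ X ^ₚ 2} {κ n *ₚ const ν *ₚ X ^ₚ 2}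
          (•≈const* (nat n * ν) (X ^ₚ 2)) (ₚ.*-congʳ {X ^ₚ 2} {const (nat n * ν)} {κ n *ₚ const ν} (const-* (nat n) ν)))
        (•≈const* β X))
      (const-+* β (nat n) ν))

  column₀-unique : ∀ (F : ℕ → Poly) → F 0 ≈ₚ 1ₚ → (∀ n → F (suc n) ≈ₚ next n (F n)) → ∀ n → A n 0 ≈ₚ F n
  column₀-unique F F₀ F-suc zero    = ₚ.sym {F 0} {1ₚ} F₀
  column₀-unique F F₀ F-suc (suc n) i = trans (A-next n i) (trans
    (next-cong n {A n 0} {F n} (column₀-unique F F₀ F-suc n) i) (sym (F-suc n i)))

  s : ℕ → Poly
  s i = (nat 2 * ν * nat i * (β + ν * (nat i - 1#))) •ₚ (1ₚ +ₚ X ^ₚ 2)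

  s≈ : ∀ k → s (suc k) ≈ₚ u *ₚ w (suc k)
  s≈ k = begin
    s (suc k)                         ≈⟨ •≈const* σ Q ⟩
    const σ *ₚ Q
      ≈⟨ ₚ.*-congʳ {Q} {const σ} {const (nat 2 * ν) *ₚ w (suc k)}
           (λ i → trans (const-cong σ≈ i) (const-* (nat 2 * ν) ω i)) ⟩
    const (nat 2 * ν) *ₚ w (suc k) *ₚ Q ≈⟨ ₚ.*-assoc (const (nat 2 * ν)) (w (suc k)) Q ⟩
    const (nat 2 * ν) *ₚ (w (suc k) *ₚ Q)
      ≈⟨ ₚ.*-congˡ {const (nat 2 * ν)} {w (suc k) *ₚ Q} {Q *ₚ w (suc k)} (ₚ.*-comm (w (suc k)) Q) ⟩
    const (nat 2 * ν) *ₚ (Q *ₚ w (suc k)) ≈⟨ ₚ.*-assoc (const (nat 2 * ν)) Q (w (suc k)) ⟨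
    const (nat 2 * ν) *ₚ Q *ₚ w (suc k) ≈⟨ ₚ.*-congʳ {w (suc k)} {u} {const (nat 2 * ν) *ₚ Q} (•≈const* (nat 2 * ν) Q) ⟨
    u *ₚ w (suc k)                    ∎
    where
    Q = 1ₚ +ₚ X ^ₚ 2
    σ = nat 2 * ν * nat (suc k) * (β + ν * (nat (suc k) - 1#))
    ω = nat (suc k) * (β + ν * nat k)
    σ≈ : σ ≈ nat 2 * ν * ω
    σ≈ = solve 4 (λ t n b k → t :* n :* (con (+ 1) :+ k) :* (b :+ n :* ((con (+ 1) :+ k) :- con (+ 1))) :=
      t :* n :* ((con (+ 1) :+ k) :* (b :+ n :* k))) refl (nat 2) ν β (nat k)

  A-jFraction : SeriesP.HasJFraction (λ n → A n 0) r s
  A-jFraction = JFraction.jFraction s s≈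

  module NonNegative (0≤β : 0# ≤ β) (0≤ν : 0# ≤ ν) where
    private
      infixl 6 _⊕_
      infixl 7 _⊗_
      _⊕_ : ∀ {p q} → NonNegCoeffs p → NonNegCoeffs q → NonNegCoeffs (p +ₚ q)
      _⊕_ {p} {q} = NonNegCoeffs-+ {p} {q}
      _⊗_ : ∀ {p q} → NonNegCoeffs p → NonNegCoeffs q → NonNegCoeffs (p *ₚ q)
      _⊗_ {p} {q} = NonNegCoeffs-* {p} {q}
      1⁺ : NonNegCoeffs 1ₚ
      1⁺ = NonNegCoeffs-const (<⇒0≤ 0<1)
      X⁺ : NonNegCoeffs X
      X⁺ = NonNegCoeffs-X
      β⁺ : NonNegCoeffs (const β)
      β⁺ = NonNegCoeffs-const 0≤β
      ν⁺ : NonNegCoeffs (const ν)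
      ν⁺ = NonNegCoeffs-const 0≤ν
      κ⁺ : ∀ k → NonNegCoeffs (κ k)
      κ⁺ k = NonNegCoeffs-const (nat-0≤ k)
      2ν⁺ : NonNegCoeffs (2ₚ *ₚ const ν)
      2ν⁺ = _⊗_ {2ₚ} {const ν} (_⊕_ {1ₚ} {1ₚ} 1⁺ 1⁺) ν⁺
      ρ⁺ : ∀ k → NonNegCoeffs (TA.ρ k)
      ρ⁺ k = _⊕_ {2ₚ *ₚ const ν *ₚ κ k} {const β} (_⊗_ {2ₚ *ₚ const ν} {κ k} 2ν⁺ (κ⁺ k)) β⁺
      1+X²⁺ : NonNegCoeffs (1ₚ +ₚ X *ₚ X)
      1+X²⁺ = _⊕_ {1ₚ} {X *ₚ X} 1⁺ (_⊗_ {X} {X} X⁺ X⁺)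

    r-nonNeg : ∀ k → NonNegCoeffs (r k)
    r-nonNeg k = NonNegCoeffs-resp {TA.ρ k *ₚ (1ₚ +ₚ X)} {r k} (ₚ.sym {r k} {TA.ρ k *ₚ (1ₚ +ₚ X)} (r≈ k))
      (_⊗_ {TA.ρ k} {1ₚ +ₚ X} (ρ⁺ k) (_⊕_ {1ₚ} {X} 1⁺ X⁺))

    u-nonNeg : NonNegCoeffs u
    u-nonNeg = NonNegCoeffs-resp {2ₚ *ₚ const ν *ₚ (1ₚ +ₚ X *ₚ X)} {u} (ₚ.sym {u} {2ₚ *ₚ const ν *ₚ (1ₚ +ₚ X *ₚ X)} u≈)
      (_⊗_ {2ₚ *ₚ const ν} {1ₚ +ₚ X *ₚ X} 2ν⁺ 1+X²⁺)

    ω-0≤ : ∀ k → 0# ≤ nat k * (β + ν * nat (pred k))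
    ω-0≤ k = *-0≤ (nat-0≤ k) (+-0≤ 0≤β (*-0≤ 0≤ν (nat-0≤ (pred k))))

    rr-uw-nonNeg : ∀ k → NonNegCoeffs (r k *ₚ r (suc k) -ₚ u *ₚ w (suc k))
    rr-uw-nonNeg k = NonNegCoeffs-resp {τ *ₚ Q +ₚ ρρ *ₚ (X +ₚ X)} {r k *ₚ r (suc k) -ₚ u *ₚ w (suc k)}
      (ₚ.sym {r k *ₚ r (suc k) -ₚ u *ₚ w (suc k)} {τ *ₚ Q +ₚ ρρ *ₚ (X +ₚ X)} (rr-uw≈ k))
      (_⊕_ {τ *ₚ Q} {ρρ *ₚ (X +ₚ X)}
        (_⊗_ {τ} {Q} (_⊕_ {const β *ₚ const β +ₚ τ₁ *ₚ const β} {τ₂ *ₚ κ (suc k)}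
          (_⊕_ {const β *ₚ const β} {τ₁ *ₚ const β} (_⊗_ {const β} {const β} β⁺ β⁺)
            (_⊗_ {τ₁} {const β} (_⊗_ {2ₚ *ₚ const ν} {κ k} 2ν⁺ (κ⁺ k)) β⁺))
          (_⊗_ {τ₂} {κ (suc k)} (_⊗_ {2ₚ *ₚ const ν *ₚ const ν} {κ k} (_⊗_ {2ₚ *ₚ const ν} {const ν} 2ν⁺ ν⁺) (κ⁺ k))
               (κ⁺ (suc k))))
          1+X²⁺)
        (_⊗_ {ρρ} {X +ₚ X} (_⊗_ {TA.ρ k} {TA.ρ (suc k)} (ρ⁺ k) (ρ⁺ (suc k))) (_⊕_ {X} {X} X⁺ X⁺)))
      where
      Q = 1ₚ +ₚ X *ₚ X
      ρρ = TA.ρ k *ₚ TA.ρ (suc k)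
      τ₁ = 2ₚ *ₚ const ν *ₚ κ k
      τ₂ = 2ₚ *ₚ const ν *ₚ const ν *ₚ κ k
      τ = const β *ₚ const β +ₚ τ₁ *ₚ const β +ₚ τ₂ *ₚ κ (suc k)

    open Minors {NonNeg = NonNegCoeffs} (λ {p} {q} → NonNegCoeffs-resp {p} {q})
      NonNegCoeffs-0 1⁺ (λ {p} {q} → NonNegCoeffs-+ {p} {q}) (λ {p} {q} → NonNegCoeffs-* {p} {q})
      r-nonNeg u-nonNeg (λ k → NonNegCoeffs-const (ω-0≤ k)) rr-uw-nonNeg public
 

-- Differential equations of the column generating functions

module TangentODE {c ℓ} (R : CommutativeRing c ℓ) where
  open CommutativeRing R

  -- The ring has no division, so the constants are pinned down by equations: `q` is (1 + x)/(1 -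
  -- x), `ι` is 1/(ν(1 - x)) and `α` is -β/ν. `C` and `S` stand for the cosine and sine of ν(1 -
  -- x)t, and `Φ` for F^α, which enters through its differential equation.
  module Solution
    (d : Carrier → Carrier)
    (d-cong : ∀ {x y} → x ≈ y → d x ≈ d y)
    (d-+ : ∀ x y → d (x + y) ≈ d x + d y)
    (d-* : ∀ x y → d (x * y) ≈ d x * y + x * d y)
    (d-neg : ∀ x → d (- x) ≈ - d x)
    (d-1 : d 1# ≈ 0#)
    (x β ν q ι α : Carrier) (d-q : d q ≈ 0#) (d-ι : d ι ≈ 0#)
    (ι-inv : ν * (1# - x) * ι ≈ 1#) (q-def : q * (1# - x) ≈ 1# + x) (α-def : α * ν ≈ - β)
    (C S F⁻¹ Φ : Carrier)
    (d-C : d C ≈ - (ν * (1# - x) * S)) (d-S : d S ≈ ν * (1# - x) * C) (C²+S² : C * C + S * S ≈ 1#)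
    (F*F⁻¹ : (C - q * S) * F⁻¹ ≈ 1#)
    (F*dΦ : (C - q * S) * d Φ ≈ α * (d (C - q * S) * Φ))
    where
    open IntegerSolver R
    open SetoidReasoning setoid

    private
      :1 :2 : ∀ {n} → Polynomial n
      :1 = con (+ 1)
      :2 = :1 :+ :1
      2# a F : Carrier
      2# = 1# + 1#
      a = ν * (1# - x)
      F = C - q * S

      -- These two identities turn g′ = F⁻² into a Riccati equation.
      ν[1+x]ι : ν * (1# + x) * ι ≈ q
      ν[1+x]ι = begin
        ν * (1# + x) * ι         ≈⟨ *-congʳ (*-congˡ q-def) ⟨
        ν * (q * (1# - x)) * ι   ≈⟨ solve 4 (λ n q y i → n :* (q :* y) :* i := q :* (n :* y :* i)) refl ν q (1# - x) ι ⟩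
        q * (ν * (1# - x) * ι)   ≈⟨ *-congˡ ι-inv ⟩
        q * 1#                   ≈⟨ *-identityʳ q ⟩
        q                        ∎

      2ν²[1+x²]ι² : 2# * ν * ν * (1# + x * x) * ι * ι ≈ 1# + q * q
      2ν²[1+x²]ι² = begin
        2# * ν * ν * (1# + x * x) * ι * ι
          ≈⟨ solve 3 (λ n x i → :2 :* n :* n :* (:1 :+ x :* x) :* i :* i :=
               (n :* (:1 :- x) :* i) :* (n :* (:1 :- x) :* i) :+ (n :* (:1 :+ x) :* i) :* (n :* (:1 :+ x) :* i))
                    refl ν x ι ⟩
        a * ι * (a * ι) + ν * (1# + x) * ι * (ν * (1# + x) * ι)
          ≈⟨ +-cong (*-cong ι-inv ι-inv) (*-cong ν[1+x]ι ν[1+x]ι) ⟩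
        1# * 1# + q * q          ≈⟨ +-congʳ (*-identityʳ 1#) ⟩
        1# + q * q               ∎

    g : Carrier
    g = ι * (S * F⁻¹)

    private
      d-F : d F ≈ - (a * S) - q * (a * C)
      d-F = begin
        d (C - q * S)
          ≈⟨ trans (d-+ _ _) (+-cong d-C
               (trans (d-neg _) (-‿cong (trans (d-* q S) (+-cong (*-congʳ d-q) (*-congˡ d-S)))))) ⟩
        - (a * S) - (0# * S + q * (a * C)) ≈⟨ +-congˡ (-‿cong (trans (+-congʳ (zeroˡ S)) (+-identityˡ _))) ⟩
        - (a * S) - q * (a * C)      ∎

      d-F⁻¹ : d F⁻¹ ≈ - (d F * F⁻¹ * F⁻¹)
      d-F⁻¹ = begin
        d F⁻¹                                        ≈⟨ *-identityˡ _ ⟨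
        1# * d F⁻¹                                   ≈⟨ *-congʳ F*F⁻¹ ⟨
        F * F⁻¹ * d F⁻¹
          ≈⟨ solve 4 (λ F G dF dG → F :* G :* dG := G :* (dF :* G :+ F :* dG) :- dF :* G :* G)
               refl F F⁻¹ (d F) (d F⁻¹) ⟩
        F⁻¹ * (d F * F⁻¹ + F * d F⁻¹) - d F * F⁻¹ * F⁻¹
          ≈⟨ +-congʳ (*-congˡ (trans (sym (d-* F F⁻¹)) (trans (d-cong F*F⁻¹) d-1))) ⟩
        F⁻¹ * 0# - d F * F⁻¹ * F⁻¹                   ≈⟨ trans (+-congʳ (zeroʳ _)) (+-identityˡ _) ⟩
        - (d F * F⁻¹ * F⁻¹)                          ∎

      -- In the quotient rule for S/F the numerator S′F - SF′ is the Wronskian a(C² + S²) = a, and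
      -- `ι` is the inverse of `a`.
      d-g≈F⁻² : d g ≈ F⁻¹ * F⁻¹
      d-g≈F⁻² = begin
        d (ι * (S * F⁻¹))
          ≈⟨ trans (d-* _ _) (+-cong (*-congʳ d-ι) (*-congˡ (trans (d-* _ _) (+-cong (*-congʳ d-S) (*-congˡ d-F⁻¹))))) ⟩
        0# * (S * F⁻¹) + ι * (a * C * F⁻¹ + S * - (d F * F⁻¹ * F⁻¹))
          ≈⟨ +-congˡ (*-congˡ (+-cong (trans (sym (*-identityʳ _)) (*-congˡ (sym F*F⁻¹)))
               (*-congˡ (-‿cong (*-congʳ (*-congʳ d-F)))))) ⟩
        0# * (S * F⁻¹) + ι * (a * C * F⁻¹ * (F * F⁻¹) + S * - ((- (a * S) - q * (a * C)) * F⁻¹ * F⁻¹))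
          ≈⟨ solve 6 (λ i S G a C q → con (+ 0) :* (S :* G) :+ i :* (a :* C :* G :* ((C :- q :* S) :* G)
                :+ S :* (:- ((:- (a :* S) :- q :* (a :* C)) :* G :* G))) := (a :* i) :* (C :* C :+ S :* S) :* (G :* G))
                     refl ι S F⁻¹ a C q ⟩
        a * ι * (C * C + S * S) * (F⁻¹ * F⁻¹)   ≈⟨ *-congʳ (*-cong ι-inv C²+S²) ⟩
        1# * 1# * (F⁻¹ * F⁻¹)                   ≈⟨ trans (*-congʳ (*-identityʳ 1#)) (*-identityˡ _) ⟩
        F⁻¹ * F⁻¹                               ∎

      -- Substituting C = F + qS into C² + S² = 1 gives 1 = F² + 2qSF + (1 + q²)S²; dividing by F²
      -- makes this a quadratic in S/F, hence in `g`.
      F⁻²≈ : F⁻¹ * F⁻¹ ≈ 1# + 2# * ν * (1# + x) * g + 2# * ν * ν * (1# + x * x) * (g * g)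
      F⁻²≈ = begin
        F⁻¹ * F⁻¹ ≈⟨ trans (*-congʳ C²+S²) (*-identityˡ _) ⟨
        (C * C + S * S) * (F⁻¹ * F⁻¹)
          ≈⟨ solve 4 (λ C S q G → (C :* C :+ S :* S) :* (G :* G) :=
               (C :- q :* S) :* G :* ((C :- q :* S) :* G) :+ :2 :* q :* (S :* G) :* ((C :- q :* S) :* G) :+
                    (:1 :+ q :* q) :* (S :* G) :* (S :* G))
             refl C S q F⁻¹ ⟩
        F * F⁻¹ * (F * F⁻¹) + 2# * q * (S * F⁻¹) * (F * F⁻¹) + (1# + q * q) * (S * F⁻¹) * (S * F⁻¹)
          ≈⟨ +-cong (+-cong (*-cong F*F⁻¹ F*F⁻¹) (*-cong (*-congʳ (*-congˡ (sym ν[1+x]ι))) F*F⁻¹))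
               (*-congʳ (*-congʳ (sym 2ν²[1+x²]ι²))) ⟩
        1# * 1# + 2# * (ν * (1# + x) * ι) * (S * F⁻¹) * 1# + 2# * ν * ν * (1# + x * x) * ι * ι * (S * F⁻¹) * (S * F⁻¹)
          ≈⟨ solve 4 (λ n x i s → :1 :* :1 :+ :2 :* (n :* (:1 :+ x) :* i) :* s :* :1 :+ :2 :* n :* n :*
               (:1 :+ x :* x) :* i :* i :* s :* s :=
               :1 :+ :2 :* n :* (:1 :+ x) :* (i :* s) :+ :2 :* n :* n :* (:1 :+ x :* x) :* ((i :* s) :* (i :* s)))
                    refl ν x ι (S * F⁻¹) ⟩
        1# + 2# * ν * (1# + x) * g + 2# * ν * ν * (1# + x * x) * (g * g) ∎

      -- F′ = -aqF - a(1 + q²)S, so the logarithmic derivative of F is affine in `g`.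
      dF*F⁻¹ : d F * F⁻¹ ≈ - (ν * (1# + x)) - 2# * ν * ν * (1# + x * x) * g
      dF*F⁻¹ = begin
        d F * F⁻¹ ≈⟨ *-congʳ d-F ⟩
        (- (a * S) - q * (a * C)) * F⁻¹
          ≈⟨ solve 5 (λ a S q C G → (:- (a :* S) :- q :* (a :* C)) :* G :=
               :- (a :* q :* ((C :- q :* S) :* G)) :- a :* ((:1 :+ q :* q) :* (S :* G))) refl a S q C F⁻¹ ⟩
        - (a * q * (F * F⁻¹)) - a * ((1# + q * q) * (S * F⁻¹))
          ≈⟨ +-cong (-‿cong (*-congˡ F*F⁻¹)) (-‿cong (*-congˡ (*-congʳ (sym 2ν²[1+x²]ι²)))) ⟩
        - (a * q * 1#) - a * (2# * ν * ν * (1# + x * x) * ι * ι * (S * F⁻¹))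
          ≈⟨ solve 5 (λ n x q i s → :- (n :* (:1 :- x) :* q :* :1) :- n :* (:1 :- x) :*
               (:2 :* n :* n :* (:1 :+ x :* x) :* i :* i :* s) :=
               :- (n :* (q :* (:1 :- x))) :- (n :* (:1 :- x) :* i) :* (:2 :* n :* n :* (:1 :+ x :* x) :* (i :* s)))
                    refl ν x q ι (S * F⁻¹) ⟩
        - (ν * (q * (1# - x))) - a * ι * (2# * ν * ν * (1# + x * x) * g)
          ≈⟨ +-cong (-‿cong (*-congˡ q-def)) (-‿cong (trans (*-congʳ ι-inv) (*-identityˡ _))) ⟩
        - (ν * (1# + x)) - 2# * ν * ν * (1# + x * x) * g ∎

    riccati : d g ≈ 1# + 2# * ν * (1# + x) * g + 2# * ν * ν * (1# + x * x) * (g * g)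
    riccati = trans d-g≈F⁻² F⁻²≈

    d-Φ : d Φ ≈ (β * (1# + x) + 2# * ν * β * (1# + x * x) * g) * Φ
    d-Φ = begin
      d Φ                     ≈⟨ trans (*-congʳ F*F⁻¹) (*-identityˡ _) ⟨
      F * F⁻¹ * d Φ           ≈⟨ solve 3 (λ F G p → F :* G :* p := G :* (F :* p)) refl F F⁻¹ (d Φ) ⟩
      F⁻¹ * (F * d Φ)         ≈⟨ *-congˡ F*dΦ ⟩
      F⁻¹ * (α * (d F * Φ))   ≈⟨ solve 4 (λ G a e p → G :* (a :* (e :* p)) := a :* (e :* G) :* p) refl F⁻¹ α (d F) Φ ⟩
      α * (d F * F⁻¹) * Φ     ≈⟨ *-congʳ (*-congˡ dF*F⁻¹) ⟩
      α * (- (ν * (1# + x)) - 2# * ν * ν * (1# + x * x) * g) * Φ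
        ≈⟨ solve 5 (λ a n x g p → a :* (:- (n :* (:1 :+ x)) :- :2 :* n :* n :* (:1 :+ x :* x) :* g) :* p :=
             ((:- (a :* n)) :* (:1 :+ x) :+ :2 :* n :* (:- (a :* n)) :* (:1 :+ x :* x) :* g) :* p) refl α ν x g Φ ⟩
      (- (α * ν) * (1# + x) + 2# * ν * - (α * ν) * (1# + x * x) * g) * Φ
        ≈⟨ *-congʳ (+-cong (*-congʳ -αν) (*-congʳ (*-congʳ (*-congˡ -αν)))) ⟩
      (β * (1# + x) + 2# * ν * β * (1# + x * x) * g) * Φ ∎
      where
      -αν : - (α * ν) ≈ β
      -αν = trans (-‿cong α-def) (solve 1 (λ b → :- (:- b) := b) refl β)

    module Columns (κ : ℕ → Carrier) (κ-0 : κ 0 ≈ 0#) (d-κ : ∀ k → d (κ k) ≈ 0#) (d-β : d β ≈ 0#) (d-ν : d ν ≈ 0#)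
         (G : ℕ → Carrier) (G-0 : d (G 0) ≈ 0#) (G-suc : ∀ k → G (suc k) ≈ g * G k)
      (d-G : ∀ k → d (G (suc k)) ≈ κ (suc k) * (G k * d g)) where

      π : ℕ → Carrier
      π zero    = 1#
      π (suc k) = π k * (β + ν * κ k)

      -- This is ∂ᵏΦ/∂hᵏ. As F = C - (h/a)S with a = 1 - x here, one has ∂Φ/∂h = βgΦ and ∂g/∂h =
      -- νg², so each further derivative contributes a factor (β + νj) g.
      Θ : ℕ → Carrier
      Θ k = π k * (Φ * G k)

      d-π : ∀ k → d (π k) ≈ 0#
      d-π zero    = d-1
      d-π (suc k) = begin
        d (π k * (β + ν * κ k))
          ≈⟨ trans (d-* _ _) (+-cong (*-congʳ (d-π k))
               (*-congˡ (trans (d-+ _ _) (+-cong d-β (trans (d-* _ _) (+-cong (*-congʳ d-ν) (*-congˡ (d-κ k)))))))) ⟩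
        0# * (β + ν * κ k) + π k * (0# + (0# * κ k + ν * 0#))
          ≈⟨ solve 4 (λ b n k p → con (+ 0) :* (b :+ n :* k) :+ p :*
               (con (+ 0) :+ (con (+ 0) :* k :+ n :* con (+ 0))) := con (+ 0)) refl β ν (κ k) (π k) ⟩
        0# ∎

      -- Differentiating gᵏ gives k gᵏ⁻¹ g′, and the three terms of the Riccati equation for g′ land
      -- in columns k - 1, k and k + 1. The derivative of Φ adds the β-parts in columns k and k + 1.
      d-Θ : ∀ k → d (Θ k) ≈ (2# * ν * κ k + β) * (1# + x) * Θ k + 2# * ν * (1# + x * x) * Θ (suc k)
        + κ k * (β + ν * κ (pred k)) * Θ (pred k)
      d-Θ k = begin
        d (π k * (Φ * G k))
          ≈⟨ trans (d-* _ _) (+-cong (trans (*-congʳ (d-π k)) (zeroˡ _))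
               (*-congˡ (trans (d-* _ _) (+-congʳ (*-congʳ d-Φ))))) ⟩
        0# + π k * ((β * (1# + x) + 2# * ν * β * (1# + x * x) * g) * Φ * G k + Φ * d (G k))
          ≈⟨ solve 8 (λ p b x n g f G dG → con (+ 0) :+ p :*
               ((b :* (:1 :+ x) :+ :2 :* n :* b :* (:1 :+ x :* x) :* g) :* f :* G :+ f :* dG) :=
               p :* ((b :* (:1 :+ x)) :* f :* G :+ (:2 :* n :* b :* (:1 :+ x :* x)) :* f :* (g :* G)) :+ p :* (f :* dG))
                    refl (π k) β x ν g Φ (G k) (d (G k)) ⟩
        π k * (β * (1# + x) * Φ * G k + 2# * ν * β * (1# + x * x) * Φ * (g * G k)) + π k * (Φ * d (G k))
          ≈⟨ +-congˡ (G-term k) ⟩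
        π k * (β * (1# + x) * Φ * G k + 2# * ν * β * (1# + x * x) * Φ * (g * G k))
          + (κ k * (β + ν * κ (pred k)) * Θ (pred k) + κ k * π k * Φ *
               (2# * ν * (1# + x) * G k + 2# * ν * ν * (1# + x * x) * (g * G k)))
          ≈⟨ solve 9 (λ p b x n f G gG k z →
               p :* (b :* (:1 :+ x) :* f :* G :+ :2 :* n :* b :* (:1 :+ x :* x) :* f :* gG)
                 :+ (z :+ k :* p :* f :* (:2 :* n :* (:1 :+ x) :* G :+ :2 :* n :* n :* (:1 :+ x :* x) :* gG)) :=
               (:2 :* n :* k :+ b) :* (:1 :+ x) :* (p :* (f :* G)) :+ :2 :* n :* (:1 :+ x :* x) :*
                    (p :* (b :+ n :* k) :* (f :* gG)) :+ z)
             refl (π k) β x ν Φ (G k) (g * G k) (κ k) (κ k * (β + ν * κ (pred k)) * Θ (pred k)) ⟩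
        (2# * ν * κ k + β) * (1# + x) * Θ k + 2# * ν * (1# + x * x) * (π (suc k) * (Φ * (g * G k)))
          + κ k * (β + ν * κ (pred k)) * Θ (pred k)
          ≈⟨ +-congʳ (+-congˡ (*-congˡ (*-congˡ (*-congˡ (G-suc k))))) ⟨
        (2# * ν * κ k + β) * (1# + x) * Θ k + 2# * ν * (1# + x * x) * Θ (suc k) + κ k * (β + ν * κ (pred k)) * Θ
             (pred k) ∎
        where
        G-term : ∀ k → π k * (Φ * d (G k)) ≈ κ k * (β + ν * κ (pred k)) * Θ (pred k)
          + κ k * π k * Φ * (2# * ν * (1# + x) * G k + 2# * ν * ν * (1# + x * x) * (g * G k))
        G-term zero = begin
          π 0 * (Φ * d (G 0)) ≈⟨ *-congˡ (*-congˡ G-0) ⟩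
          1# * (Φ * 0#)
            ≈⟨ solve 4 (λ f a b c → :1 :* (f :* con (+ 0)) := con (+ 0) :* a :* b :+ con (+ 0) :* :1 :* f :* c)
               refl Φ (β + ν * κ 0) (Θ 0) (2# * ν * (1# + x) * G 0 + 2# * ν * ν * (1# + x * x) * (g * G 0)) ⟩
          0# * (β + ν * κ 0) * Θ 0 + 0# * 1# * Φ * (2# * ν * (1# + x) * G 0 + 2# * ν * ν * (1# + x * x) * (g * G 0))
            ≈⟨ +-cong (*-congʳ (*-congʳ κ-0)) (*-congʳ (*-congʳ (*-congʳ κ-0))) ⟨
          κ 0 * (β + ν * κ 0) * Θ 0 + κ 0 * π 0 * Φ *
               (2# * ν * (1# + x) * G 0 + 2# * ν * ν * (1# + x * x) * (g * G 0)) ∎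
        G-term (suc k) = begin
          π (suc k) * (Φ * d (G (suc k)))  ≈⟨ *-congˡ (*-congˡ (trans (d-G k) (*-congˡ (*-congˡ riccati)))) ⟩
          π k * (β + ν * κ k) *
               (Φ * (κ (suc k) * (G k * (1# + 2# * ν * (1# + x) * g + 2# * ν * ν * (1# + x * x) * (g * g)))))
            ≈⟨ solve 9 (λ p b n k f k′ G x g →
                 p :* (b :+ n :* k) :*
                      (f :* (k′ :* (G :* (:1 :+ :2 :* n :* (:1 :+ x) :* g :+ :2 :* n :* n :* (:1 :+ x :* x) :*
                           (g :* g))))) :=
                 k′ :* (b :+ n :* k) :* (p :* (f :* G))
                   :+ k′ :* (p :* (b :+ n :* k)) :* f :*
                        (:2 :* n :* (:1 :+ x) :* (g :* G) :+ :2 :* n :* n :* (:1 :+ x :* x) :* (g :* (g :* G))))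
               refl (π k) β ν (κ k) Φ (κ (suc k)) (G k) x g ⟩
          κ (suc k) * (β + ν * κ k) * Θ k
            + κ (suc k) * π (suc k) * Φ * (2# * ν * (1# + x) * (g * G k) + 2# * ν * ν * (1# + x * x) * (g * (g * G k)))
            ≈⟨ +-congˡ (*-congˡ (+-cong (*-congˡ (G-suc k)) (*-congˡ (*-congˡ (G-suc k))))) ⟨
          κ (suc k) * (β + ν * κ k) * Θ k
            + κ (suc k) * π (suc k) * Φ *
                 (2# * ν * (1# + x) * G (suc k) + 2# * ν * ν * (1# + x * x) * (g * G (suc k))) ∎
 

-- Exponential generating functions, cosine and sine, real powers

module ExponentialSeries {c ℓ₁ ℓ₂ ℓ₃} (ℝ : RealNumbers c ℓ₁ ℓ₂ ℓ₃) where
  open RealNumbers ℝ hiding (refl; sym; trans)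
  open Notions ℝ
  open Polynomials ℝ
  open CommutativeRing realRing using (refl; sym; trans)
  open SemiringMult (CommutativeRing.semiring realRing) using (×1-homo-*)
  private module Pow = RawSemiringOps (RawRing.rawSemiring rawRing)
  open S hiding (Series; nat)
  open SD
  open IntegerSolver realRing
  open SetoidReasoning setoid

  /-inverse : ∀ x {y} (y#0 : y # 0#) → x / y ⟨ y#0 ⟩ * y ≈ x
  /-inverse x {y} y#0 with #⇒invertible y#0
  ... | z , zy≈1 , _ = begin
    x * z * y          ≈⟨ solve 3 (λ x z y → x :* z :* y := x :* (z :* (y :- con (+ 0)))) refl x z y ⟩
    x * (z * (y - 0#)) ≈⟨ *-congˡ zy≈1 ⟩
    x * 1#             ≈⟨ *-identityʳ x ⟩
    x                  ∎

  #0-cancelʳ : ∀ {x y z} → z # 0# → x * z ≈ y * z → x ≈ y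
  #0-cancelʳ {x} {y} {z} z#0 xz≈yz = begin
    x                                   ≈⟨ solve 1 (λ x → x := con (+ 1) :* x) refl x ⟩
    1# * x                              ≈⟨ *-congʳ (/-inverse 1# z#0) ⟨
    1# / z ⟨ z#0 ⟩ * z * x              ≈⟨ solve 3 (λ i z x → i :* z :* x := i :* (x :* z)) refl (1# / z ⟨ z#0 ⟩) z x ⟩
    1# / z ⟨ z#0 ⟩ * (x * z)            ≈⟨ *-congˡ xz≈yz ⟩
    1# / z ⟨ z#0 ⟩ * (y * z)            ≈⟨ solve 3 (λ i z x → i :* z :* x := i :* (x :* z)) refl (1# / z ⟨ z#0 ⟩) z y ⟨
    1# / z ⟨ z#0 ⟩ * z * y              ≈⟨ *-congʳ (/-inverse 1# z#0) ⟩
    1# * y                              ≈⟨ *-identityˡ y ⟩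
    y                                   ∎

  nat#0 : ∀ n → .{{ℕ.NonZero n}} → nat n # 0#
  nat#0 (suc n) = pos⇒#0 (nat-pos n)

  /ℕ-inverse : ∀ x n → .{{_ : ℕ.NonZero n}} → (x /ℕ n) * nat n ≈ x
  /ℕ-inverse x (suc n) = /-inverse x (pos⇒#0 (nat-pos n))

  nat!#0 : ∀ n → nat (n !) # 0#
  nat!#0 n = nat#0 (n !) {{n ℕ.!≢0}}

  -- Identities between exponential generating functions are proved by multiplying both sides by n!,
  -- simplifying with this, and cancelling.
  egf-inverse : ∀ a n → egf a n * nat (n !) ≈ a n
  egf-inverse a n = /ℕ-inverse (a n) (n !) {{n ℕ.!≢0}}

  egf-0 : ∀ a → egf a 0 ≈ a 0
  egf-0 a = trans (solve 1 (λ x → x := x :* (con (+ 1) :+ con (+ 0))) refl (egf a 0)) (egf-inverse a 0)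

  nat-! : ∀ n → nat (suc n !) ≈ nat (suc n) * nat (n !)
  nat-! n = ×1-homo-* (suc n) (n !)

  /ℕ-suc! : ∀ {x} e n → e * nat (suc n !) ≈ x → nat (suc n) * e * nat (n !) ≈ x
  /ℕ-suc! {x} e n e≈ = begin
    nat (suc n) * e * nat (n !)
      ≈⟨ solve 3 (λ k e m → k :* e :* m := e :* (k :* m)) refl (nat (suc n)) e (nat (n !)) ⟩
    e * (nat (suc n) * nat (n !))   ≈⟨ *-congˡ (nat-! n) ⟨
    e * nat (suc n !)               ≈⟨ e≈ ⟩
    x                               ∎

  D-egf : ∀ a → D (egf a) ≈ₛ egf (λ n → a (suc n))
  D-egf a n = #0-cancelʳ (nat!#0 n) (trans (/ℕ-suc! (egf a (suc n)) n (egf-inverse a (suc n)))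
    (sym (egf-inverse (λ n → a (suc n)) n)))

  egf-cong : ∀ {a b : ℕ → Carrier} → (∀ n → a n ≈ b n) → egf a ≈ₛ egf b
  egf-cong {a} {b} a≈b n = #0-cancelʳ (nat!#0 n) (trans (egf-inverse a n) (trans (a≈b n) (sym (egf-inverse b n))))

  egf-• : ∀ a b → egf (λ n → a * b n) ≈ₛ a •ₛ egf b
  egf-• a b n = #0-cancelʳ (nat!#0 n) (trans (egf-inverse (λ n → a * b n) n)
    (sym (trans (*-assoc a (egf b n) _) (*-congˡ (egf-inverse b n)))))

  cos-suc : ∀ n → cos⁽ suc n ⁾ ≈ - sin⁽ n ⁾
  cos-suc zero          = solve 0 (con (+ 0) := :- con (+ 0)) refl
  cos-suc (suc zero)    = refl
  cos-suc (suc (suc n)) = -‿cong (cos-suc n)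

  sin-suc : ∀ n → sin⁽ suc n ⁾ ≈ cos⁽ n ⁾
  sin-suc zero          = refl
  sin-suc (suc zero)    = solve 0 (:- con (+ 0) := con (+ 0)) refl
  sin-suc (suc (suc n)) = -‿cong (sin-suc n)

  D-cos : ∀ a → D cos[ a t] ≈ₛ ⊝ (a ·t^ 0 *ₛ sin[ a t])
  D-cos a = ₛ.trans (D-egf (λ n → cos⁽ n ⁾ * (a Pow.^ n))) (ₛ.trans
    (egf-cong (λ n → trans (*-congʳ (cos-suc n)) (solve 3 (λ s a p → (:- s) :* (a :* p) := (:- a) :* (s :* p))
         refl sin⁽ n ⁾ a (a Pow.^ n))))
    (ₛ.trans (egf-• (- a) (λ n → sin⁽ n ⁾ * (a Pow.^ n)))
      λ n → trans (solve 2 (λ a s → (:- a) :* s := :- (a :* s))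
           refl a (sin[ a t] n)) (-‿cong (sym (·t^0-* a sin[ a t] n)))))

  D-sin : ∀ a → D sin[ a t] ≈ₛ a ·t^ 0 *ₛ cos[ a t]
  D-sin a = ₛ.trans (D-egf (λ n → sin⁽ n ⁾ * (a Pow.^ n))) (ₛ.trans
    (egf-cong (λ n → trans (*-congʳ (sin-suc n)) (solve 3 (λ s a p → s :* (a :* p) := a :* (s :* p))
         refl cos⁽ n ⁾ a (a Pow.^ n))))
    (ₛ.trans (egf-• a (λ n → cos⁽ n ⁾ * (a Pow.^ n))) (ₛ.sym (·t^0-*ₛ a cos[ a t]))))

  -- This is where characteristic zero enters: n + 1 is apart from 0 and can be cancelled.
  D≈0⇒const : ∀ f → D f ≈ₛ 0ₛ → f ≈ₛ f 0 ·t^ 0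
  D≈0⇒const f Df≈0 zero    = refl
  D≈0⇒const f Df≈0 (suc n) = #0-cancelʳ (pos⇒#0 (nat-pos n))
    (trans (*-comm _ _) (trans (Df≈0 n) (sym (zeroˡ _))))

  cos-0 : ∀ a → cos[ a t] 0 ≈ 1#
  cos-0 a = trans (egf-0 (λ n → cos⁽ n ⁾ * (a Pow.^ n))) (*-identityʳ 1#)

  sin-0 : ∀ a → sin[ a t] 0 ≈ 0#
  sin-0 a = trans (egf-0 (λ n → sin⁽ n ⁾ * (a Pow.^ n))) (*-identityʳ 0#)

  private module 𝕊 = IntegerSolver seriesRing

  -- The derivative is zero and the constant term is 1.
  cos²+sin² : ∀ a → cos[ a t] *ₛ cos[ a t] +ₛ sin[ a t] *ₛ sin[ a t] ≈ₛ 1ₛ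
  cos²+sin² a = ₛ.trans (D≈0⇒const P DP≈0) P₀≈1
    where
    C = cos[ a t]
    N = sin[ a t]
    P = C *ₛ C +ₛ N *ₛ N
    P₀≈1 : P 0 ·t^ 0 ≈ₛ 1ₛ
    P₀≈1 zero    = trans (+-cong (+-congʳ (*-cong (cos-0 a) (cos-0 a))) (+-congʳ (*-cong (sin-0 a) (sin-0 a))))
      (solve 0 ((con (+ 1) :* con (+ 1) :+ con (+ 0)) :+ (con (+ 0) :* con (+ 0) :+ con (+ 0)) := con (+ 1)) refl)
    P₀≈1 (suc n) = refl
    DP≈0 : D P ≈ₛ 0ₛ
    DP≈0 = ₛ.trans (D-+ₛ (C *ₛ C) (N *ₛ N)) (ₛ.trans
      (ₛ.+-cong
        (ₛ.trans (D-*ₛ C C) (ₛ.+-cong (ₛ.*-congʳ {C} (D-cos a)) (ₛ.*-congˡ {C} (D-cos a))))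
        (ₛ.trans (D-*ₛ N N) (ₛ.+-cong (ₛ.*-congʳ {N} (D-sin a)) (ₛ.*-congˡ {N} (D-sin a)))))
      (𝕊.solve 3 (λ a C N → (𝕊.:- (a 𝕊.:* N) 𝕊.:* C 𝕊.:+ C 𝕊.:* (𝕊.:- (a 𝕊.:* N)))
          𝕊.:+ (a 𝕊.:* C 𝕊.:* N 𝕊.:+ N 𝕊.:* (a 𝕊.:* C)) 𝕊.:= 𝕊.con (+ 0)) ₛ.refl (a ·t^ 0) C N))

  binomial-suc : ∀ α k → nat (suc k) * binomial α (suc k) ≈ (α - nat k) * binomial α k
  binomial-suc α k = #0-cancelʳ (nat!#0 k) (begin
    nat (suc k) * binomial α (suc k) * nat (k !)
      ≈⟨ /ℕ-suc! (binomial α (suc k)) k (/ℕ-inverse (fallingFactorial α (suc k)) (suc k !) {{suc k ℕ.!≢0}}) ⟩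
    fallingFactorial α k * (α - nat k)
      ≈⟨ *-comm _ _ ⟩
    (α - nat k) * fallingFactorial α k
      ≈⟨ *-congˡ (/ℕ-inverse (fallingFactorial α k) (k !) {{k ℕ.!≢0}}) ⟨
    (α - nat k) * (binomial α k * nat (k !))
      ≈⟨ *-assoc _ _ _ ⟨
    (α - nat k) * binomial α k * nat (k !) ∎)

  ^ᵣ-0 : ∀ f α → (f ^ᵣ α) 0 ≈ 1#
  ^ᵣ-0 f α = begin
    binomial α 0 * 1# + 0#
      ≈⟨ solve 1 (λ b → b :* con (+ 1) :+ con (+ 0) := b :* (con (+ 1) :+ con (+ 0))) refl (binomial α 0) ⟩
    binomial α 0 * nat 1     ≈⟨ /ℕ-inverse 1# 1 ⟩
    1#                       ∎

  -- Together with the constant term `^ᵣ-0`, this linear equation is the form in which a real power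
  -- enters the proof of (i).
  ^ᵣ-ODE : ∀ f α → f 0 ≈ 1# → f *ₛ D (f ^ᵣ α) ≈ₛ α ·t^ 0 *ₛ (D f *ₛ f ^ᵣ α)
  ^ᵣ-ODE f α f₀≈1 = ₛ.trans (ₛ.*-congʳ {D (f ^ᵣ α)} f≈1+v) (ₛ.trans
    (power-ODE {v} v₀≈0 α (binomial α) (binomial-suc α))
    (ₛ.*-congˡ {α ·t^ 0} (ₛ.*-congʳ {f ^ᵣ α} Dv≈Df)))
    where
    v = f -ₛ 1ₛ
    v₀≈0 : v 0 ≈ 0#
    v₀≈0 = trans (+-congʳ f₀≈1) (-‿inverseʳ 1#)
    f≈1+v : f ≈ₛ 1ₛ +ₛ v
    f≈1+v = 𝕊.solve 1 (λ f → f 𝕊.:= 𝕊.con (+ 1) 𝕊.:+ (f 𝕊.:- 𝕊.con (+ 1))) ₛ.refl f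
    Dv≈Df : D v ≈ₛ D f
    Dv≈Df n = *-congˡ (solve 1 (λ x → x :- con (+ 0) := x) refl (f (suc n)))
 

-- Identification of the exponential generating function at a point x

module ExponentialGeneratingFunction {c ℓ₁ ℓ₂ ℓ₃} (ℝ : RealNumbers c ℓ₁ ℓ₂ ℓ₃)
  (β ν : RealNumbers.Carrier ℝ) (ν>0 : RealNumbers._<_ ℝ (RealNumbers.0# ℝ) ν)
  (x : RealNumbers.Carrier ℝ) (x≠1 : RealNumbers._#_ ℝ x (RealNumbers.1# ℝ)) where
  open RealNumbers ℝ hiding (refl; sym; trans)
  open Notions ℝ
  open Polynomials ℝ
  open ExponentialSeries ℝ
  open PolynomialArray ℝ β ν using (A; A-suc; r; u; w)
  open CommutativeRing realRing using (refl; sym; trans)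
  open S hiding (Series; nat)
  open SD
  open IntegerSolver realRing
  private module 𝕊 = IntegerSolver seriesRing
  open SetoidReasoning setoid

  private
    y#0 : 1# - x # 0#
    y#0 = #1⇒1-x#0 x≠1
    a q ι α : Carrier
    a = ν * (1# - x)
    q = (1# + x) / (1# - x) ⟨ y#0 ⟩
    ι = 1# / ν ⟨ pos⇒#0 ν>0 ⟩ * (1# / (1# - x) ⟨ y#0 ⟩)
    α = - (β / ν ⟨ pos⇒#0 ν>0 ⟩)

    a*ι≈1 : a * ι ≈ 1#
    a*ι≈1 = begin
      ν * (1# - x) * (1# / ν ⟨ pos⇒#0 ν>0 ⟩ * (1# / (1# - x) ⟨ y#0 ⟩))
        ≈⟨ solve 4 (λ n y m z → n :* y :* (m :* z) := (m :* n) :* (z :* y))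
             refl ν (1# - x) (1# / ν ⟨ pos⇒#0 ν>0 ⟩) (1# / (1# - x) ⟨ y#0 ⟩) ⟩
      1# / ν ⟨ pos⇒#0 ν>0 ⟩ * ν * (1# / (1# - x) ⟨ y#0 ⟩ * (1# - x))
        ≈⟨ *-cong (/-inverse 1# (pos⇒#0 ν>0)) (/-inverse 1# y#0) ⟩
      1# * 1#  ≈⟨ *-identityʳ 1# ⟩
      1#       ∎

    α*ν≈-β : α * ν ≈ - β
    α*ν≈-β = trans (solve 2 (λ b n → (:- b) :* n := :- (b :* n)) refl (β / ν ⟨ pos⇒#0 ν>0 ⟩) ν)
      (-‿cong (/-inverse β (pos⇒#0 ν>0)))

    K : Carrier → S.Series
    K b = b ·t^ 0

    K-cong : ∀ {b c} → b ≈ c → K b ≈ₛ K c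
    K-cong b≈c zero    = b≈c
    K-cong b≈c (suc n) = refl

    K-+ : ∀ b c → K b +ₛ K c ≈ₛ K (b + c)
    K-+ b c zero    = refl
    K-+ b c (suc n) = +-identityʳ 0#

    K-neg : ∀ b → ⊝ K b ≈ₛ K (- b)
    K-neg b zero    = refl
    K-neg b (suc n) = solve 0 (:- con (+ 0) := con (+ 0)) refl

    K-* : ∀ b c → K b *ₛ K c ≈ₛ K (b * c)
    K-* b c = ₛ.trans (·t^0-*ₛ b (K c)) λ { zero → refl ; (suc n) → zeroʳ b }

    infixl 6 _⊕_
    infixl 7 _⊗_
    -- With `_⊗_` this recovers the scalar behind a compound constant series: the proof term copies
    -- the shape of the ring expression.
    _⊕_ : ∀ {f g b c} → f ≈ₛ K b → g ≈ₛ K c → f +ₛ g ≈ₛ K (b + c)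
    _⊕_ {f} {g} {b} {c} p q = ₛ.trans (ₛ.+-cong {f} {K b} {g} {K c} p q) (K-+ b c)
    _⊗_ : ∀ {f g b c} → f ≈ₛ K b → g ≈ₛ K c → f *ₛ g ≈ₛ K (b * c)
    _⊗_ {f} {g} {b} {c} p q = ₛ.trans (ₛ.*-cong {f} {K b} {g} {K c} p q) (K-* b c)
    κ : ∀ b → K b ≈ₛ K b
    κ b = ₛ.refl {K b}

    1-Kx : 1ₛ -ₛ K x ≈ₛ K (1# - x)
    1-Kx = ₛ.trans (ₛ.+-congˡ {1ₛ} (K-neg x)) (K-+ 1# (- x))

    C N F₁ F F⁻¹ Φ : S.Series
    C = cos[ a t]
    N = sin[ a t]
    F = C -ₛ q •ₛ N
    F₁ = C -ₛ K q *ₛ N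
    F⁻¹ = 1/1- (1ₛ -ₛ F)
    Φ = F ^ᵣ α

    -- `F` is spelled as in the claim, `F₁` as an expression in the operations of the series ring,
    -- which is the form that `Solution` expects.
    F₁≈F : F₁ ≈ₛ F
    F₁≈F n = +-congˡ (-‿cong (·t^0-* q N n))

    F-0 : F 0 ≈ 1#
    F-0 = trans (+-cong (cos-0 a) (-‿cong (*-congˡ (sin-0 a))))
      (solve 1 (λ q → con (+ 1) :- q :* con (+ 0) := con (+ 1)) refl q)

    F*F⁻¹ : F₁ *ₛ F⁻¹ ≈ₛ 1ₛ
    F*F⁻¹ = ₛ.trans (ₛ.*-congʳ {F⁻¹} F₁≈F) (ₛ.trans
      (𝕊.solve 2 (λ F G → F 𝕊.:* G 𝕊.:= G 𝕊.:- (𝕊.con (+ 1) 𝕊.:- F) 𝕊.:* G) ₛ.refl F F⁻¹)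
      (ₛ.trans (ₛ.+-congʳ {⊝ ((1ₛ -ₛ F) *ₛ F⁻¹)} (1/1-≈ {1ₛ -ₛ F} (trans (+-congˡ (-‿cong F-0)) (-‿inverseʳ 1#))))
        (𝕊.solve 1 (λ z → 𝕊.con (+ 1) 𝕊.:+ z 𝕊.:- z 𝕊.:= 𝕊.con (+ 1)) ₛ.refl ((1ₛ -ₛ F) *ₛ F⁻¹))))

    K-a : K a ≈ₛ K ν *ₛ (1ₛ -ₛ K x)
    K-a = ₛ.sym (κ ν ⊗ 1-Kx)

  private
    K-0 : K 0# ≈ₛ 0ₛ
    K-0 zero    = refl
    K-0 (suc n) = refl

    Kν*[1-Kx]*Kι : K ν *ₛ (1ₛ -ₛ K x) *ₛ K ι ≈ₛ 1ₛ
    Kν*[1-Kx]*Kι = ₛ.trans (κ ν ⊗ 1-Kx ⊗ κ ι) (K-cong a*ι≈1)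

    Kq*[1-Kx] : K q *ₛ (1ₛ -ₛ K x) ≈ₛ 1ₛ +ₛ K x
    Kq*[1-Kx] = ₛ.trans (κ q ⊗ 1-Kx) (ₛ.trans (K-cong (/-inverse (1# + x) y#0)) (ₛ.sym (K-+ 1# x)))

    Kα*Kν : K α *ₛ K ν ≈ₛ ⊝ K β
    Kα*Kν = ₛ.trans (K-* α ν) (ₛ.trans (K-cong α*ν≈-β) (ₛ.sym (K-neg β)))

    D-C : D C ≈ₛ ⊝ (K ν *ₛ (1ₛ -ₛ K x) *ₛ N)
    D-C = ₛ.trans (D-cos a) (ₛ.-‿cong (ₛ.*-congʳ {N} K-a))

    D-N : D N ≈ₛ K ν *ₛ (1ₛ -ₛ K x) *ₛ C
    D-N = ₛ.trans (D-sin a) (ₛ.*-congʳ {C} K-a)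

    F₁*DΦ : F₁ *ₛ D Φ ≈ₛ K α *ₛ (D F₁ *ₛ Φ)
    F₁*DΦ = ₛ.trans (ₛ.*-congʳ {D Φ} F₁≈F) (ₛ.trans (^ᵣ-ODE F α F-0)
      (ₛ.*-congˡ {K α} (ₛ.*-congʳ {Φ} (D-cong (ₛ.sym F₁≈F)))))

    D-K-nat : ∀ k → D (K (nat k)) ≈ₛ 0ₛ
    D-K-nat k = D-const (nat k)

    cos²+sin²≈1 : C *ₛ C +ₛ N *ₛ N ≈ₛ 1ₛ
    cos²+sin²≈1 = cos²+sin² a

  open TangentODE.Solution seriesRing D D-cong D-+ₛ D-*ₛ D-⊝ (D-const 1#)
    (K x) (K β) (K ν) (K q) (K ι) (K α) (D-const q) (D-const ι) Kν*[1-Kx]*Kι Kq*[1-Kx] Kα*Kν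
    C N F⁻¹ Φ D-C D-N cos²+sin²≈1 F*F⁻¹ F₁*DΦ
    using (g; module Columns)

  private
    G : ℕ → S.Series
    G = g ^ₛ_

    G-suc : ∀ k → G (suc k) ≈ₛ g *ₛ G k
    G-suc k = ₛ.refl {G (suc k)}

    D-G : ∀ k → D (G (suc k)) ≈ₛ K (nat (suc k)) *ₛ (G k *ₛ D g)
    D-G = D-^ₛ g

  open Columns (λ k → K (nat k)) K-0 D-K-nat (D-const β) (D-const ν) G (D-const 1#) G-suc D-G
    using (π; Θ; d-Θ)

  g-0 : g 0 ≈ 0#
  g-0 = trans (·t^0-* ι (N *ₛ F⁻¹) 0) (trans (*-congˡ (+-congʳ (*-congʳ (sin-0 a))))
    (solve 2 (λ i f → i :* (con (+ 0) :* f :+ con (+ 0)) := con (+ 0)) refl ι (F⁻¹ 0)))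

  eval-r : ∀ k → eval (r k) x ≈ (nat 2 * ν * nat k + β) * (1# + x)
  eval-r k = trans (eval-• _ (1ₚ +ₚ X) x) (*-congˡ
    (solve 1 (λ x → (con (+ 1) :+ con (+ 0)) :+ x :* (con (+ 1) :+ x :* con (+ 0)) := con (+ 1) :+ x) refl x))

  eval-X : eval X x ≈ x
  eval-X = solve 1 (λ x → con (+ 0) :+ x :* (con (+ 1) :+ x :* con (+ 0)) := x) refl x

  eval-const : ∀ b → eval (const b) x ≈ b
  eval-const b = trans (+-congˡ (zeroʳ x)) (+-identityʳ b)

  eval-u : eval u x ≈ nat 2 * ν * (1# + x * x)
  eval-u = trans (eval-• _ (1ₚ +ₚ X ^ₚ 2) x) (*-congˡ (trans (eval-+ 1ₚ (X ^ₚ 2) x)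
    (+-cong (eval-const 1#) (trans (eval-* X (X *ₚ 1ₚ) x) (*-cong eval-X
      (trans (eval-* X 1ₚ x) (trans (*-cong eval-X (eval-const 1#)) (*-identityʳ x))))))))

  eval-A-suc : ∀ n k → eval (A (suc n) k) x ≈
    (nat 2 * ν * nat k + β) * (1# + x) * eval (A n k) x + nat 2 * ν * (1# + x * x) * eval (A n (suc k)) x
      + nat k * (β + ν * nat (pred k)) * eval (A n (pred k)) x
  eval-A-suc n k = trans
    (eval-cong {A (suc n) k} {r k *ₚ A n k +ₚ u *ₚ A n (suc k) +ₚ w k *ₚ A n (pred k)} x (A-suc n k)) (trans
    (eval-+ (r k *ₚ A n k +ₚ u *ₚ A n (suc k)) (w k *ₚ A n (pred k)) x) (+-cong
    (trans (eval-+ (r k *ₚ A n k) (u *ₚ A n (suc k)) x) (+-cong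
      (trans (eval-* (r k) (A n k) x) (*-congʳ (eval-r k)))
      (trans (eval-* u (A n (suc k)) x) (*-congʳ eval-u))))
    (trans (eval-* (w k) (A n (pred k)) x) (*-congʳ (eval-const _)))))

  IsColumnSeries : (ℕ → S.Series) → Set ℓ₁
  IsColumnSeries Θ = ∀ k n → nat (suc n) * Θ k (suc n) ≈
    (nat 2 * ν * nat k + β) * (1# + x) * Θ k n + nat 2 * ν * (1# + x * x) * Θ (suc k) n
      + nat k * (β + ν * nat (pred k)) * Θ (pred k) n

  -- Differentiation shifts the index of an exponential generating function, so after multiplication
  -- by n! the differential system of the columns is the recurrence of the array; the constant terms
  -- are row 0.
  column-series-unique : ∀ Θ → IsColumnSeries Θ → Θ 0 0 ≈ 1# → (∀ k → Θ (suc k) 0 ≈ 0#) →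
    ∀ n k → Θ k n * nat (n !) ≈ eval (A n k) x
  column-series-unique Θ rec Θ₀₀≈1 Θ₀≈0 = go
    where
    go : ∀ n k → Θ k n * nat (n !) ≈ eval (A n k) x
    go zero    zero    = trans (*-cong Θ₀₀≈1 (+-identityʳ 1#)) (trans (*-identityʳ 1#) (sym (eval-const 1#)))
    go zero    (suc k) = trans (*-congʳ (Θ₀≈0 k)) (zeroˡ _)
    go (suc n) k = begin
      Θ k (suc n) * nat (suc n !)              ≈⟨ *-congˡ (nat-! n) ⟩
      Θ k (suc n) * (nat (suc n) * nat (n !))
        ≈⟨ solve 3 (λ z m f → z :* (m :* f) := m :* z :* f) refl (Θ k (suc n)) (nat (suc n)) (nat (n !)) ⟩
      nat (suc n) * Θ k (suc n) * nat (n !)    ≈⟨ *-congʳ (rec k n) ⟩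
      (ρ₁ * Θ k n + u₁ * Θ (suc k) n + w₁ * Θ (pred k) n) * nat (n !)
        ≈⟨ solve 7 (λ a b c x y z m → (a :* x :+ b :* y :+ c :* z) :* m :=
             a :* (x :* m) :+ b :* (y :* m) :+ c :* (z :* m))
             refl ρ₁ u₁ w₁ (Θ k n) (Θ (suc k) n) (Θ (pred k) n) (nat (n !)) ⟩
      ρ₁ * (Θ k n * nat (n !)) + u₁ * (Θ (suc k) n * nat (n !)) + w₁ * (Θ (pred k) n * nat (n !))
        ≈⟨ +-cong (+-cong (*-congˡ (go n k)) (*-congˡ (go n (suc k)))) (*-congˡ (go n (pred k))) ⟩
      ρ₁ * eval (A n k) x + u₁ * eval (A n (suc k)) x + w₁ * eval (A n (pred k)) x ≈⟨ eval-A-suc n k ⟨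
      eval (A (suc n) k) x ∎
      where
      ρ₁ = (nat 2 * ν * nat k + β) * (1# + x)
      u₁ = nat 2 * ν * (1# + x * x)
      w₁ = nat k * (β + ν * nat (pred k))

  scalar-combination : ∀ {f₁ f₂ f₃ b₁ b₂ b₃} → f₁ ≈ₛ K b₁ → f₂ ≈ₛ K b₂ → f₃ ≈ₛ K b₃ → ∀ e h₁ h₂ h₃ →
    e ≈ₛ f₁ *ₛ h₁ +ₛ f₂ *ₛ h₂ +ₛ f₃ *ₛ h₃ → ∀ n → e n ≈ b₁ * h₁ n + b₂ * h₂ n + b₃ * h₃ n
  scalar-combination {f₁} {f₂} {f₃} p₁ p₂ p₃ e h₁ h₂ h₃ e≈ n =
    trans (e≈ n) (+-cong (+-cong (scalar f₁ p₁ h₁) (scalar f₂ p₂ h₂)) (scalar f₃ p₃ h₃))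
    where
    scalar : ∀ f {b} → f ≈ₛ K b → ∀ h → (f *ₛ h) n ≈ b * h n
    scalar f {b} f≈ h = trans (ₛ.*-congʳ {h} {f} {K b} f≈ n) (·t^0-* b h n)

  Θ-column : IsColumnSeries Θ
  Θ-column k = scalar-combination
    ((two ⊗ κ ν ⊗ κ (nat k) ⊕ κ β) ⊗ (κ 1# ⊕ κ x))
    (two ⊗ κ ν ⊗ (κ 1# ⊕ κ x ⊗ κ x))
    (κ (nat k) ⊗ (κ β ⊕ κ ν ⊗ κ (nat (pred k))))
    (D (Θ k)) (Θ k) (Θ (suc k)) (Θ (pred k)) (d-Θ k)
    where
    two : 1ₛ +ₛ 1ₛ ≈ₛ K (nat 2)
    two = ₛ.trans (K-+ 1# 1#) (K-cong (+-congˡ (sym (+-identityʳ 1#))))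

  constant-term-* : ∀ p f h → (p *ₛ (f *ₛ h)) 0 ≈ p 0 * (f 0 * h 0)
  constant-term-* p f h = trans (+-identityʳ _) (*-congˡ (+-identityʳ _))

  Θ₀₀≈1 : Θ 0 0 ≈ 1#
  Θ₀₀≈1 = trans (constant-term-* 1ₛ Φ 1ₛ) (trans (*-identityˡ _) (trans (*-identityʳ _) (^ᵣ-0 F α)))

  Θ₀≈0 : ∀ k → Θ (suc k) 0 ≈ 0#
  Θ₀≈0 k = trans (constant-term-* (π (suc k)) Φ (G (suc k)))
    (trans (*-congˡ (trans (*-congˡ (trans (+-identityʳ _) (trans (*-congʳ g-0) (zeroˡ _)))) (zeroʳ _))) (zeroʳ _))

  Θ₀≈Φ : Θ 0 ≈ₛ Φ
  Θ₀≈Φ = ₛ.trans (ₛ.*-identityˡ (Φ *ₛ 1ₛ)) (ₛ.*-identityʳ Φ)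

  egf-A : egf (λ n → eval (A n 0) x) ≈ₛ
    (cos[ a t] -ₛ q •ₛ sin[ a t]) ^ᵣ α
  egf-A n = #0-cancelʳ (nat!#0 n) (trans (egf-inverse (λ n → eval (A n 0) x) n)
    (trans (sym (column-series-unique Θ Θ-column Θ₀₀≈1 Θ₀≈0 n 0)) (*-congʳ (Θ₀≈Φ n))))

-- The two lowest coefficients of a γ-expansion

module GammaExpansion {c ℓ₁ ℓ₂ ℓ₃} (ℝ : RealNumbers c ℓ₁ ℓ₂ ℓ₃) where
  open RealNumbers ℝ hiding (refl; sym; trans)
  open Notions ℝ
  open Polynomials ℝ
  open Order ℝ
  open CommutativeRing realRing using (refl; sym; trans)
  open IntegerSolver realRing
  open S using (_≈ₛ_; Vanishes<)
  open SetoidReasoning setoid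

  coeff-*-0 : ∀ p q → coeff (p *ₚ q) 0 ≈ coeff p 0 * coeff q 0
  coeff-*-0 p q = trans (coeff-* p q 0) (+-identityʳ _)

  coeff-*-1 : ∀ p q → coeff (p *ₚ q) 1 ≈ coeff p 0 * coeff q 1 + coeff p 1 * coeff q 0
  coeff-*-1 p q = trans (coeff-* p q 1) (+-congˡ (+-identityʳ _))

  coeff-[1+X]^-0 : ∀ n → coeff ((1ₚ +ₚ X) ^ₚ n) 0 ≈ 1#
  coeff-[1+X]^-0 zero    = refl
  coeff-[1+X]^-0 (suc n) = trans (coeff-*-0 (1ₚ +ₚ X) ((1ₚ +ₚ X) ^ₚ n)) (trans (*-congˡ (coeff-[1+X]^-0 n))
    (solve 0 ((con (+ 1) :+ con (+ 0)) :* con (+ 1) := con (+ 1)) refl))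

  coeff-[1+X]^-1 : ∀ n → coeff ((1ₚ +ₚ X) ^ₚ n) 1 ≈ nat n
  coeff-[1+X]^-1 zero    = refl
  coeff-[1+X]^-1 (suc n) = trans (coeff-*-1 (1ₚ +ₚ X) ((1ₚ +ₚ X) ^ₚ n))
    (trans (+-cong (*-congˡ (coeff-[1+X]^-1 n)) (*-congˡ (coeff-[1+X]^-0 n)))
      (solve 1 (λ n → (con (+ 1) :+ con (+ 0)) :* n :+ con (+ 1) :* con (+ 1) := con (+ 1) :+ n) refl (nat n)))

  coeff-X^* : ∀ k p → Vanishes< k (coeff (X ^ₚ k *ₚ p))
  coeff-X^* zero    p n ()
  coeff-X^* (suc k) p n n<k = trans (ₚ.*-assoc X (X ^ₚ k) p n) (trans (coeff-* X (X ^ₚ k *ₚ p) n)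
    (S.*ₛ-vanishes-suc {f = coeff (X ^ₚ k *ₚ p)} {coeff X} refl (coeff-X^* k p) n n<k))

  coeff-sum : ∀ n f i → coeff (SeriesP.sum≤ n f) i ≈ S.sum≤ n (λ k → coeff (f k) i)
  coeff-sum zero    f i = coeff-+ (f 0) [] i
  coeff-sum (suc n) f i = trans (coeff-+ (f 0) (SeriesP.sum≤ n (λ k → f (suc k))) i)
    (+-congˡ (coeff-sum n (λ k → f (suc k)) i))

  -- `γ-Positive` carries a degree of its own, which has to be identified with the known one.
  degree-unique : ∀ {p m n} → HasDegree p m → HasDegree p n → m ≡ n
  degree-unique {p} {m} {n} (pₘ#0 , above-m) (pₙ#0 , above-n) with ℕ.<-cmp m n
  ... | tri< m<n _ _ = ⊥-elim (#-irrefl (above-m n m<n) pₙ#0)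
  ... | tri≈ _ m≡n _ = m≡n
  ... | tri> _ _ n<m = ⊥-elim (#-irrefl (above-n m n<m) pₘ#0)

  γ-expansion : (ℕ → Carrier) → ℕ → Poly
  γ-expansion g d = SeriesP.sum≤ ⌊ d /2⌋ (λ k → g k •ₚ (X ^ₚ k *ₚ (1ₚ +ₚ X) ^ₚ (d ℕ.∸ 2 ℕ.* k)))

  -- The terms with k ≥ 2 do not contribute to the two lowest coefficients.
  γ-expansion-coeff₁ : ∀ g d → 2 ℕ.≤ d →
    coeff (γ-expansion g d) 1 ≈ nat d * coeff (γ-expansion g d) 0 + g 1
  γ-expansion-coeff₁ g d@(suc (suc e)) (s≤s (s≤s z≤n)) = begin
    coeff (γ-expansion g d) 1        ≈⟨ coeff-sum ⌊ d /2⌋ t 1 ⟩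
    coeff (t 0) 1 + S.sum≤ ⌊ e /2⌋ (λ k → coeff (t (suc k)) 1)
      ≈⟨ +-cong t₀₁ (rest≈ 1 ⌊ e /2⌋ (s≤s (s≤s z≤n))) ⟩
    g 0 * nat d + coeff (t 1) 1      ≈⟨ +-congˡ t₁₁ ⟩
    g 0 * nat d + g 1
      ≈⟨ solve 3 (λ g d h → g :* d :+ h := d :* (g :+ con (+ 0)) :+ h) refl (g 0) (nat d) (g 1) ⟩
    nat d * (g 0 + 0#) + g 1         ≈⟨ +-congʳ (*-congˡ (+-cong t₀₀ t₁₀)) ⟨
    nat d * (coeff (t 0) 0 + coeff (t 1) 0) + g 1
      ≈⟨ +-congʳ (*-congˡ (trans (coeff-sum ⌊ d /2⌋ t 0) (+-congˡ (rest≈ 0 ⌊ e /2⌋ (s≤s z≤n))))) ⟨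
    nat d * coeff (γ-expansion g d) 0 + g 1 ∎
    where
    b : ℕ → Poly
    b k = (1ₚ +ₚ X) ^ₚ (d ℕ.∸ 2 ℕ.* k)
    t : ℕ → Poly
    t k = g k •ₚ (X ^ₚ k *ₚ b k)
    t-vanishes : ∀ k → Vanishes< k (coeff (t k))
    t-vanishes k i i<k = trans (coeff-• (g k) (X ^ₚ k *ₚ b k) i) (trans (*-congˡ (coeff-X^* k (b k) i i<k)) (zeroʳ _))
    rest≈ : ∀ i n → i ℕ.< 2 → S.sum≤ n (λ k → coeff (t (suc k)) i) ≈ coeff (t 1) i
    rest≈ i zero    i<2 = +-identityʳ _
    rest≈ i (suc n) i<2 = trans (+-congˡ (S.sum≤-0 n (λ k → coeff (t (suc (suc k))) i)
      (λ k → t-vanishes (suc (suc k)) i (ℕ.≤-trans i<2 (s≤s (s≤s z≤n)))))) (+-identityʳ _)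
    t₀ : ∀ i → coeff (t 0) i ≈ g 0 * coeff (b 0) i
    t₀ i = trans (coeff-• (g 0) (1ₚ *ₚ b 0) i) (*-congˡ (ₚ.*-identityˡ (b 0) i))
    t₀₀ : coeff (t 0) 0 ≈ g 0
    t₀₀ = trans (t₀ 0) (trans (*-congˡ (coeff-[1+X]^-0 d)) (*-identityʳ _))
    t₀₁ : coeff (t 0) 1 ≈ g 0 * nat d
    t₀₁ = trans (t₀ 1) (*-congˡ (coeff-[1+X]^-1 d))
    t₁₀ : coeff (t 1) 0 ≈ 0#
    t₁₀ = t-vanishes 1 0 (s≤s z≤n)
    t₁₁ : coeff (t 1) 1 ≈ g 1
    t₁₁ = begin
      coeff (t 1) 1                       ≈⟨ coeff-• (g 1) (X ^ₚ 1 *ₚ b 1) 1 ⟩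
      g 1 * coeff (X ^ₚ 1 *ₚ b 1) 1
        ≈⟨ *-congˡ (trans (coeff-*-1 (X ^ₚ 1) (b 1))
             (+-cong (*-congʳ (ₚ.*-identityʳ X 0)) (*-cong (ₚ.*-identityʳ X 1) (coeff-[1+X]^-0 (d ℕ.∸ 2))))) ⟩
      g 1 * (0# * coeff (b 1) 1 + 1# * 1#)
        ≈⟨ solve 2 (λ g b → g :* (con (+ 0) :* b :+ con (+ 1) :* con (+ 1)) := g) refl (g 1) (coeff (b 1) 1) ⟩
      g 1                                 ∎

  -- The difference is the γ-coefficient of index 1. Its sign is guaranteed only for indices up to
  -- ⌊n/2⌋, hence the bound on n.
  γ-positive⇒coeff₁ : ∀ {f n} → 2 ℕ.≤ n → HasDegree f n → γ-Positive f → 0# ≤ coeff f 1 - nat n * coeff f 0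
  γ-positive⇒coeff₁ {f} {n} 2≤n f-degree (m , f-degree′ , _ , g , f≈ , 0≤g)
    with degree-unique {f} f-degree f-degree′
  ... | ≡.refl = ≤-resp eq (0≤g 1 (ℕ.⌊n/2⌋-mono 2≤n))
    where
    eq : g 1 ≈ coeff f 1 - nat n * coeff f 0
    eq = begin
      g 1
        ≈⟨ solve 2 (λ g z → g := z :+ g :- z) refl (g 1) (nat n * coeff (γ-expansion g n) 0) ⟩
      nat n * coeff (γ-expansion g n) 0 + g 1 - nat n * coeff (γ-expansion g n) 0
        ≈⟨ +-congʳ (γ-expansion-coeff₁ g n 2≤n) ⟨
      coeff (γ-expansion g n) 1 - nat n * coeff (γ-expansion g n) 0
        ≈⟨ +-cong (f≈ 1) (-‿cong (*-congˡ (f≈ 0))) ⟨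
      coeff f 1 - nat n * coeff f 0 ∎

-- Sign of the γ-coefficient of index 1

module LowCoefficients {c ℓ₁ ℓ₂ ℓ₃} (ℝ : RealNumbers c ℓ₁ ℓ₂ ℓ₃)
  (β ν : RealNumbers.Carrier ℝ) (0<β : RealNumbers._<_ ℝ (RealNumbers.0# ℝ) β)
  (0<ν : RealNumbers._<_ ℝ (RealNumbers.0# ℝ) ν) where
  open RealNumbers ℝ hiding (refl; sym; trans)
  open Notions ℝ
  open Polynomials ℝ
  open Order ℝ
  open GammaExpansion ℝ
  open PolynomialArray ℝ β ν
  open NonNegative (<⇒0≤ 0<β) (<⇒0≤ 0<ν) using (A-nonNeg; ω-0≤)
  open CommutativeRing realRing using (refl; sym; trans)
  open IntegerSolver realRing
  open SetoidReasoning setoid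

  ρ₀ ω₀ : ℕ → Carrier
  ρ₀ k = nat 2 * ν * nat k + β
  ω₀ k = nat k * (β + ν * nat (pred k))

  ρ₀-0≤ : ∀ k → 0# ≤ ρ₀ k
  ρ₀-0≤ k = +-0≤ (*-0≤ (*-0≤ (nat-0≤ 2) (<⇒0≤ 0<ν)) (nat-0≤ k)) (<⇒0≤ 0<β)

  2ν-0≤ : 0# ≤ nat 2 * ν
  2ν-0≤ = *-0≤ (nat-0≤ 2) (<⇒0≤ 0<ν)

  c₀ c₁ : ℕ → ℕ → Carrier
  c₀ n k = coeff (A n k) 0
  c₁ n k = coeff (A n k) 1

  c₀-0≤ : ∀ n k → 0# ≤ c₀ n k
  c₀-0≤ n k = A-nonNeg n k 0

  u-0 : coeff u 0 ≈ nat 2 * ν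
  u-0 = trans (coeff-• (nat 2 * ν) (1ₚ +ₚ X ^ₚ 2) 0) (trans (*-congˡ (+-congˡ (coeff-*-0 X (X *ₚ 1ₚ))))
    (solve 2 (λ m z → m :* (con (+ 1) :+ con (+ 0) :* z) := m) refl (nat 2 * ν) (coeff (X *ₚ 1ₚ) 0)))

  u-1 : coeff u 1 ≈ 0#
  u-1 = trans (coeff-• (nat 2 * ν) (1ₚ +ₚ X ^ₚ 2) 1) (trans (*-congˡ (trans (coeff-+ 1ₚ (X ^ₚ 2) 1)
    (+-congˡ (trans (coeff-*-1 X (X *ₚ 1ₚ)) (+-congˡ (*-congˡ (coeff-*-0 X 1ₚ)))))))
    (solve 2 (λ m z → m :* (con (+ 0) :+ (con (+ 0) :* z :+ con (+ 1) :* (con (+ 0) :* con (+ 1)))) := con (+ 0))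
         refl (nat 2 * ν) (coeff (X *ₚ 1ₚ) 1)))

  c₀-suc : ∀ n k → c₀ (suc n) k ≈ ρ₀ k * c₀ n k + nat 2 * ν * c₀ n (suc k) + ω₀ k * c₀ n (pred k)
  c₀-suc n k = trans (trans (A-suc n k 0) (coeff-+ (r k *ₚ A n k +ₚ u *ₚ A n (suc k)) (w k *ₚ A n (pred k)) 0))
    (+-cong (trans (coeff-+ (r k *ₚ A n k) (u *ₚ A n (suc k)) 0) (+-cong
      (trans (coeff-*-0 (r k) (A n k)) (*-congʳ (solve 1 (λ p → p :* (con (+ 1) :+ con (+ 0)) := p) refl (ρ₀ k))))
      (trans (coeff-*-0 u (A n (suc k))) (*-congʳ u-0))))
      (coeff-*-0 (w k) (A n (pred k))))

  c₁-suc : ∀ n k → c₁ (suc n) k ≈ ρ₀ k * (c₁ n k + c₀ n k) + nat 2 * ν * c₁ n (suc k) + ω₀ k * c₁ n (pred k)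
  c₁-suc n k = trans (trans (A-suc n k 1) (coeff-+ (r k *ₚ A n k +ₚ u *ₚ A n (suc k)) (w k *ₚ A n (pred k)) 1))
    (+-cong (trans (coeff-+ (r k *ₚ A n k) (u *ₚ A n (suc k)) 1) (+-cong
      (trans (coeff-*-1 (r k) (A n k)) (solve 3 (λ p a b → p :* (con (+ 1) :+ con (+ 0)) :* a :+ p :* con (+ 1) :* b :=
           p :* (a :+ b)) refl (ρ₀ k) (c₁ n k) (c₀ n k)))
      (trans (coeff-*-1 u (A n (suc k))) (trans (+-cong (*-congʳ u-0) (*-congʳ u-1))
        (solve 3 (λ m a b → m :* a :+ con (+ 0) :* b := m :* a) refl (nat 2 * ν) (c₁ n (suc k)) (c₀ n (suc k)))))))
      (trans (coeff-*-1 (w k) (A n (pred k))) (solve 3 (λ w a b → w :* a :+ con (+ 0) :* b := w :* a)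
           refl (ω₀ k) (c₁ n (pred k)) (c₀ n (pred k)))))

  -- In the expansion of A n k in the products (1 + x)ⁱ (1 + x²)ʲ with i + 2j = n - k,
  -- this is twice the sum of the coefficients weighted by j.
  excess : ℕ → ℕ → Carrier
  excess n k = (nat n - nat k) * c₀ n k - c₁ n k

  -- A factor 1 + x raises the degree by one and the coefficient of x by the constant term, so the
  -- excess is unchanged. A factor 1 + x² raises the degree by two and leaves the coefficient of x
  -- alone, which adds twice the constant term.
  excess-suc : ∀ n k → excess (suc n) k ≈ ρ₀ k * excess n k
    + nat 2 * ν * (excess n (suc k) + nat 2 * c₀ n (suc k)) + ω₀ k * excess n (pred k)
  excess-suc n k = trans (+-cong (*-congˡ (c₀-suc n k)) (-‿cong (c₁-suc n k))) (by-column k)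
    where
    by-column : ∀ k → (nat (suc n) - nat k) * (ρ₀ k * c₀ n k + nat 2 * ν * c₀ n (suc k) + ω₀ k * c₀ n (pred k))
      - (ρ₀ k * (c₁ n k + c₀ n k) + nat 2 * ν * c₁ n (suc k) + ω₀ k * c₁ n (pred k)) ≈
      ρ₀ k * excess n k + nat 2 * ν * (excess n (suc k) + nat 2 * c₀ n (suc k)) + ω₀ k * excess n (pred k)
    by-column zero    = solve 8 (λ n p m a b a′ b′ z →
      ((con (+ 1) :+ n) :- con (+ 0)) :* (p :* a :+ m :* a′ :+ con (+ 0) :* z :* a) :-
           (p :* (b :+ a) :+ m :* b′ :+ con (+ 0) :* z :* b) :=
      p :* ((n :- con (+ 0)) :* a :- b) :+ m :*
           ((n :- (con (+ 1) :+ con (+ 0))) :* a′ :- b′ :+ (con (+ 1) :+ (con (+ 1) :+ con (+ 0))) :* a′)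
        :+ con (+ 0) :* z :* ((n :- con (+ 0)) :* a :- b))
      refl (nat n) (ρ₀ 0) (nat 2 * ν) (c₀ n 0) (c₁ n 0) (c₀ n 1) (c₁ n 1) (β + ν * 0#)
    by-column (suc k) = solve 11 (λ n k p m a b a′ b′ w a″ b″ →
      ((con (+ 1) :+ n) :- (con (+ 1) :+ k)) :* (p :* a :+ m :* a′ :+ w :* a″) :-
           (p :* (b :+ a) :+ m :* b′ :+ w :* b″) :=
      p :* ((n :- (con (+ 1) :+ k)) :* a :- b)
        :+ m :* ((n :- (con (+ 1) :+ (con (+ 1) :+ k))) :* a′ :- b′ :+ (con (+ 1) :+ (con (+ 1) :+ con (+ 0))) :* a′)
        :+ w :* ((n :- k) :* a″ :- b″))
      refl (nat n) (nat k) (ρ₀ (suc k)) (nat 2 * ν) (c₀ n (suc k)) (c₁ n (suc k)) (c₀ n (suc (suc k)))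
           (c₁ n (suc (suc k)))
        (ω₀ (suc k)) (c₀ n k) (c₁ n k)

  excess-0≤ : ∀ n k → 0# ≤ excess n k
  excess-0≤ zero    zero    = ≤-resp (solve 0 (con (+ 0) :=
       (con (+ 0) :- con (+ 0)) :* con (+ 1) :- con (+ 0)) refl) 0≤0
  excess-0≤ zero    (suc k) = ≤-resp (solve 1 (λ k → con (+ 0) := (con (+ 0) :- k) :* con (+ 0) :- con (+ 0))
       refl (nat (suc k))) 0≤0
  excess-0≤ (suc n) k       = ≤-resp (sym (excess-suc n k)) (+-0≤ (+-0≤ (*-0≤ (ρ₀-0≤ k) (excess-0≤ n k))
    (*-0≤ 2ν-0≤ (+-0≤ (excess-0≤ n (suc k)) (*-0≤ (nat-0≤ 2) (c₀-0≤ n (suc k))))))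
    (*-0≤ (ω-0≤ k) (excess-0≤ n (pred k))))

  -- Strict positivity is carried by the coefficient β alone: it is `ρ₀ 0` here and `ω₀ 1` in
  -- `c₀-1-pos`; the other terms are only known to be nonnegative.
  c₀-0-pos : ∀ n → 0# < c₀ n 0
  c₀-0-pos zero    = 0<1
  c₀-0-pos (suc n) = <-resp refl (sym (c₀-suc n 0)) (+-pos-0≤ (+-pos-0≤
    (*-pos (<-resp refl (solve 2 (λ b m → b := m :* con (+ 0) :+ b) refl β (nat 2 * ν)) 0<β) (c₀-0-pos n))
    (*-0≤ 2ν-0≤ (c₀-0≤ n 1))) (*-0≤ (ω-0≤ 0) (c₀-0≤ n 0)))

  c₀-1-pos : ∀ n → 0# < c₀ (suc n) 1
  c₀-1-pos n = <-resp refl (trans (+-comm _ _) (sym (c₀-suc n 1))) (+-pos-0≤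
    (*-pos (<-resp refl (solve 2 (λ b v → b := (con (+ 1) :+ con (+ 0)) :* (b :+ v :* con (+ 0)))
         refl β ν) 0<β) (c₀-0-pos n))
    (+-0≤ (*-0≤ (ρ₀-0≤ 1) (c₀-0≤ n 1)) (*-0≤ 2ν-0≤ (c₀-0≤ n 2))))

  -- A factor 1 + x² arises only on the way from column 1 to column 0, and column 1 is first reached
  -- in row 1. So row 2 is the first with positive excess in column 0.
  excess-pos : ∀ n → 0# < excess (suc (suc n)) 0
  excess-pos n = <-resp refl (trans (solve 3 (λ a b c → a :+ (b :+ c) := b :+ a :+ c)
       refl _ _ _) (sym (excess-suc (suc n) 0)))
    (+-pos-0≤ (*-pos (*-pos (nat-pos 1) 0<ν) (<-resp refl (+-comm _ _)
        (+-pos-0≤ (*-pos (nat-pos 1) (c₀-1-pos n)) (excess-0≤ (suc n) 1))))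
      (+-0≤ (*-0≤ (ρ₀-0≤ 0) (excess-0≤ (suc n) 0)) (*-0≤ (ω-0≤ 0) (excess-0≤ (suc n) 0))))

  -- `excess n 0` is minus the γ-coefficient of index 1, so their sum would be both positive and
  -- zero.
  ¬γ-positive : ∀ {f n} → f ≈ₚ A n 0 → 2 ℕ.≤ n → HasDegree f n → ¬ γ-Positive f
  ¬γ-positive {f} {n@(suc (suc m))} f≈ 2≤n@(s≤s (s≤s _)) f-degree f-γ = <.irrefl refl
    (<-resp refl (trans (+-congˡ (+-cong (f≈ 1) (-‿cong (*-congˡ (f≈ 0)))))
        (solve 3 (λ n a b → ((n :- con (+ 0)) :* a :- b) :+ (b :- n :* a) := con (+ 0)) refl (nat n) (c₀ n 0) (c₁ n 0)))
      (+-pos-0≤ (excess-pos m) (γ-positive⇒coeff₁ {f} 2≤n f-degree f-γ)))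
 

-- The theorem, by transfer from column 0 of the array

theorem4p7 :
    ∀ {c ℓ₁ ℓ₂ ℓ₃} (ℝ : RealNumbers c ℓ₁ ℓ₂ ℓ₃) →
    let open RealNumbers ℝ
        open Notions ℝ
        open Series
    in
    (δ : ℕ) → δ ℕ.≥ 1 →
    (β ν : Carrier) → (ν>0 : 0# < ν) →
    (T : ℕ → Poly) →
    T (δ ℕ.∸ 1) ≈ₚ 1ₚ →
    (∀ n → n ℕ.≥ δ ℕ.∸ 1 → HasDegree (T n) (n ℕ.+ 1 ℕ.∸ δ)) →
    (∀ n → n ℕ.≥ δ ℕ.∸ 1 →
      let k = nat (n ℕ.+ 1 ℕ.∸ δ) in
      T (n ℕ.+ 1) ≈ₚ
        ((k * ν) •ₚ X ^ₚ 2 +ₚ β •ₚ X +ₚ const (β + k * ν)) *ₚ T n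
        +ₚ ν •ₚ (-ₚ (X ^ₚ 3) +ₚ X ^ₚ 2 -ₚ X +ₚ 1ₚ) *ₚ derivative (T n)) →
    -- (i)
    (∀ x → (x≠1 : x # 1#) →
      let a = ν * (1# - x) in
      egf (λ n → eval (T (n ℕ.+ δ ℕ.∸ 1)) x) ≈ₛ
        (cos[ a t] -ₛ ((1# + x) / (1# - x) ⟨ #1⇒1-x#0 x≠1 ⟩) •ₛ sin[ a t])
          ^ᵣ (- (β / ν ⟨ pos⇒#0 ν>0 ⟩)))
    ×
    -- (ii)
    SeriesP.HasJFraction (λ n → T (n ℕ.+ δ ℕ.∸ 1))
      (λ i → (nat 2 * ν * nat i + β) •ₚ (1ₚ +ₚ X))
      (λ i → (nat 2 * ν * nat i * (β + ν * (nat i - 1#))) •ₚ (1ₚ +ₚ X ^ₚ 2))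
    ×
    -- (iii)
    (0# ≤ β → StronglyQLogConvex (λ n → T (n ℕ.+ δ ℕ.∸ 1)))
    ×
    -- (iv)
    (∀ n → n ℕ.≥ δ ℕ.+ 2 → 0# ≤ β → ¬ γ-Positive (T n))
theorem4p7 ℝ (suc e) _ β ν ν>0 T T₀≈1 T-degree T-rec = part-i , part-ii , part-iii , part-iv
  where
  open RealNumbers ℝ hiding (refl; sym; trans)
  open Notions ℝ
  open Polynomials ℝ
  open Order ℝ
  open PolynomialArray ℝ β ν
  open CommutativeRing realRing using (refl; sym; trans)
  open IntegerSolver realRing
  open GammaExpansion ℝ using (coeff-*-1)

  F : ℕ → Poly
  F n = T (n ℕ.+ suc e ℕ.∸ 1)

  -- With δ = e + 1 the first index of the sequence is e; the truncated subtraction in `F` does not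
  -- reduce until the successor is moved outward.
  F≡ : ∀ n → F n ≡ T (n ℕ.+ e)
  F≡ n = ≡.cong (λ m → T (m ℕ.∸ 1)) (ℕ.+-suc n e)

  degree≡ : ∀ n → n ℕ.+ e ℕ.+ 1 ℕ.∸ suc e ≡ n
  degree≡ n = ≡.trans (≡.cong (ℕ._∸ suc e) (ℕ.+-comm (n ℕ.+ e) 1)) (ℕ.m+n∸n≡m n e)

  T-next : ∀ n → T (suc n ℕ.+ e) ≈ₚ next n (T (n ℕ.+ e))
  T-next n = ≡.subst₂ (λ m k → T m ≈ₚ next k (T (n ℕ.+ e)))
    (ℕ.+-comm (n ℕ.+ e) 1) (degree≡ n) (T-rec (n ℕ.+ e) (ℕ.m≤n+m e n))

  A≈T : ∀ n → A n 0 ≈ₚ T (n ℕ.+ e)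
  A≈T = column₀-unique (λ n → T (n ℕ.+ e)) T₀≈1 T-next

  A≈F : ∀ n → A n 0 ≈ₚ F n
  A≈F n = ≡.subst (A n 0 ≈ₚ_) (≡.sym (F≡ n)) (A≈T n)

  part-i : ∀ x → (x≠1 : x # 1#) → egf (λ n → eval (F n) x) Series.≈ₛ _
  part-i x x≠1 n = trans (egf-cong (λ n → eval-cong {F n} {A n 0} x (ₚ.sym {A n 0} {F n} (A≈F n))) n) (egf-A n)
    where
    open ExponentialSeries ℝ using (egf-cong)
    open ExponentialGeneratingFunction ℝ β ν ν>0 x x≠1 using (egf-A)

  part-ii : SeriesP.HasJFraction F r s
  part-ii n = proj₁ (A-jFraction n) , λ m m≥N i → trans (proj₂ (A-jFraction n) m m≥N i) (A≈F n i)

  part-iii : 0# ≤ β → StronglyQLogConvex F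
  part-iii 0≤β n (suc a) n>a _ = NonNegCoeffs-resp
    {A (suc n) 0 *ₚ A a 0 -ₚ A n 0 *ₚ A (suc a) 0} {F (n ℕ.+ 1) *ₚ F a -ₚ F n *ₚ F (suc a)}
    (ₚ.+-cong {A (suc n) 0 *ₚ A a 0} {F (n ℕ.+ 1) *ₚ F a} { -ₚ (A n 0 *ₚ A (suc a) 0)} { -ₚ (F n *ₚ F (suc a))}
      (ₚ.*-cong {A (suc n) 0} {F (n ℕ.+ 1)} {A a 0} {F a}
        (≡.subst (λ m → A m 0 ≈ₚ F (n ℕ.+ 1)) (ℕ.+-comm n 1) (A≈F (n ℕ.+ 1))) (A≈F a))
      (ₚ.-‿cong {A n 0 *ₚ A (suc a) 0} {F n *ₚ F (suc a)}
        (ₚ.*-cong {A n 0} {F n} {A (suc a) 0} {F (suc a)} (A≈F n) (A≈F (suc a)))))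
    (stronglyLogConvex (ℕ.<⇒≤ n>a))
    where open NonNegative 0≤β (<⇒0≤ ν>0)

  A₁-coeff₁ : coeff (A 1 0) 1 ≈ β
  A₁-coeff₁ = trans (coeff-+ (r 0 *ₚ 1ₚ +ₚ u *ₚ []) (w 0 *ₚ 1ₚ) 1)
    (trans (+-cong (trans (coeff-+ (r 0 *ₚ 1ₚ) (u *ₚ []) 1) (+-cong (ₚ.*-identityʳ (r 0) 1) (ₚ.zeroʳ u 1)))
         (ₚ.*-identityʳ (w 0) 1))
      (solve 2 (λ b m → (m :* con (+ 0) :+ b) :* con (+ 1) :+ con (+ 0) :+ con (+ 0) := b) refl β (nat 2 * ν)))

  -- The degree hypothesis at index δ says that the coefficient of x in row 1, which is β, is apart
  -- from 0.
  β-pos : 0# ≤ β → 0# < β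
  β-pos = #0⇒pos (#-resp (trans (sym (A≈T 1 1)) A₁-coeff₁) refl
    (≡.subst (λ d → coeff (T (suc e)) d # 0#) (degree≡ 1) (proj₁ (T-degree (suc e) (ℕ.n≤1+n e)))))

  part-iv : ∀ n → n ℕ.≥ suc e ℕ.+ 2 → 0# ≤ β → ¬ γ-Positive (T n)
  part-iv n n≥δ+2 0≤β = ¬γ-positive {T n} {m} T≈A 2≤m (≡.subst (HasDegree (T n)) deg≡ (T-degree n e≤n))
    where
    open LowCoefficients ℝ β ν (β-pos 0≤β) ν>0 using (¬γ-positive)
    m = n ℕ.∸ e
    e≤n : e ℕ.≤ n
    e≤n = ℕ.≤-trans (ℕ.≤-trans (ℕ.n≤1+n e) (ℕ.m≤m+n (suc e) 2)) n≥δ+2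
    n≡ : m ℕ.+ e ≡ n
    n≡ = ℕ.m∸n+n≡m e≤n
    deg≡ : n ℕ.+ 1 ℕ.∸ suc e ≡ m
    deg≡ = ≡.cong (ℕ._∸ suc e) (ℕ.+-comm n 1)
    T≈A : T n ≈ₚ A m 0
    T≈A = ≡.subst (λ k → T k ≈ₚ A m 0) n≡ (ₚ.sym {A m 0} {T (m ℕ.+ e)} (A≈T m))
    2≤m : 2 ℕ.≤ m
    2≤m = ≡.subst (ℕ._≤ m) (ℕ.m+n∸m≡n e 2) (ℕ.∸-monoˡ-≤ e (ℕ.≤-trans (ℕ.n≤1+n (e ℕ.+ 2)) n≥δ+2))
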